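{- Let $p$ be a prime with $p\equiv 9 \pmod{10}$ and let $n$ be a nonnegative integer. Then for every $i\in\{1,2,\ldots,p-1\}$, $$\overline{A}_{25}(5p(pn+i))\equiv 0 \pmod{5}.$$
   Context: An overpartition of $n$ is a partition of $n$ in which the first occurrence of each distinct part may be overlined. For a positive integer $\ell$, $\overline{A}_\ell(n)$ denotes the number of overpartitions of $n$ into parts not divisible by $\ell$, with $\overline{A}_\ell(0)=1$; equivalently $$\sum_{n\ge 0}\overline{A}_\ell(n)q^n=\frac{(q^\ell;q^\ell)_\infty^2(q^2;q^2)_\infty}{(q;q)_\infty^2(q^{2\ell};q^{2\ell})_\infty},\qquad (a;q)_\infty=\prod_{k\ge 0}(1-aq^k).$$ -}

module Defs where

open import Data.Nat using (ℕ; zero; suc; _+_; _*_; _∸_; _≤?_)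
open import Data.Nat.Divisibility using (_∣?_)
open import Data.Bool using (Bool; true; false)
open import Data.List using (List; []; _∷_; _++_; length; replicate; concatMap; upTo)
open import Data.Product using (_×_; _,_)
open import Relation.Nullary using (yes; no)

-- A part of an overpartition: its size together with a flag saying whether
-- it is overlined.  An overpartition is the list of its parts, listed in
-- nonincreasing order of size; among the copies of a given size, at most the
-- first one may be overlined (the first occurrence of each distinct part).
Part : Set
Part = ℕ × Bool

blocks : ℕ → ℕ → List (List Part)
blocks k zero    = [] ∷ []
blocks k (suc m) = ((k , false) ∷ replicate m (k , false))
                 ∷ ((k , true)  ∷ replicate m (k , false)) ∷ []

overparts : ℕ → ℕ → ℕ → List (List Part)
overparts ℓ zero    zero    = [] ∷ []
overparts ℓ zero    (suc n) = []
overparts ℓ (suc k) n with ℓ ∣? suc k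
... | yes _ = overparts ℓ k n
... | no  _ = concatMap choose (upTo (suc n))
  where
    choose : ℕ → List (List Part)
    choose m with m * suc k ≤? n
    ... | no  _ = []
    ... | yes _ = concatMap (λ b → Data.List.map (b ++_) (overparts ℓ k (n ∸ m * suc k)))
                            (blocks (suc k) m)

-- Abar ℓ n : number of overpartitions of n into parts not divisible by ℓ
-- (parts of an overpartition of n are at most n).  Abar ℓ 0 = 1.
Abar : ℕ → ℕ → ℕ
Abar ℓ n = length (overparts ℓ n n)

{-# OPTIONS --safe #-}
module Submission where

-- Write φ = (q;q)²/(q²;q²), so that the overpartitions of n into parts not divisible by 25
-- have generating function φ(q²⁵)/φ(q).  By Frobenius this is φ²⁴ = (φ⁴)⁵ φ⁴ ≡ φ⁴(q⁵) φ⁴ modulo 5.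
-- Logarithmic differentiation together with an identity of Liouville type shows that
-- φ⁴ = 1 − 8 Σ (−1)^{d+e} d q^{de}, and a second one that φ⁸ = 1 + 16 Σ (−1)^d d³ q^{de}.
-- The first formula shows that the coefficients of φ⁴ at 5n and n agree modulo 5, so the
-- coefficient at 5n of the generating function is that of φ⁸ at n.  By the second formula,
-- the latter picks up a factor 1 + p³ ≡ 0 when n = pm with p ∤ m.

open import Defs
open import Data.Nat using (ℕ; _+_; _*_; _%_; _≤_; _<_)
open import Data.Nat.Primality using (Prime)
open import Data.Nat.Divisibility using (_∣_)
open import Relation.Binary.PropositionalEquality using (_≡_)

open import Algebra.Bundles using (CommutativeRing)
import Algebra.Solver.Ring as RingSolver
open import Algebra.Solver.Ring.AlmostCommutativeRing
  using (fromCommutativeRing; _-Raw-AlmostCommutative⟶_)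
open import Data.Integer as ℤ using (ℤ; +_; 0ℤ; 1ℤ)
import Data.Integer.Properties as ℤ
open import Data.Integer.Tactic.RingSolver using (solve-∀)
open import Algebra.Properties.AbelianGroup ℤ.+-0-abelianGroup using () renaming (∙-cancelˡ to +-cancelˡ)
open import Data.List as List using (List; []; _∷_; _++_; length; concatMap; applyUpTo; upTo)
import Data.List.Properties as List
open import Data.Maybe as Maybe using (Maybe; just; nothing)
open import Data.Nat as ℕ using (zero; suc; z≤n; s≤s)
import Data.Nat.DivMod as ℕ
open import Data.Nat.Divisibility using (_∣?_; divides; ∣m+n∣m⇒∣n; n∣m*n; m∣m*n; ∣⇒≤; 0∣⇒≡0; ∣-trans; ∣-refl)
open import Data.Nat.Induction using (<-rec)
open import Data.Nat.Primality using (prime?; euclidsLemma; prime⇒nonZero)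
import Data.Nat.Properties as ℕ
import Data.Nat.Tactic.RingSolver as ℕ-Solver
open import Data.Product using (∃; _,_; proj₁; proj₂)
open import Data.Sum using (_⊎_; inj₁; inj₂)
open import Function using (_∘_)
open import Level using (0ℓ)
open import Relation.Nullary using (¬_; Dec; yes; no; contradiction)
open import Relation.Nullary.Decidable using (toWitness)
open import Relation.Binary.PropositionalEquality
  using (refl; sym; trans; cong; cong₂; subst; _≢_; module ≡-Reasoning)
import Relation.Binary.Reasoning.Setoid as SetoidReasoning

-- No series is inverted. `φ` enters through its reciprocal `overpartitions 0`: no positive integer
-- is divisible by 0, so ℓ = 0 counts all overpartitions. A factor (1 + q^j)/(1 - q^j) is encoded by
-- X′ = X + q^j (X + X′), and uniqueness of the solution of f = c + q^j f replaces division by 1 -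
-- q^j. As φ = Σ (-1)^n q^(n²) over all integers n, the formulas for φ⁴ and φ⁸ are the theorems on
-- sums of four and eight squares. Theta functions are avoided: `F` is defined as the divisor
-- series, and comparing logarithmic derivatives shows that it is inverse to the fourth power of
-- `overpartitions 0`. This needs two quadratic relations between divisor sums. Both rest on 4ab =
-- (a + b)² - (a - b)². A product of two divisor sums runs over the solutions of ax + by = n with
-- weight ab times signs. Liouville's substitutions carry the sum with (a + b)² into the sum with (a
-- - b)², except for boundary solutions, which form divisor sums again.

Series : Set
Series = ℕ → ℤ

infix  4 _≐_
infixl 6 _⊕_
infixl 7 _⊗_
infix  8 ⊖_

_≐_ : Series → Series → Set
f ≐ g = ∀ n → f n ≡ g n

tail : Series → Series
tail f = f ∘ suc

-- Arithmetic of formal power series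

_⊕_ : Series → Series → Series
(f ⊕ g) n = f n ℤ.+ g n

⊖_ : Series → Series
(⊖ f) n = ℤ.- f n

-- The Cauchy product, obtained by writing the left factor as `f 0` plus q times `tail f`. With this
-- recursion a monomial on the left reduces by computation.
_⊗_ : Series → Series → Series
(f ⊗ g) zero    = f 0 ℤ.* g 0
(f ⊗ g) (suc n) = f 0 ℤ.* g (suc n) ℤ.+ (tail f ⊗ g) n

const : ℤ → Series
const c zero    = c
const c (suc n) = 0ℤ

module ⊗-Congruence (_∼_ : ℤ → ℤ → Set)
  (+-cong : ∀ {a b c d} → a ∼ b → c ∼ d → (a ℤ.+ c) ∼ (b ℤ.+ d))
  (*-cong : ∀ {a b c d} → a ∼ b → c ∼ d → (a ℤ.* c) ∼ (b ℤ.* d)) where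

  -- A coefficient of a product depends on finitely many coefficients of the factors. This is what
  -- allows infinite products and divisor sums to be replaced by truncations that may vary with `n`.
  ⊗-cong-upto : ∀ n {f f′ g g′} → (∀ i → i ℕ.≤ n → f i ∼ f′ i) → (∀ i → i ℕ.≤ n → g i ∼ g′ i) →
    (f ⊗ g) n ∼ (f′ ⊗ g′) n
  ⊗-cong-upto zero    p q = *-cong (p 0 ℕ.z≤n) (q 0 ℕ.z≤n)
  ⊗-cong-upto (suc n) p q = +-cong (*-cong (p 0 ℕ.z≤n) (q (suc n) ℕ.≤-refl))
    (⊗-cong-upto n (λ i i≤n → p (suc i) (ℕ.s≤s i≤n)) (λ i i≤n → q i (ℕ.m≤n⇒m≤1+n i≤n)))

  ⊗-cong : ∀ {f f′ g g′} → (∀ n → f n ∼ f′ n) → (∀ n → g n ∼ g′ n) → ∀ n → (f ⊗ g) n ∼ (f′ ⊗ g′) n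
  ⊗-cong p q n = ⊗-cong-upto n (λ i _ → p i) (λ i _ → q i)

open ⊗-Congruence _≡_ (cong₂ ℤ._+_) (cong₂ ℤ._*_) public

⊗-distribʳ : ∀ h f g → (f ⊕ g) ⊗ h ≐ f ⊗ h ⊕ g ⊗ h
⊗-distribʳ h f g zero    = ℤ.*-distribʳ-+ (h 0) (f 0) (g 0)
⊗-distribʳ h f g (suc n) rewrite ⊗-distribʳ h (tail f) (tail g) n =
  lemma (f 0) (g 0) (h (suc n)) _ _
  where
  lemma : ∀ a b c u v → (a ℤ.+ b) ℤ.* c ℤ.+ (u ℤ.+ v) ≡ (a ℤ.* c ℤ.+ u) ℤ.+ (b ℤ.* c ℤ.+ v)
  lemma = solve-∀

scale-⊗ : ∀ c f g → (λ n → c ℤ.* f n) ⊗ g ≐ λ n → c ℤ.* (f ⊗ g) n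
scale-⊗ c f g zero    = ℤ.*-assoc c (f 0) (g 0)
scale-⊗ c f g (suc n) rewrite scale-⊗ c (tail f) g n = lemma c (f 0) (g (suc n)) _
  where
  lemma : ∀ c a b u → c ℤ.* a ℤ.* b ℤ.+ c ℤ.* u ≡ c ℤ.* (a ℤ.* b ℤ.+ u)
  lemma = solve-∀

⊗-sucʳ : ∀ f g n → (f ⊗ g) (suc n) ≡ f (suc n) ℤ.* g 0 ℤ.+ (f ⊗ tail g) n
⊗-sucʳ f g zero    = ℤ.+-comm (f 0 ℤ.* g 1) _
⊗-sucʳ f g (suc n) rewrite ⊗-sucʳ (tail f) g n = lemma (f 0 ℤ.* g (suc (suc n)))
    (f (suc (suc n)) ℤ.* g 0) _
  where
  lemma : ∀ a b c → a ℤ.+ (b ℤ.+ c) ≡ b ℤ.+ (a ℤ.+ c)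
  lemma = solve-∀

⊗-comm : ∀ f g → f ⊗ g ≐ g ⊗ f
⊗-comm f g zero    = ℤ.*-comm (f 0) (g 0)
⊗-comm f g (suc n) = begin
  f 0 ℤ.* g (suc n) ℤ.+ (tail f ⊗ g) n ≡⟨ cong₂ ℤ._+_ (ℤ.*-comm (f 0) _) (⊗-comm (tail f) g n) ⟩
  g (suc n) ℤ.* f 0 ℤ.+ (g ⊗ tail f) n ≡⟨ ⊗-sucʳ g f n ⟨
  (g ⊗ f) (suc n)                      ∎
  where open ≡-Reasoning

⊗-assoc : ∀ f g h → (f ⊗ g) ⊗ h ≐ f ⊗ (g ⊗ h)
⊗-assoc f g h zero    = ℤ.*-assoc (f 0) (g 0) (h 0)
⊗-assoc f g h (suc n)
  rewrite ⊗-distribʳ h (λ k → f 0 ℤ.* tail g k) (tail f ⊗ g) n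
        | scale-⊗ (f 0) (tail g) h n
        | ⊗-assoc (tail f) g h n = lemma (f 0) (g 0) (h (suc n)) _ _
  where
  lemma : ∀ a b c u v → a ℤ.* b ℤ.* c ℤ.+ (a ℤ.* u ℤ.+ v) ≡ a ℤ.* (b ℤ.* c ℤ.+ u) ℤ.+ v
  lemma = solve-∀

0*-when : ∀ {a} b → a ≡ 0ℤ → a ℤ.* b ≡ 0ℤ
0*-when b refl = refl

-- The sums run over the solutions of a x + b y = N.  The substitutions that add b to a and
-- subtract x from y permute these solutions up to the boundary cases a = b and x = y; the
-- weight w becomes W, which is invariant under the substitution used in W-shear.
zero-⊗ : ∀ {f} g n → (∀ i → f i ≡ 0ℤ) → (f ⊗ g) n ≡ 0ℤ
zero-⊗ g zero    p = 0*-when (g 0) (p 0)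
zero-⊗ g (suc n) p = trans (cong₂ ℤ._+_ (0*-when (g (suc n)) (p 0)) (zero-⊗ g n (p ∘ suc))) refl

const-⊗ : ∀ c f n → (const c ⊗ f) n ≡ c ℤ.* f n
const-⊗ c f zero    = refl
const-⊗ c f (suc n) = trans (cong (λ z → c ℤ.* f (suc n) ℤ.+ z) (zero-⊗ f n λ _ → refl))
    (ℤ.+-identityʳ _)

const-⊗-const : ∀ a b → const a ⊗ const b ≐ const (a ℤ.* b)
const-⊗-const a b zero    = refl
const-⊗-const a b (suc n) = trans (const-⊗ a (const b) (suc n)) (ℤ.*-zeroʳ a)

-- The coefficient relation is a parameter so that one construction yields both the ring of series
-- over the integers and the same carrier with coefficients compared modulo 5.
module SeriesSolver (_∼_ : ℤ → ℤ → Set)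
  (∼-refl : ∀ {a} → a ∼ a) (∼-sym : ∀ {a b} → a ∼ b → b ∼ a)
  (∼-trans : ∀ {a b c} → a ∼ b → b ∼ c → a ∼ c)
  (+-cong : ∀ {a b c d} → a ∼ b → c ∼ d → (a ℤ.+ c) ∼ (b ℤ.+ d))
  (*-cong : ∀ {a b c d} → a ∼ b → c ∼ d → (a ℤ.* c) ∼ (b ℤ.* d))
  (-‿cong : ∀ {a b} → a ∼ b → (ℤ.- a) ∼ (ℤ.- b))
  (_∼?_ : ∀ a b → Maybe (a ∼ b)) where

  ≡⇒∼ : ∀ {a b} → a ≡ b → a ∼ b
  ≡⇒∼ refl = ∼-refl

  ring : CommutativeRing 0ℓ 0ℓ
  ring = record
    { Carrier = Series
    ; _≈_ = λ f g → ∀ n → f n ∼ g n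
    ; _+_ = _⊕_
    ; _*_ = _⊗_
    ; -_ = ⊖_
    ; 0# = const 0ℤ
    ; 1# = const 1ℤ
    ; isCommutativeRing = record
      { isRing = record
        { +-isAbelianGroup = record
          { isGroup = record
            { isMonoid = record
              { isSemigroup = record
                { isMagma = record
                  { isEquivalence = record
                    { refl = λ _ → ∼-refl
                    ; sym = λ p n → ∼-sym (p n)
                    ; trans = λ p q n → ∼-trans (p n) (q n)
                    }
                  ; ∙-cong = λ p q n → +-cong (p n) (q n)
                  }
                ; assoc = λ f g h n → ≡⇒∼ (ℤ.+-assoc (f n) (g n) (h n))
                }
              ; identity = (λ f n → ≡⇒∼ (identityˡ f n))
                         , (λ f n → ≡⇒∼ (trans (ℤ.+-comm (f n) _) (identityˡ f n)))
              }
            ; inverse = (λ f n → ≡⇒∼ (trans (ℤ.+-inverseˡ (f n)) (const-0 n)))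
                      , (λ f n → ≡⇒∼ (trans (ℤ.+-inverseʳ (f n)) (const-0 n)))
            ; ⁻¹-cong = λ p n → -‿cong (p n)
            }
          ; comm = λ f g n → ≡⇒∼ (ℤ.+-comm (f n) (g n))
          }
        ; *-cong = M.⊗-cong
        ; *-assoc = λ f g h n → ≡⇒∼ (⊗-assoc f g h n)
        ; *-identity = (λ f n → ≡⇒∼ (one-⊗ f n))
                     , (λ f n → ≡⇒∼ (trans (⊗-comm f (const 1ℤ) n) (one-⊗ f n)))
        ; distrib = (λ f g h n → ≡⇒∼ (distribˡ f g h n)) , (λ f g h n → ≡⇒∼ (⊗-distribʳ f g h n))
        }
      ; *-comm = λ f g n → ≡⇒∼ (⊗-comm f g n)
      }
    }
    where
    module M = ⊗-Congruence _∼_ +-cong *-cong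
    const-0 : ∀ n → 0ℤ ≡ const 0ℤ n
    const-0 zero    = refl
    const-0 (suc n) = refl
    identityˡ : ∀ f → const 0ℤ ⊕ f ≐ f
    identityˡ f zero    = ℤ.+-identityˡ _
    identityˡ f (suc n) = ℤ.+-identityˡ _
    one-⊗ : ∀ f → const 1ℤ ⊗ f ≐ f
    one-⊗ f n = trans (const-⊗ 1ℤ f n) (ℤ.*-identityˡ _)
    distribˡ : ∀ f g h → f ⊗ (g ⊕ h) ≐ f ⊗ g ⊕ f ⊗ h
    distribˡ f g h n = trans (⊗-comm f (g ⊕ h) n)
      (trans (⊗-distribʳ f g h n) (cong₂ ℤ._+_ (⊗-comm g f n) (⊗-comm h f n)))

  constants : CommutativeRing.rawRing ℤ.+-*-commutativeRing -Raw-AlmostCommutative⟶ fromCommutativeRing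
      ring
  constants = record
    { ⟦_⟧ = const
    ; +-homo = λ { a b zero → ∼-refl ; a b (suc n) → ∼-refl }
    ; *-homo = λ a b n → ∼-sym (≡⇒∼ (const-⊗-const a b n))
    ; -‿homo = λ { a zero → ∼-refl ; a (suc n) → ∼-refl }
    ; 0-homo = λ _ → ∼-refl
    ; 1-homo = λ _ → ∼-refl
    }

  equal-constants? : ∀ a b → Maybe (∀ n → const a n ∼ const b n)
  equal-constants? a b = Maybe.map (λ a∼b → λ { zero → a∼b ; (suc n) → ∼-refl }) (a ∼? b)

  open RingSolver _ (fromCommutativeRing ring) constants equal-constants? public
    using (solve; _:=_; _:+_; _:*_; :-_; con)

  open CommutativeRing ring public using (setoid)

-- Congruences modulo 5

infix 4 _≡₅_

record _≡₅_ (a b : ℤ) : Set where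
  constructor mod₅
  field
    quot : ℤ
    eq   : a ≡ b ℤ.+ + 5 ℤ.* quot

≡₅-refl : ∀ {a} → a ≡₅ a
≡₅-refl {a} = mod₅ 0ℤ (sym (ℤ.+-identityʳ a))

≡₅-sym : ∀ {a b} → a ≡₅ b → b ≡₅ a
≡₅-sym {b = b} (mod₅ k refl) = mod₅ (ℤ.- k) (lemma b k)
  where
  lemma : ∀ b k → b ≡ b ℤ.+ + 5 ℤ.* k ℤ.+ + 5 ℤ.* (ℤ.- k)
  lemma = solve-∀

≡₅-trans : ∀ {a b c} → a ≡₅ b → b ≡₅ c → a ≡₅ c
≡₅-trans {c = c} (mod₅ k refl) (mod₅ l refl) = mod₅ (l ℤ.+ k) (lemma c k l)
  where
  lemma : ∀ c k l → c ℤ.+ + 5 ℤ.* l ℤ.+ + 5 ℤ.* k ≡ c ℤ.+ + 5 ℤ.* (l ℤ.+ k)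
  lemma = solve-∀

+-cong₅ : ∀ {a b c d} → a ≡₅ b → c ≡₅ d → a ℤ.+ c ≡₅ b ℤ.+ d
+-cong₅ {b = b} {d = d} (mod₅ k refl) (mod₅ l refl) = mod₅ (k ℤ.+ l) (lemma b d k l)
  where
  lemma : ∀ b d k l → b ℤ.+ + 5 ℤ.* k ℤ.+ (d ℤ.+ + 5 ℤ.* l) ≡ b ℤ.+ d ℤ.+ + 5 ℤ.* (k ℤ.+ l)
  lemma = solve-∀

*-cong₅ : ∀ {a b c d} → a ≡₅ b → c ≡₅ d → a ℤ.* c ≡₅ b ℤ.* d
*-cong₅ {b = b} {d = d} (mod₅ k refl) (mod₅ l refl) =
  mod₅ (b ℤ.* l ℤ.+ k ℤ.* d ℤ.+ + 5 ℤ.* k ℤ.* l) (lemma b d k l)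
  where
  lemma : ∀ b d k l → (b ℤ.+ + 5 ℤ.* k) ℤ.* (d ℤ.+ + 5 ℤ.* l) ≡
    b ℤ.* d ℤ.+ + 5 ℤ.* (b ℤ.* l ℤ.+ k ℤ.* d ℤ.+ + 5 ℤ.* k ℤ.* l)
  lemma = solve-∀

-‿cong₅ : ∀ {a b} → a ≡₅ b → ℤ.- a ≡₅ ℤ.- b
-‿cong₅ {b = b} (mod₅ k refl) = mod₅ (ℤ.- k) (lemma b k)
  where
  lemma : ∀ b k → ℤ.- (b ℤ.+ + 5 ℤ.* k) ≡ ℤ.- b ℤ.+ + 5 ℤ.* (ℤ.- k)
  lemma = solve-∀

_≟₅_ : ∀ a b → Maybe (a ≡₅ b)
a ≟₅ b with (a ℤ.- b) ℤ./ + 5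
... | k with a ℤ.≟ b ℤ.+ + 5 ℤ.* k
... | yes eq = just (mod₅ k eq)
... | no _   = nothing

_≟_ : ∀ a b → Maybe (a ≡ b)
_≟_ a b with a ℤ.≟ b
... | yes eq = just eq
... | no _   = nothing

module Exact = SeriesSolver _≡_ refl sym trans (cong₂ ℤ._+_) (cong₂ ℤ._*_) (cong (ℤ.-_)) _≟_

-- Coefficients are compared modulo 5, so this solver proves (f + g)⁵ ≡ f⁵ + g⁵.
module Mod₅ = SeriesSolver _≡₅_ ≡₅-refl ≡₅-sym ≡₅-trans +-cong₅ *-cong₅ -‿cong₅ _≟₅_

-- Finite sums over positive integers

-- Summation starts at 1.
∑ : ℕ → (ℕ → ℤ) → ℤ
∑ zero    f = 0ℤ
∑ (suc N) f = f 1 ℤ.+ ∑ N (f ∘ suc)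

∑₂ : ℕ → (ℕ → ℕ → ℤ) → ℤ
∑₂ N h = ∑ N λ x → ∑ N λ y → h x y

∑-cong : ∀ N {f g} → (∀ i → f (suc i) ≡ g (suc i)) → ∑ N f ≡ ∑ N g
∑-cong zero    p = refl
∑-cong (suc N) p = cong₂ ℤ._+_ (p 0) (∑-cong N (p ∘ suc))

∑-zero : ∀ N {f} → (∀ i → f (suc i) ≡ 0ℤ) → ∑ N f ≡ 0ℤ
∑-zero zero    p = refl
∑-zero (suc N) p = cong₂ ℤ._+_ (p 0) (∑-zero N (p ∘ suc))

∑-+ : ∀ N f g → ∑ N (λ i → f i ℤ.+ g i) ≡ ∑ N f ℤ.+ ∑ N g
∑-+ zero    f g = refl
∑-+ (suc N) f g rewrite ∑-+ N (f ∘ suc) (g ∘ suc) = lemma (f 1) (g 1) _ _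
  where
  lemma : ∀ a b c d → a ℤ.+ b ℤ.+ (c ℤ.+ d) ≡ a ℤ.+ c ℤ.+ (b ℤ.+ d)
  lemma = solve-∀

∑-*ˡ : ∀ N c f → ∑ N (λ i → c ℤ.* f i) ≡ c ℤ.* ∑ N f
∑-*ˡ zero    c f = sym (ℤ.*-zeroʳ c)
∑-*ˡ (suc N) c f = trans (cong (λ z → c ℤ.* f 1 ℤ.+ z) (∑-*ˡ N c (f ∘ suc)))
    (sym (ℤ.*-distribˡ-+ c (f 1) _))

∑-last : ∀ N f → ∑ (suc N) f ≡ ∑ N f ℤ.+ f (suc N)
∑-last zero    f = ℤ.+-comm (f 1) 0ℤ
∑-last (suc N) f = trans (cong (λ z → f 1 ℤ.+ z) (∑-last N (f ∘ suc))) (sym (ℤ.+-assoc (f 1) _ _))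

∑-extend : ∀ {M N} f → M ℕ.≤ N → (∀ i → M ℕ.≤ i → f (suc i) ≡ 0ℤ) → ∑ N f ≡ ∑ M f
∑-extend {N = N} f z≤n p = ∑-zero N (λ i → p i z≤n)
∑-extend f (s≤s M≤N) p =
  cong (λ z → f 1 ℤ.+ z) (∑-extend (f ∘ suc) M≤N (λ i M≤i → p (suc i) (s≤s M≤i)))

∑-swap : ∀ M N (h : ℕ → ℕ → ℤ) → (∑ M λ x → ∑ N λ y → h x y) ≡ (∑ N λ y → ∑ M λ x → h x y)
∑-swap zero    N h = sym (∑-zero N λ _ → refl)
∑-swap (suc M) N h = trans (cong (λ z → ∑ N (h 1) ℤ.+ z) (∑-swap M N (λ x → h (suc x))))
  (sym (∑-+ N (h 1) (λ y → ∑ M λ x → h (suc x) y)))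

∑₂-cong : ∀ N {g h} → (∀ x y → g (suc x) (suc y) ≡ h (suc x) (suc y)) → ∑₂ N g ≡ ∑₂ N h
∑₂-cong N p = ∑-cong N λ x → ∑-cong N λ y → p x y

∑₂-+ : ∀ N g h → ∑₂ N (λ x y → g x y ℤ.+ h x y) ≡ ∑₂ N g ℤ.+ ∑₂ N h
∑₂-+ N g h = trans (∑-cong N λ x → ∑-+ N (g (suc x)) (h (suc x)))
  (∑-+ N (λ x → ∑ N λ y → g x y) (λ x → ∑ N λ y → h x y))

∑₂-*ˡ : ∀ N c h → ∑₂ N (λ x y → c ℤ.* h x y) ≡ c ℤ.* ∑₂ N h
∑₂-*ˡ N c h = trans (∑-cong N λ x → ∑-*ˡ N c (h (suc x))) (∑-*ˡ N c (λ x → ∑ N λ y → h x y))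

∑₂-swap : ∀ N h → ∑₂ N h ≡ ∑₂ N (λ x y → h y x)
∑₂-swap N h = ∑-swap N N h

∑₂-extend : ∀ {M N} h → M ℕ.≤ N → (∀ x y → M ℕ.≤ x → h (suc x) (suc y) ≡ 0ℤ) →
  (∀ x y → M ℕ.≤ y → h (suc x) (suc y) ≡ 0ℤ) → ∑₂ N h ≡ ∑₂ M h
∑₂-extend {M} {N} h M≤N p q =
  trans (∑-cong N λ x → ∑-extend (h (suc x)) M≤N (q x))
        (∑-extend (λ x → ∑ M (h x)) M≤N (λ x M≤x → ∑-zero M λ y → p x y M≤x))

-- Substituting x + z for the larger variable while z still ranges up to `N` makes the new sums
-- leave the box. The two vanishing hypotheses make the excess terms zero, so all ranges can stay
-- equal to `N`.
∑₂-trichotomy : ∀ N h → (∀ x y → N ℕ.≤ x → h (suc x) (suc y) ≡ 0ℤ) →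
  (∀ x y → N ℕ.≤ y → h (suc x) (suc y) ≡ 0ℤ) →
  ∑₂ N h ≡ ∑ N (λ x → h x x) ℤ.+ ∑₂ N (λ x z → h x (x ℕ.+ z)) ℤ.+ ∑₂ N (λ y z → h (y ℕ.+ z) y)
∑₂-trichotomy zero    h p q = refl
∑₂-trichotomy (suc N) h p q = begin
  h 1 1 ℤ.+ row ℤ.+ ∑ N (λ x → h (suc x) 1 ℤ.+ ∑ N (h′ x))
    ≡⟨ cong (λ z → h 1 1 ℤ.+ row ℤ.+ z) (∑-+ N (λ x → h (suc x) 1) (λ x → ∑ N (h′ x))) ⟩
  h 1 1 ℤ.+ row ℤ.+ (column ℤ.+ ∑₂ N h′)
    ≡⟨ cong (λ z → h 1 1 ℤ.+ row ℤ.+ (column ℤ.+ z))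
         (∑₂-trichotomy N h′ (λ x y N≤x → p (suc x) (suc y) (s≤s N≤x))
             (λ x y N≤y → q (suc x) (suc y) (s≤s N≤y))) ⟩
  h 1 1 ℤ.+ row ℤ.+ (column ℤ.+ (diagonal ℤ.+ ∑₂ N upper ℤ.+ ∑₂ N lower))
    ≡⟨ rearrange (h 1 1) row column diagonal _ _ ⟩
  h 1 1 ℤ.+ diagonal ℤ.+ (row ℤ.+ ∑₂ N upper) ℤ.+ (column ℤ.+ ∑₂ N lower)
    ≡⟨ cong₂ (λ u v → h 1 1 ℤ.+ diagonal ℤ.+ u ℤ.+ v)
         (cong₂ ℤ._+_ (sym (∑-extend (λ z → h 1 (suc z)) (ℕ.n≤1+n N) λ z N≤z → q 0 (suc z) (s≤s N≤z)))
           (∑-cong N λ x → sym (∑-extend (upper (suc x)) (ℕ.n≤1+n N)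
             λ z N≤z → q (suc x) (suc x ℕ.+ suc z)
                 (s≤s (ℕ.≤-trans N≤z (ℕ.≤-trans (ℕ.n≤1+n z) (ℕ.m≤n+m (suc z) x)))))))
         (cong₂ ℤ._+_ (sym (∑-extend (λ z → h (suc z) 1) (ℕ.n≤1+n N) λ z N≤z → p (suc z) 0 (s≤s N≤z)))
           (∑-cong N λ y → sym (∑-extend (lower (suc y)) (ℕ.n≤1+n N)
             λ z N≤z → p (suc y ℕ.+ suc z) (suc y)
                 (s≤s (ℕ.≤-trans N≤z (ℕ.≤-trans (ℕ.n≤1+n z) (ℕ.m≤n+m (suc z) y))))))) ⟩
  _ ∎
  where
  open ≡-Reasoning
  h′ : ℕ → ℕ → ℤ
  h′ x y = h (suc x) (suc y)
  row column diagonal : ℤ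
  row      = ∑ N (λ y → h 1 (suc y))
  column   = ∑ N (λ x → h (suc x) 1)
  diagonal = ∑ N (λ x → h′ x x)
  upper lower : ℕ → ℕ → ℤ
  upper x z = h′ x (x ℕ.+ z)
  lower y z = h′ (y ℕ.+ z) y
  rearrange : ∀ a b c d e f → a ℤ.+ b ℤ.+ (c ℤ.+ (d ℤ.+ e ℤ.+ f)) ≡ a ℤ.+ d ℤ.+ (b ℤ.+ e) ℤ.+ (c ℤ.+ f)
  rearrange = solve-∀

-- Pairs of positive integers are grouped by their total d, which leaves the first entry running
-- from 1 to d - 1; totals above `N` contribute nothing by hypothesis.
∑₂-by-total : ∀ N (k : ℕ → ℕ → ℤ) → (∀ d a → N ℕ.< d → k d (suc a) ≡ 0ℤ) →
  ∑₂ N (λ a b → k (a ℕ.+ b) a) ≡ ∑ N (λ d → ∑ (ℕ.pred d) (k d))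
∑₂-by-total zero    k p = refl
∑₂-by-total (suc N) k p = begin
  row (suc N) ℤ.+ ∑ N (λ a → ∑ (suc N) λ b → k (suc (a ℕ.+ b)) (suc a))
    ≡⟨ cong₂ ℤ._+_
        (∑-extend (λ b → k (suc b) 1) (ℕ.n≤1+n N) λ b N≤b → p (suc (suc b)) 0 (s≤s (s≤s N≤b)))
         (∑-cong N λ a → ∑-extend (λ b → k (suc (suc a ℕ.+ b)) (suc (suc a))) (ℕ.n≤1+n N)
           λ b N≤b → p (suc (suc a ℕ.+ suc b)) (suc a)
             (s≤s (s≤s (ℕ.≤-trans N≤b (ℕ.≤-trans (ℕ.n≤1+n b) (ℕ.m≤n+m (suc b) a)))))) ⟩
  row N ℤ.+ ∑₂ N (λ a b → k (suc (a ℕ.+ b)) (suc a))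
    ≡⟨ cong (λ z → row N ℤ.+ z)
        (∑₂-by-total N (λ d a → k (suc d) (suc a)) λ d a N<d → p (suc d) (suc a) (s≤s N<d)) ⟩
  row N ℤ.+ ∑ N (λ d → ∑ (ℕ.pred d) λ a → k (suc d) (suc a))
    ≡⟨ ∑-+ N (λ d → k (suc d) 1) (λ d → ∑ (ℕ.pred d) λ a → k (suc d) (suc a)) ⟨
  ∑ N (λ d → k (suc d) 1 ℤ.+ ∑ (ℕ.pred d) λ a → k (suc d) (suc a))
    ≡⟨ ∑-cong N (λ d → refl) ⟩
  ∑ N (λ d → ∑ d (k (suc d)))
    ≡⟨ ℤ.+-identityˡ _ ⟨
  _ ∎
  where
  open ≡-Reasoning
  row : ℕ → ℤ
  row M = ∑ M (λ b → k (suc b) 1)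

-- As a series, the monomial q^i; as a factor inside a sum, the indicator of i = n, which cuts a sum
-- over a box down to the solutions of an equation.
δ : ℕ → Series
δ zero    zero    = 1ℤ
δ zero    (suc n) = 0ℤ
δ (suc i) zero    = 0ℤ
δ (suc i) (suc n) = δ i n

δ-refl : ∀ n → δ n n ≡ 1ℤ
δ-refl zero    = refl
δ-refl (suc n) = δ-refl n

δ-≢ : ∀ {i n} → i ≢ n → δ i n ≡ 0ℤ
δ-≢ {zero}  {zero}  i≢n with () ← i≢n refl
δ-≢ {zero}  {suc n} i≢n = refl
δ-≢ {suc i} {zero}  i≢n = refl
δ-≢ {suc i} {suc n} i≢n = δ-≢ (i≢n ∘ cong suc)

δ-> : ∀ {i n} → n ℕ.< i → δ i n ≡ 0ℤ
δ-> n<i = δ-≢ (ℕ.<⇒≢ n<i ∘ sym)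

-- Liouville's elementary method

-- The function `g a b` stands for f(|a - b|), with value 0 at a = b, stated without absolute
-- values. The three conditions on `W` say what becomes of the weight under the changes of
-- variables: `W-sum` and `W-difference` each merge two mirror-image halves of a sum into one, and
-- `W-shear` is the invariance that links the two results.
module Liouville (N : ℕ) (w W : ℕ → ℕ → ℕ → ℕ → ℤ) (f : ℕ → ℤ) (g : ℕ → ℕ → ℤ)
  (g-diagonal : ∀ a → g a a ≡ 0ℤ)
  (g-above : ∀ b c → g (b ℕ.+ c) b ≡ f c)
  (g-below : ∀ a c → g a (a ℕ.+ c) ≡ f c)
  (W-sum : ∀ a b x z → W (a ℕ.+ b) b x z ≡ w a b x (x ℕ.+ z) ℤ.+ w b a (x ℕ.+ z) x)
  (W-difference : ∀ b c x y → W c b x (x ℕ.+ y) ≡ w (b ℕ.+ c) b x y ℤ.+ w b (b ℕ.+ c) y x)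
  (W-shear : ∀ a c x y → W a (a ℕ.+ c) x y ≡ W a c (x ℕ.+ y) y)
  where

  ∑₄ : (ℕ → ℕ → ℕ → ℕ → ℤ) → ℤ
  ∑₄ h = ∑₂ N λ a b → ∑₂ N λ x y → h a b x y

  ⟨_⟩ : (ℕ → ℕ → ℕ → ℕ → ℤ) → ℕ → ℕ → ℕ → ℕ → ℤ
  ⟨ u ⟩ a b x y = δ (a ℕ.* x ℕ.+ b ℕ.* y) N ℤ.* u a b x y

  private
    -- A coefficient or an unknown exceeding `N` already makes ax + by exceed `N`, so restricting
    -- all four variables to 1, ..., `N` loses no solution.
    large : ∀ {a} x c → N ℕ.≤ a → N ℕ.< suc a ℕ.* suc x ℕ.+ c
    large x c N≤a = s≤s
        (ℕ.≤-trans N≤a (ℕ.≤-trans (ℕ.≤-trans (ℕ.m≤m*n _ (suc x)) (ℕ.m≤n+m _ x)) (ℕ.m≤m+n _ c)))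

    large′ : ∀ {a} x c → N ℕ.≤ a → N ℕ.< c ℕ.+ suc a ℕ.* suc x
    large′ {a} x c N≤a = subst (N ℕ.<_) (ℕ.+-comm (suc a ℕ.* suc x) c) (large x c N≤a)

    large-xʳ : ∀ {x} a c → N ℕ.≤ x → N ℕ.< suc a ℕ.* suc x ℕ.+ c
    large-xʳ {x} a c N≤x = subst (λ z → N ℕ.< z ℕ.+ c) (ℕ.*-comm (suc x) (suc a)) (large a c N≤x)

    large-yʳ : ∀ {x} a c → N ℕ.≤ x → N ℕ.< c ℕ.+ suc a ℕ.* suc x
    large-yʳ {x} a c N≤x = subst (λ z → N ℕ.< c ℕ.+ z) (ℕ.*-comm (suc x) (suc a)) (large′ a c N≤x)

  split-xy : ∀ u → ∑₄ ⟨ u ⟩ ≡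
    ∑₂ N (λ a b → ∑ N λ x → ⟨ u ⟩ a b x x)
      ℤ.+ ∑₄ (λ a b x z → ⟨ u ⟩ a b x (x ℕ.+ z)) ℤ.+ ∑₄ (λ a b y z → ⟨ u ⟩ a b (y ℕ.+ z) y)
  split-xy u = begin
    ∑₄ ⟨ u ⟩
      ≡⟨ ∑₂-cong N (λ a b → ∑₂-trichotomy N (⟨ u ⟩ (suc a) (suc b))
           (λ x y N≤x → 0*-when _ (δ-> (large-xʳ a _ N≤x)))
           (λ x y N≤y → 0*-when _ (δ-> (large-yʳ b (suc a ℕ.* suc x) N≤y)))) ⟩
    ∑₂ N (λ a b → D a b ℤ.+ U a b ℤ.+ L a b)
      ≡⟨ ∑₂-+ N (λ a b → D a b ℤ.+ U a b) L ⟩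
    ∑₂ N (λ a b → D a b ℤ.+ U a b) ℤ.+ ∑₂ N L
      ≡⟨ cong (λ z → z ℤ.+ ∑₂ N L) (∑₂-+ N D U) ⟩
    _ ∎
    where
    open ≡-Reasoning
    D U L : ℕ → ℕ → ℤ
    D a b = ∑ N λ x → ⟨ u ⟩ a b x x
    U a b = ∑₂ N λ x z → ⟨ u ⟩ a b x (x ℕ.+ z)
    L a b = ∑₂ N λ y z → ⟨ u ⟩ a b (y ℕ.+ z) y

  split-ab : ∀ u → ∑₄ ⟨ u ⟩ ≡
    ∑ N (λ a → ∑₂ N λ x y → ⟨ u ⟩ a a x y)
      ℤ.+ ∑₄ (λ a c x y → ⟨ u ⟩ a (a ℕ.+ c) x y) ℤ.+ ∑₄ (λ b c x y → ⟨ u ⟩ (b ℕ.+ c) b x y)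
  split-ab u = ∑₂-trichotomy N (λ a b → ∑₂ N (⟨ u ⟩ a b))
    (λ a b N≤a → ∑-zero N λ x → ∑-zero N λ y → 0*-when _ (δ-> (large x (suc b ℕ.* suc y) N≤a)))
    (λ a b N≤b → ∑-zero N λ x → ∑-zero N λ y → 0*-when _ (δ-> (large′ y (suc a ℕ.* suc x) N≤b)))

  ∑₄-cong : ∀ {g h} → (∀ a b x y → g (suc a) (suc b) (suc x) (suc y)
      ≡ h (suc a) (suc b) (suc x) (suc y)) → ∑₄ g ≡ ∑₄ h
  ∑₄-cong p = ∑₂-cong N λ a b → ∑₂-cong N λ x y → p a b x y

  ∑₄-+ : ∀ g h → ∑₄ g ℤ.+ ∑₄ h ≡ ∑₄ (λ a b x y → g a b x y ℤ.+ h a b x y)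
  ∑₄-+ g h = trans (sym (∑₂-+ N (λ a b → ∑₂ N (g a b)) (λ a b → ∑₂ N (h a b))))
    (∑₂-cong N λ a b → sym (∑₂-+ N (g (suc a) (suc b)) (h (suc a) (suc b))))

  ∑₄-*ˡ : ∀ c h → c ℤ.* ∑₄ h ≡ ∑₄ (λ a b x y → c ℤ.* h a b x y)
  ∑₄-*ˡ c h = sym
      (trans (∑₂-cong N λ a b → ∑₂-*ˡ N c (h (suc a) (suc b))) (∑₂-*ˡ N c (λ a b → ∑₂ N (h a b))))

  ∑₄-swap-ab : ∀ h → ∑₄ h ≡ ∑₄ (λ a b x y → h b a x y)
  ∑₄-swap-ab h = ∑₂-swap N (λ a b → ∑₂ N (h a b))

  ∑₄-swap-xy : ∀ h → ∑₄ h ≡ ∑₄ (λ a b x y → h a b y x)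
  ∑₄-swap-xy h = ∑₂-cong N λ a b → ∑₂-swap N (h (suc a) (suc b))

  Sums Differences : ℤ
  Sums        = ∑₄ ⟨ (λ a b x y → w a b x y ℤ.* f (a ℕ.+ b)) ⟩
  Differences = ∑₄ ⟨ (λ a b x y → w a b x y ℤ.* g a b) ⟩

  private
    -- In the sum of W·f(a) over all solutions of ax + by = N, `M` is the part a > b, `R` the part a
    -- < b, `T₂` the part x < y, and `Dab`, `Dxy` are the diagonals a = b and x = y. `D₁` is the
    -- diagonal x = y of `Sums`, with the original weight.
    M T₂ R D₁ Dxy Dab : ℤ
    M   = ∑₄ λ a b x z → δ ((a ℕ.+ b) ℕ.* x ℕ.+ b ℕ.* z) N ℤ.* (W (a ℕ.+ b) b x z ℤ.* f (a ℕ.+ b))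
    T₂  = ∑₄ λ b c x y → δ ((b ℕ.+ c) ℕ.* x ℕ.+ b ℕ.* y) N ℤ.* (W c b x (x ℕ.+ y) ℤ.* f c)
    R   = ∑₄ λ a c x y → δ (a ℕ.* x ℕ.+ (a ℕ.+ c) ℕ.* y) N ℤ.* (W a (a ℕ.+ c) x y ℤ.* f a)
    D₁  = ∑₂ N λ a b → ∑ N λ x → δ (a ℕ.* x ℕ.+ b ℕ.* x) N ℤ.* (w a b x x ℤ.* f (a ℕ.+ b))
    Dxy = ∑₂ N λ a b → ∑ N λ x → δ (a ℕ.* x ℕ.+ b ℕ.* x) N ℤ.* (W a b x x ℤ.* f a)
    Dab = ∑ N λ a → ∑₂ N λ x y → δ (a ℕ.* x ℕ.+ a ℕ.* y) N ℤ.* (W a a x y ℤ.* f a)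

    merge : ∀ d u v w r → w ≡ u ℤ.+ v → d ℤ.* (u ℤ.* r) ℤ.+ d ℤ.* (v ℤ.* r) ≡ d ℤ.* (w ℤ.* r)
    merge d u v w r refl = lemma d u v r
      where
      lemma : ∀ d u v r → d ℤ.* (u ℤ.* r) ℤ.+ d ℤ.* (v ℤ.* r) ≡ d ℤ.* ((u ℤ.+ v) ℤ.* r)
      lemma = solve-∀

    Sums≡ : Sums ≡ D₁ ℤ.+ M
    Sums≡ = begin
      Sums              ≡⟨ split-xy _ ⟩
      D₁ ℤ.+ U ℤ.+ L    ≡⟨ ℤ.+-assoc D₁ U L ⟩
      D₁ ℤ.+ (U ℤ.+ L)  ≡⟨ cong (λ z → D₁ ℤ.+ (U ℤ.+ z)) (∑₄-swap-ab _) ⟩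
      D₁ ℤ.+ (U ℤ.+ L′)
          ≡⟨ cong (λ z → D₁ ℤ.+ z)
          (trans (∑₄-+ _ _) (∑₄-cong λ a b x y → merged (suc a) (suc b) (suc x) (suc y))) ⟩
      D₁ ℤ.+ M          ∎
      where
      open ≡-Reasoning
      u = λ a b x y → w a b x y ℤ.* f (a ℕ.+ b)
      U L L′ : ℤ
      U = ∑₄ λ a b x z → ⟨ u ⟩ a b x (x ℕ.+ z)
      L = ∑₄ λ a b y z → ⟨ u ⟩ a b (y ℕ.+ z) y
      L′ = ∑₄ λ a b y z → ⟨ u ⟩ b a (y ℕ.+ z) y
      e₁ : ∀ a b x z → a ℕ.* x ℕ.+ b ℕ.* (x ℕ.+ z) ≡ (a ℕ.+ b) ℕ.* x ℕ.+ b ℕ.* z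
      e₁ = ℕ-Solver.solve-∀
      e₂ : ∀ a b x z → b ℕ.* (x ℕ.+ z) ℕ.+ a ℕ.* x ≡ (a ℕ.+ b) ℕ.* x ℕ.+ b ℕ.* z
      e₂ = ℕ-Solver.solve-∀
      merged : ∀ a b x z → ⟨ u ⟩ a b x (x ℕ.+ z) ℤ.+ ⟨ u ⟩ b a (x ℕ.+ z) x ≡
        δ ((a ℕ.+ b) ℕ.* x ℕ.+ b ℕ.* z) N ℤ.* (W (a ℕ.+ b) b x z ℤ.* f (a ℕ.+ b))
      merged a b x z rewrite e₁ a b x z | e₂ a b x z | ℕ.+-comm b a =
        merge (δ ((a ℕ.+ b) ℕ.* x ℕ.+ b ℕ.* z) N) (w a b x (x ℕ.+ z)) (w b a (x ℕ.+ z) x)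
            (W (a ℕ.+ b) b x z)
          (f (a ℕ.+ b)) (W-sum a b x z)

    Differences≡ : Differences ≡ T₂
    Differences≡ = begin
      Differences            ≡⟨ split-ab _ ⟩
      D ℤ.+ U ℤ.+ L
          ≡⟨ cong (λ z → z ℤ.+ U ℤ.+ L)
          (∑-zero N λ a → ∑-zero N λ x → ∑-zero N λ y → vanish (suc a) (suc x) (suc y)) ⟩
      0ℤ ℤ.+ U ℤ.+ L         ≡⟨ cong (ℤ._+ L) (ℤ.+-identityˡ U) ⟩
      U ℤ.+ L                ≡⟨ ℤ.+-comm U L ⟩
      L ℤ.+ U                ≡⟨ cong (λ z → L ℤ.+ z) (∑₄-swap-xy _) ⟩
      L ℤ.+ U′
          ≡⟨ trans (∑₄-+ _ _) (∑₄-cong λ b c x y → merged (suc b) (suc c) (suc x) (suc y)) ⟩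
      T₂                     ∎
      where
      open ≡-Reasoning
      u = λ a b x y → w a b x y ℤ.* g a b
      D U U′ L : ℤ
      D = ∑ N λ a → ∑₂ N λ x y → ⟨ u ⟩ a a x y
      U = ∑₄ λ a c x y → ⟨ u ⟩ a (a ℕ.+ c) x y
      U′ = ∑₄ λ a c x y → ⟨ u ⟩ a (a ℕ.+ c) y x
      L = ∑₄ λ b c x y → ⟨ u ⟩ (b ℕ.+ c) b x y
      vanish : ∀ a x y → ⟨ u ⟩ a a x y ≡ 0ℤ
      vanish a x y rewrite g-diagonal a | ℤ.*-zeroʳ (w a a x y) = ℤ.*-zeroʳ (δ (a ℕ.* x ℕ.+ a ℕ.* y) N)
      merged : ∀ b c x y → ⟨ u ⟩ (b ℕ.+ c) b x y ℤ.+ ⟨ u ⟩ b (b ℕ.+ c) y x ≡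
        δ ((b ℕ.+ c) ℕ.* x ℕ.+ b ℕ.* y) N ℤ.* (W c b x (x ℕ.+ y) ℤ.* f c)
      merged b c x y rewrite ℕ.+-comm (b ℕ.* y) ((b ℕ.+ c) ℕ.* x) | g-above b c | g-below b c =
        merge (δ ((b ℕ.+ c) ℕ.* x ℕ.+ b ℕ.* y) N) (w (b ℕ.+ c) b x y) (w b (b ℕ.+ c) y x)
            (W c b x (x ℕ.+ y))
          (f c) (W-difference b c x y)

    K : ℤ
    K = ∑₄ ⟨ (λ a b x y → W a b x y ℤ.* f a) ⟩

    K≡ab : K ≡ Dab ℤ.+ R ℤ.+ M
    K≡ab = trans (split-ab _) (cong (λ z → Dab ℤ.+ R ℤ.+ z) (trans (∑₄-swap-ab _)
      (∑₄-cong λ a b x z → cong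
          (λ s → δ (s ℕ.* suc x ℕ.+ suc b ℕ.* suc z) N ℤ.* (W s (suc b) (suc x) (suc z) ℤ.* f s))
         (ℕ.+-comm (suc b) (suc a)))))

    K≡xy : K ≡ Dxy ℤ.+ T₂ ℤ.+ R
    K≡xy = trans (split-xy _) (cong₂ (λ u v → Dxy ℤ.+ u ℤ.+ v)
      (trans (∑₄-swap-ab _)
          (∑₄-cong λ b c x z → cong
          (λ s → δ s N ℤ.* (W (suc c) (suc b) (suc x) (suc x ℕ.+ suc z) ℤ.* f (suc c)))
        (e₁ (suc b) (suc c) (suc x) (suc z))))
      (trans (∑₄-swap-xy _) (∑₄-cong λ a c z y → cong₂ (λ s t → δ s N ℤ.* (t ℤ.* f (suc a)))
        (e₂ (suc a) (suc c) (suc z) (suc y))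
        (trans (cong (λ s → W (suc a) (suc c) s (suc y)) (ℕ.+-comm (suc y) (suc z)))
          (sym (W-shear (suc a) (suc c) (suc z) (suc y)))))))
      where
      e₁ : ∀ b c x z → c ℕ.* x ℕ.+ b ℕ.* (x ℕ.+ z) ≡ (b ℕ.+ c) ℕ.* x ℕ.+ b ℕ.* z
      e₁ = ℕ-Solver.solve-∀
      e₂ : ∀ a c z y → a ℕ.* (y ℕ.+ z) ℕ.+ c ℕ.* y ≡ a ℕ.* z ℕ.+ (a ℕ.+ c) ℕ.* y
      e₂ = ℕ-Solver.solve-∀

  -- `Sums` is `M` and `Differences` is `T₂`, up to the diagonal `D₁`. To compare them, the full sum
  -- `K` is evaluated twice. Splitting by a and b gives `Dab`, `R` and `M`; splitting by x and y
  -- gives `Dxy`, `T₂` and the part x > y. The shear ax + by = a(x - y) + (a + b)y identifies that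
  -- last part with `R`, so it cancels and M - T₂ = Dxy - Dab.
  Sums-Differences : Sums ℤ.- Differences ≡ D₁ ℤ.+ Dxy ℤ.- Dab
  Sums-Differences rewrite Sums≡ | Differences≡ =
    cancel D₁ M T₂ Dxy Dab R (trans (sym K≡ab) K≡xy)
    where
    cancel : ∀ d m t x a r → a ℤ.+ r ℤ.+ m ≡ x ℤ.+ t ℤ.+ r → d ℤ.+ m ℤ.- t ≡ d ℤ.+ x ℤ.- a
    cancel d m t x a r eq = begin
      d ℤ.+ m ℤ.- t                                     ≡⟨ left d m t a r ⟩
      d ℤ.+ (a ℤ.+ r ℤ.+ m) ℤ.- a ℤ.- r ℤ.- t ≡⟨ cong (λ z → d ℤ.+ z ℤ.- a ℤ.- r ℤ.- t) eq ⟩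
      d ℤ.+ (x ℤ.+ t ℤ.+ r) ℤ.- a ℤ.- r ℤ.- t ≡⟨ right d t x a r ⟩
      d ℤ.+ x ℤ.- a                                     ∎
      where
      open ≡-Reasoning
      left : ∀ d m t a r → d ℤ.+ m ℤ.- t ≡ d ℤ.+ (a ℤ.+ r ℤ.+ m) ℤ.- a ℤ.- r ℤ.- t
      left = solve-∀
      right : ∀ d t x a r → d ℤ.+ (x ℤ.+ t ℤ.+ r) ℤ.- a ℤ.- r ℤ.- t ≡ d ℤ.+ x ℤ.- a
      right = solve-∀

  module DivisorForm (u v t : ℕ → ℕ → ℕ → ℤ)
    (w-diagonal-xy : ∀ a b x → w a b x x ≡ u (a ℕ.+ b) a x)
    (W-diagonal-xy : ∀ a b x → W a b x x ≡ v (a ℕ.+ b) a x)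
    (W-diagonal-ab : ∀ a x y → W a a x y ≡ t a x (x ℕ.+ y)) where

    -- On x = y the equation becomes (a + b)x = N, and on a = b it becomes a(x + y) = N. Both have
    -- the form de = N with one free variable left, a below d or x below e. Summing over that
    -- variable gives the weight of the factorisation de.
    Θ⁺ Θ⁻ : ℕ → ℕ → ℤ
    Θ⁺ d e = ∑ (ℕ.pred d) λ a → u d a e ℤ.* f d ℤ.+ v d a e ℤ.* f a
    Θ⁻ d e = ∑ (ℕ.pred e) λ x → t d x e ℤ.* f d

    private
      D₁+Dxy : D₁ ℤ.+ Dxy ≡ ∑₂ N (λ d e → δ (d ℕ.* e) N ℤ.* Θ⁺ d e)
      D₁+Dxy = begin
        D₁ ℤ.+ Dxy
          ≡⟨ ∑₂-+ N (λ a b → ∑ N λ x → δ (a ℕ.* x ℕ.+ b ℕ.* x) N ℤ.* (w a b x x ℤ.* f (a ℕ.+ b)))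
                    (λ a b → ∑ N λ x → δ (a ℕ.* x ℕ.+ b ℕ.* x) N ℤ.* (W a b x x ℤ.* f a)) ⟨
        ∑₂ N (λ a b → (∑ N λ x → δ (a ℕ.* x ℕ.+ b ℕ.* x) N ℤ.* (w a b x x ℤ.* f (a ℕ.+ b)))
                ℤ.+ (∑ N λ x → δ (a ℕ.* x ℕ.+ b ℕ.* x) N ℤ.* (W a b x x ℤ.* f a)))
          ≡⟨ ∑₂-cong N (λ a b → trans
               (sym (∑-+ N (λ x → δ (suc a ℕ.* x ℕ.+ suc b ℕ.* x) N
                   ℤ.* (w (suc a) (suc b) x x ℤ.* f (suc a ℕ.+ suc b)))
                           (λ x → δ (suc a ℕ.* x ℕ.+ suc b ℕ.* x) N
                               ℤ.* (W (suc a) (suc b) x x ℤ.* f (suc a)))))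
               (∑-cong N λ x → pointwise (suc a) (suc b) (suc x))) ⟩
        ∑₂ N (λ a b → k (a ℕ.+ b) a)
          ≡⟨ ∑₂-by-total N k (λ d a N<d → ∑-zero N λ e →
               0*-when (q d (suc a) (suc e)) (δ-> (ℕ.<-≤-trans N<d (ℕ.m≤m*n d (suc e))))) ⟩
        ∑ N (λ d → ∑ (ℕ.pred d) λ a → ∑ N λ e → δ (d ℕ.* e) N ℤ.* q d a e)
          ≡⟨ ∑-cong N (λ d → trans (∑-swap d N (λ a e → δ (suc d ℕ.* e) N ℤ.* q (suc d) a e))
               (∑-cong N λ e → ∑-*ˡ d (δ (suc d ℕ.* suc e) N) (λ a → q (suc d) a (suc e)))) ⟩
        ∑₂ N (λ d e → δ (d ℕ.* e) N ℤ.* Θ⁺ d e) ∎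
        where
        open ≡-Reasoning
        q : ℕ → ℕ → ℕ → ℤ
        q d a e = u d a e ℤ.* f d ℤ.+ v d a e ℤ.* f a
        k : ℕ → ℕ → ℤ
        k d a = ∑ N λ e → δ (d ℕ.* e) N ℤ.* q d a e
        pointwise : ∀ a b x → δ (a ℕ.* x ℕ.+ b ℕ.* x) N ℤ.* (w a b x x ℤ.* f (a ℕ.+ b))
          ℤ.+ δ (a ℕ.* x ℕ.+ b ℕ.* x) N ℤ.* (W a b x x ℤ.* f a)
              ≡ δ ((a ℕ.+ b) ℕ.* x) N ℤ.* q (a ℕ.+ b) a x
        pointwise a b x rewrite sym (ℕ.*-distribʳ-+ x a b) | w-diagonal-xy a b x | W-diagonal-xy a b x =
          sym (ℤ.*-distribˡ-+ (δ ((a ℕ.+ b) ℕ.* x) N) _ _)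

      Dab≡ : Dab ≡ ∑₂ N (λ d e → δ (d ℕ.* e) N ℤ.* Θ⁻ d e)
      Dab≡ = ∑-cong N λ a → begin
        ∑₂ N (λ x y → δ (suc a ℕ.* x ℕ.+ suc a ℕ.* y) N ℤ.* (W (suc a) (suc a) x y ℤ.* f (suc a)))
          ≡⟨ ∑₂-cong N (λ x y → pointwise (suc a) (suc x) (suc y)) ⟩
        ∑₂ N (λ x y → k (suc a) (x ℕ.+ y) x)
          ≡⟨ ∑₂-by-total N (k (suc a)) (λ e x N<e → 0*-when (t (suc a) (suc x) e ℤ.* f (suc a))
               (δ-> (ℕ.<-≤-trans N<e (ℕ.m≤n*m e (suc a))))) ⟩
        ∑ N (λ e → ∑ (ℕ.pred e) λ x → k (suc a) e x)
          ≡⟨ ∑-cong N (λ e → ∑-*ˡ e (δ (suc a ℕ.* suc e) N) (λ x → t (suc a) x (suc e) ℤ.* f (suc a))) ⟩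
        ∑ N (λ e → δ (suc a ℕ.* e) N ℤ.* Θ⁻ (suc a) e) ∎
        where
        open ≡-Reasoning
        k : ℕ → ℕ → ℕ → ℤ
        k a e x = δ (a ℕ.* e) N ℤ.* (t a x e ℤ.* f a)
        pointwise : ∀ a x y → δ (a ℕ.* x ℕ.+ a ℕ.* y) N ℤ.* (W a a x y ℤ.* f a) ≡ k a (x ℕ.+ y) x
        pointwise a x y rewrite sym (ℕ.*-distribˡ-+ a x y) | W-diagonal-ab a x y = refl

    Sums-Differences-divisors : Sums
        ≡ Differences ℤ.+ ∑₂ N (λ d e → δ (d ℕ.* e) N ℤ.* (Θ⁺ d e ℤ.- Θ⁻ d e))
    Sums-Differences-divisors = rearrange Sums Differences _ _ _
      (trans Sums-Differences (cong₂ ℤ._-_ D₁+Dxy Dab≡))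
      (trans (sym (∑₂-+ N _ _))
          (∑₂-cong N λ d e → sub-add (δ (suc d ℕ.* suc e) N) (Θ⁺ (suc d) (suc e)) (Θ⁻ (suc d) (suc e))))
      where
      rearrange : ∀ s d p m θ → s ℤ.- d ≡ p ℤ.- m → θ ℤ.+ m ≡ p → s ≡ d ℤ.+ θ
      rearrange s d p m θ eq refl = trans (lemma₁ s d) (trans (cong (λ z → d ℤ.+ z) eq) (lemma₂ d m θ))
        where
        lemma₁ : ∀ s d → s ≡ d ℤ.+ (s ℤ.- d)
        lemma₁ = solve-∀
        lemma₂ : ∀ d m θ → d ℤ.+ (θ ℤ.+ m ℤ.- m) ≡ d ℤ.+ θ
        lemma₂ = solve-∀
      sub-add : ∀ δ p m → δ ℤ.* (p ℤ.- m) ℤ.+ δ ℤ.* m ≡ δ ℤ.* p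
      sub-add = solve-∀

-- Signs and alternating sums

σ : ℕ → ℤ
σ zero    = 1ℤ
σ (suc n) = ℤ.- σ n

σ-+ : ∀ m n → σ (m ℕ.+ n) ≡ σ m ℤ.* σ n
σ-+ zero    n = sym (ℤ.*-identityˡ (σ n))
σ-+ (suc m) n = trans (cong ℤ.-_ (σ-+ m n)) (ℤ.neg-distribˡ-* (σ m) (σ n))

σ-square : ∀ n → σ n ℤ.* σ n ≡ 1ℤ
σ-square zero    = refl
σ-square (suc n) = trans (lemma (σ n)) (σ-square n)
  where
  lemma : ∀ s → (ℤ.- s) ℤ.* (ℤ.- s) ≡ s ℤ.* s
  lemma = solve-∀

∑-const : ∀ N c → ∑ N (λ _ → c) ≡ + N ℤ.* c
∑-const zero    c = refl
∑-const (suc N) c = trans (cong (λ z → c ℤ.+ z) (∑-const N c)) (lemma (+ N) c)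
  where
  lemma : ∀ n c → c ℤ.+ n ℤ.* c ≡ (1ℤ ℤ.+ n) ℤ.* c
  lemma = solve-∀

-- The closed form has denominator 2, as has that of the alternating sum of squares; both are
-- doubled to stay among the integers.
∑-σ : ∀ k → + 2 ℤ.* ∑ k σ ≡ σ k ℤ.- 1ℤ
∑-σ zero    = refl
∑-σ (suc k) rewrite ∑-last k σ = trans (lemma (∑ k σ) (σ k))
    (trans (cong (λ z → z ℤ.- + 2 ℤ.* σ k) (∑-σ k)) (lemma′ (σ k)))
  where
  lemma : ∀ s t → + 2 ℤ.* (s ℤ.+ ℤ.- t) ≡ + 2 ℤ.* s ℤ.- + 2 ℤ.* t
  lemma = solve-∀
  lemma′ : ∀ t → t ℤ.- 1ℤ ℤ.- + 2 ℤ.* t ≡ ℤ.- t ℤ.- 1ℤ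
  lemma′ = solve-∀

square : ℕ → ℤ
square n = + n ℤ.* + n

∑-σ-square : ∀ k → + 2 ℤ.* ∑ k (λ a → σ a ℤ.* square a) ≡ σ k ℤ.* + k ℤ.* + suc k
∑-σ-square zero    = refl
∑-σ-square (suc k) rewrite ∑-last k (λ a → σ a ℤ.* square a) =
  trans (lemma (∑ k (λ a → σ a ℤ.* square a)) (σ k) (+ k))
      (trans (cong (λ z → z ℤ.- + 2 ℤ.* σ k ℤ.* square (suc k)) (∑-σ-square k)) (lemma′ (σ k) (+ k)))
  where
  lemma : ∀ s t k → + 2 ℤ.* (s ℤ.+ (ℤ.- t) ℤ.* ((1ℤ ℤ.+ k) ℤ.* (1ℤ ℤ.+ k))) ≡
    + 2 ℤ.* s ℤ.- + 2 ℤ.* t ℤ.* ((1ℤ ℤ.+ k) ℤ.* (1ℤ ℤ.+ k))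
  lemma = solve-∀
  lemma′ : ∀ t k → t ℤ.* k ℤ.* (1ℤ ℤ.+ k) ℤ.- + 2 ℤ.* t ℤ.* ((1ℤ ℤ.+ k) ℤ.* (1ℤ ℤ.+ k)) ≡
    (ℤ.- t) ℤ.* (1ℤ ℤ.+ k) ℤ.* (1ℤ ℤ.+ (1ℤ ℤ.+ k))
  lemma′ = solve-∀

squared-difference : ℕ → ℕ → ℤ
squared-difference a b = (+ a ℤ.- + b) ℤ.* (+ a ℤ.- + b)

squared-difference-diagonal : ∀ a → squared-difference a a ≡ 0ℤ
squared-difference-diagonal a = lemma (+ a)
  where
  lemma : ∀ a → (a ℤ.- a) ℤ.* (a ℤ.- a) ≡ 0ℤ
  lemma = solve-∀

squared-difference-above : ∀ b c → squared-difference (b ℕ.+ c) b ≡ square c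
squared-difference-above b c = lemma (+ b) (+ c)
  where
  lemma : ∀ b c → (b ℤ.+ c ℤ.- b) ℤ.* (b ℤ.+ c ℤ.- b) ≡ c ℤ.* c
  lemma = solve-∀

squared-difference-below : ∀ a c → squared-difference a (a ℕ.+ c) ≡ square c
squared-difference-below a c = lemma (+ a) (+ c)
  where
  lemma : ∀ a c → (a ℤ.- (a ℤ.+ c)) ℤ.* (a ℤ.- (a ℤ.+ c)) ≡ c ℤ.* c
  lemma = solve-∀

-- Divisor sums and their products

divisorSum : (ℕ → ℕ → ℤ) → Series
divisorSum β n = ∑₂ n λ d e → δ (d ℕ.* e) n ℤ.* β d e

divisorSum-extend : ∀ β {n N} → n ℕ.≤ N → divisorSum β n ≡ ∑₂ N λ d e → δ (d ℕ.* e) n ℤ.* β d e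
divisorSum-extend β {n} n≤N = sym (∑₂-extend (λ d e → δ (d ℕ.* e) n ℤ.* β d e) n≤N
  (λ d e n≤d → 0*-when _ (δ-> (s≤s (ℕ.≤-trans n≤d (ℕ.≤-trans (ℕ.m≤m*n d (suc e)) (ℕ.m≤n+m _ e))))))
  (λ d e n≤e → 0*-when _ (δ-> (ℕ.≤-trans (s≤s n≤e) (ℕ.m≤n*m (suc e) (suc d))))))

∑-⊗ : ∀ N (h : ℕ → Series) g n → ((λ i → ∑ N λ a → h a i) ⊗ g) n ≡ ∑ N λ a → (h a ⊗ g) n
∑-⊗ zero    h g n = zero-⊗ g n (λ _ → refl)
∑-⊗ (suc N) h g n = trans (⊗-distribʳ g (h 1) (λ i → ∑ N λ a → h (suc a) i) n)
  (cong (λ z → (h 1 ⊗ g) n ℤ.+ z) (∑-⊗ N (h ∘ suc) g n))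

⊗-∑ : ∀ N f (h : ℕ → Series) n → (f ⊗ λ i → ∑ N λ a → h a i) n ≡ ∑ N λ a → (f ⊗ h a) n
⊗-∑ N f h n = trans (⊗-comm f _ n) (trans (∑-⊗ N h f n) (∑-cong N λ a → ⊗-comm (h (suc a)) f n))

δ-⊗-δ : ∀ i j → δ i ⊗ δ j ≐ δ (i ℕ.+ j)
δ-⊗-δ zero    j zero    = ℤ.*-identityˡ (δ j 0)
δ-⊗-δ zero    j (suc n) = trans (cong₂ ℤ._+_ (ℤ.*-identityˡ (δ j (suc n))) (zero-⊗ (δ j) n λ _ → refl))
    (ℤ.+-identityʳ _)
δ-⊗-δ (suc i) j zero    = refl
δ-⊗-δ (suc i) j (suc n) = trans (ℤ.+-identityˡ _) (δ-⊗-δ i j n)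

-- This brings a product of divisor sums into the shape treated by Liouville's method: coefficients
-- a, b outside, unknowns x, y inside.
divisorSum-⊗ : ∀ β γ n → (divisorSum β ⊗ divisorSum γ) n ≡
  ∑₂ n λ a b → ∑₂ n λ x y → δ (a ℕ.* x ℕ.+ b ℕ.* y) n ℤ.* (β a x ℤ.* γ b y)
divisorSum-⊗ β γ n = begin
  (divisorSum β ⊗ divisorSum γ) n
    ≡⟨ ⊗-cong-upto n (λ i → divisorSum-extend β) (λ i → divisorSum-extend γ) ⟩
  ((λ i → ∑₂ n λ a x → δ (a ℕ.* x) i ℤ.* β a x) ⊗ (λ i → ∑₂ n λ b y → δ (b ℕ.* y) i ℤ.* γ b y)) n
    ≡⟨ ∑-⊗ n (λ a i → ∑ n λ x → δ (a ℕ.* x) i ℤ.* β a x) g n ⟩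
  (∑ n λ a → ((λ i → ∑ n λ x → δ (a ℕ.* x) i ℤ.* β a x) ⊗ g) n)
    ≡⟨ ∑-cong n (λ a → ∑-⊗ n (λ x i → δ (suc a ℕ.* x) i ℤ.* β (suc a) x) g n) ⟩
  (∑ n λ a → ∑ n λ x → ((λ i → δ (a ℕ.* x) i ℤ.* β a x) ⊗ g) n)
    ≡⟨ ∑₂-cong n (λ a x → trans (⊗-∑ n (term β (suc a) (suc x)) (λ b i → ∑ n λ y → term γ b y i) n)
         (∑-cong n λ b → trans (⊗-∑ n (term β (suc a) (suc x)) (λ y i → term γ (suc b) y i) n)
           (∑-cong n λ y → product (suc a) (suc x) (suc b) (suc y)))) ⟩
  (∑₂ n λ a x → ∑₂ n λ b y → δ (a ℕ.* x ℕ.+ b ℕ.* y) n ℤ.* (β a x ℤ.* γ b y))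
    ≡⟨ ∑-cong n (λ a → ∑-swap n n
        (λ x b → ∑ n λ y → δ (suc a ℕ.* x ℕ.+ b ℕ.* y) n ℤ.* (β (suc a) x ℤ.* γ b y))) ⟩
  _ ∎
  where
  open ≡-Reasoning
  term : (ℕ → ℕ → ℤ) → ℕ → ℕ → Series
  term β a x i = δ (a ℕ.* x) i ℤ.* β a x
  g : Series
  g i = ∑₂ n λ b y → term γ b y i
  product : ∀ a x b y → (term β a x ⊗ term γ b y) n ≡ δ (a ℕ.* x ℕ.+ b ℕ.* y) n ℤ.* (β a x ℤ.* γ b y)
  product a x b y = begin
    (term β a x ⊗ term γ b y) n
      ≡⟨ ⊗-cong {g = term γ b y} (λ i → ℤ.*-comm _ (β a x)) (λ i → ℤ.*-comm _ (γ b y)) n ⟩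
    ((λ i → β a x ℤ.* δ (a ℕ.* x) i) ⊗ (λ i → γ b y ℤ.* δ (b ℕ.* y) i)) n
      ≡⟨ scale-⊗ (β a x) (δ (a ℕ.* x)) _ n ⟩
    β a x ℤ.* (δ (a ℕ.* x) ⊗ (λ i → γ b y ℤ.* δ (b ℕ.* y) i)) n
      ≡⟨ cong (λ z → β a x ℤ.* z) (trans (⊗-comm (δ (a ℕ.* x)) _ n)
           (trans (scale-⊗ (γ b y) (δ (b ℕ.* y)) _ n)
               (cong (λ z → γ b y ℤ.* z)
               (trans (⊗-comm (δ (b ℕ.* y)) (δ (a ℕ.* x)) n) (δ-⊗-δ (a ℕ.* x) (b ℕ.* y) n))))) ⟩
    β a x ℤ.* (γ b y ℤ.* δ (a ℕ.* x ℕ.+ b ℕ.* y) n)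
      ≡⟨ lemma (β a x) (γ b y) _ ⟩
    δ (a ℕ.* x ℕ.+ b ℕ.* y) n ℤ.* (β a x ℤ.* γ b y) ∎
    where
    lemma : ∀ p q r → p ℤ.* (q ℤ.* r) ≡ r ℤ.* (p ℤ.* q)
    lemma = solve-∀

-- Squares of signs are written out as factors s * s, so that they can be cancelled.
σ-cancel : ∀ {a b} n (F : ℤ → ℤ) → a ≡ F (σ n ℤ.* σ n) → F 1ℤ ≡ b → a ≡ b
σ-cancel n F p q = trans p (trans (cong F (σ-square n)) q)

-- The factor `1ℤ ℤ.- σ e` is 2 for odd e and 0 for even e, so `oddSum` is q times the logarithmic
-- derivative of the product of all (1 + q^j)/(1 - q^j).
signedSum cubeSum oddSum : Series
signedSum = divisorSum λ d e → ℤ.- (σ d ℤ.* σ e ℤ.* + d)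
cubeSum   = divisorSum λ d e → σ d ℤ.* (+ d ℤ.* + d ℤ.* + d)
oddSum    = divisorSum λ d e → (1ℤ ℤ.- σ e) ℤ.* + d

-- Two quadratic identities between divisor sums

∑-linear : ∀ N a f b g → ∑ N (λ i → a ℤ.* f i ℤ.+ b ℤ.* g i) ≡ a ℤ.* ∑ N f ℤ.+ b ℤ.* ∑ N g
∑-linear N a f b g = trans (∑-+ N (λ i → a ℤ.* f i) (λ i → b ℤ.* g i))
    (cong₂ ℤ._+_ (∑-*ˡ N a f) (∑-*ˡ N b g))

-- The weight `w` carries the signs in the square of `signedSum`, so `Sums` minus `Differences` is 4
-- times the coefficient of that square. As `w` is unchanged when (a, x) and (b, y) are exchanged,
-- the two merged halves are equal, whence the factor 2 in `W`.
module SquareIdentity (N : ℕ) where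

  w W : ℕ → ℕ → ℕ → ℕ → ℤ
  w a b x y = σ a ℤ.* σ x ℤ.* (σ b ℤ.* σ y)
  W a b x y = + 2 ℤ.* (σ a ℤ.* σ y)

  W-sum : ∀ a b x z → W (a ℕ.+ b) b x z ≡ w a b x (x ℕ.+ z) ℤ.+ w b a (x ℕ.+ z) x
  W-sum a b x z rewrite σ-+ a b | σ-+ x z =
    sym (σ-cancel x (λ q → + 2 ℤ.* q ℤ.* (σ a ℤ.* σ b ℤ.* σ z)) (lemma (σ a) (σ b) (σ x) (σ z))
        (lemma′ (σ a) (σ b) (σ z)))
    where
    lemma : ∀ a b x z → a ℤ.* x ℤ.* (b ℤ.* (x ℤ.* z)) ℤ.+ b ℤ.* (x ℤ.* z) ℤ.* (a ℤ.* x)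
        ≡ + 2 ℤ.* (x ℤ.* x) ℤ.* (a ℤ.* b ℤ.* z)
    lemma = solve-∀
    lemma′ : ∀ a b z → + 2 ℤ.* 1ℤ ℤ.* (a ℤ.* b ℤ.* z) ≡ + 2 ℤ.* (a ℤ.* b ℤ.* z)
    lemma′ = solve-∀

  W-difference : ∀ b c x y → W c b x (x ℕ.+ y) ≡ w (b ℕ.+ c) b x y ℤ.+ w b (b ℕ.+ c) y x
  W-difference b c x y rewrite σ-+ b c | σ-+ x y =
    sym (σ-cancel b (λ q → + 2 ℤ.* q ℤ.* (σ c ℤ.* σ x ℤ.* σ y)) (lemma (σ b) (σ c) (σ x) (σ y))
        (lemma′ (σ c) (σ x) (σ y)))
    where
    lemma : ∀ b c x y → b ℤ.* c ℤ.* x ℤ.* (b ℤ.* y) ℤ.+ b ℤ.* y ℤ.* (b ℤ.* c ℤ.* x)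
        ≡ + 2 ℤ.* (b ℤ.* b) ℤ.* (c ℤ.* x ℤ.* y)
    lemma = solve-∀
    lemma′ : ∀ c x y → + 2 ℤ.* 1ℤ ℤ.* (c ℤ.* x ℤ.* y) ≡ + 2 ℤ.* (c ℤ.* (x ℤ.* y))
    lemma′ = solve-∀

  open Liouville N w W square squared-difference
    squared-difference-diagonal squared-difference-above squared-difference-below
    W-sum W-difference (λ a c x y → refl)

  u v t : ℕ → ℕ → ℕ → ℤ
  u d a e = σ d
  v d a e = + 2 ℤ.* (σ a ℤ.* σ e)
  t d x e = + 2 ℤ.* (σ d ℤ.* (σ e ℤ.* σ x))

  w-diagonal-xy : ∀ a b x → w a b x x ≡ σ (a ℕ.+ b)
  w-diagonal-xy a b x rewrite σ-+ a b =
    σ-cancel x (λ q → σ a ℤ.* σ b ℤ.* q) (lemma (σ a) (σ b) (σ x)) (ℤ.*-identityʳ _)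
    where
    lemma : ∀ a b x → a ℤ.* x ℤ.* (b ℤ.* x) ≡ a ℤ.* b ℤ.* (x ℤ.* x)
    lemma = solve-∀

  W-diagonal-ab : ∀ a x y → W a a x y ≡ t a x (x ℕ.+ y)
  W-diagonal-ab a x y rewrite σ-+ x y =
    sym (σ-cancel x (λ q → + 2 ℤ.* (σ a ℤ.* σ y ℤ.* q)) (lemma (σ a) (σ x) (σ y))
        (cong (λ z → + 2 ℤ.* z) (ℤ.*-identityʳ _)))
    where
    lemma : ∀ a x y → + 2 ℤ.* (a ℤ.* (x ℤ.* y ℤ.* x)) ≡ + 2 ℤ.* (a ℤ.* y ℤ.* (x ℤ.* x))
    lemma = solve-∀

  open DivisorForm u v t w-diagonal-xy (λ a b x → refl) W-diagonal-ab

  -- Let D, E be the two arguments. Up to sign, the D - 1 equal terms from `u` give (D - 1)D², and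
  -- the sign in `∑-σ` supplies the D² missing from D³. The constant in `∑-σ` and the alternating
  -- squares together leave D² - (D - 1)D = D.
  Θ : ∀ d e → Θ⁺ (suc d) (suc e) ℤ.- Θ⁻ (suc d) (suc e) ≡
    σ (suc d) ℤ.* (+ suc d ℤ.* + suc d ℤ.* + suc d) ℤ.+ σ (suc d) ℤ.* σ (suc e) ℤ.* + suc d
  Θ d e = begin
    Θ⁺ (suc d) (suc e) ℤ.- Θ⁻ (suc d) (suc e)
      ≡⟨ cong₂ ℤ._-_ plus minus ⟩
    (+ d ℤ.* (ℤ.- σ d ℤ.* square (suc d)) ℤ.+ + 2 ℤ.* (ℤ.- σ e) ℤ.* A) ℤ.- + 2 ℤ.* (σ d ℤ.* σ e)
        ℤ.* square (suc d) ℤ.* X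
      ≡⟨ lemma₁ (σ d) (σ e) (+ d) A X ⟩
    ℤ.- (σ d ℤ.* + d ℤ.* square (suc d)) ℤ.- σ e ℤ.* (+ 2 ℤ.* A) ℤ.- σ d ℤ.* σ e ℤ.* square (suc d)
        ℤ.* (+ 2 ℤ.* X)
      ≡⟨ cong₂ (λ p q → ℤ.- (σ d ℤ.* + d ℤ.* square (suc d)) ℤ.- σ e ℤ.* p ℤ.- σ d ℤ.* σ e ℤ.* square
          (suc d) ℤ.* q)
           (∑-σ-square d) (∑-σ e) ⟩
    ℤ.- (σ d ℤ.* + d ℤ.* square (suc d)) ℤ.- σ e ℤ.* (σ d ℤ.* + d ℤ.* + suc d) ℤ.- σ d ℤ.* σ e
        ℤ.* square (suc d) ℤ.* (σ e ℤ.- 1ℤ)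
      ≡⟨ σ-cancel e
          (λ q → ℤ.- (σ d ℤ.* + d ℤ.* square (suc d)) ℤ.- σ e ℤ.* (σ d ℤ.* + d ℤ.* + suc d) ℤ.- σ d
          ℤ.* square (suc d) ℤ.* (q ℤ.- σ e))
           (lemma₂ (σ d) (σ e) (+ d)) (lemma₃ (σ d) (σ e) (+ d)) ⟩
    _ ∎
    where
    open ≡-Reasoning
    A X : ℤ
    A = ∑ d (λ a → σ a ℤ.* square a)
    X = ∑ e σ
    plus : Θ⁺ (suc d) (suc e) ≡ + d ℤ.* (ℤ.- σ d ℤ.* square (suc d)) ℤ.+ + 2 ℤ.* (ℤ.- σ e) ℤ.* A
    plus = trans
        (∑-+ d (λ _ → ℤ.- σ d ℤ.* square (suc d)) (λ a → + 2 ℤ.* (σ a ℤ.* ℤ.- σ e) ℤ.* square a))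
      (cong₂ ℤ._+_ (∑-const d _) (trans (∑-cong d λ a → lemma (σ (suc a)) (ℤ.- σ e) (square (suc a)))
        (∑-*ˡ d (+ 2 ℤ.* (ℤ.- σ e)) (λ a → σ a ℤ.* square a))))
      where
      lemma : ∀ s t q → + 2 ℤ.* (s ℤ.* t) ℤ.* q ≡ + 2 ℤ.* t ℤ.* (s ℤ.* q)
      lemma = solve-∀
    minus : Θ⁻ (suc d) (suc e) ≡ + 2 ℤ.* (σ d ℤ.* σ e) ℤ.* square (suc d) ℤ.* X
    minus = trans (∑-cong e λ x → lemma (σ d) (σ e) (σ (suc x)) (square (suc d)))
      (∑-*ˡ e (+ 2 ℤ.* (σ d ℤ.* σ e) ℤ.* square (suc d)) σ)
      where
      lemma : ∀ s t x q → + 2 ℤ.* (ℤ.- s ℤ.* (ℤ.- t ℤ.* x)) ℤ.* q ≡ + 2 ℤ.* (s ℤ.* t) ℤ.* q ℤ.* x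
      lemma = solve-∀
    lemma₁ : ∀ s t d A X → (d ℤ.* (ℤ.- s ℤ.* ((1ℤ ℤ.+ d) ℤ.* (1ℤ ℤ.+ d))) ℤ.+ + 2 ℤ.* (ℤ.- t) ℤ.* A)
        ℤ.- + 2 ℤ.* (s ℤ.* t) ℤ.* ((1ℤ ℤ.+ d) ℤ.* (1ℤ ℤ.+ d)) ℤ.* X
      ≡ ℤ.- (s ℤ.* d ℤ.* ((1ℤ ℤ.+ d) ℤ.* (1ℤ ℤ.+ d))) ℤ.- t ℤ.* (+ 2 ℤ.* A) ℤ.- s ℤ.* t
          ℤ.* ((1ℤ ℤ.+ d) ℤ.* (1ℤ ℤ.+ d)) ℤ.* (+ 2 ℤ.* X)
    lemma₁ = solve-∀
    lemma₂ : ∀ s t d → ℤ.- (s ℤ.* d ℤ.* ((1ℤ ℤ.+ d) ℤ.* (1ℤ ℤ.+ d))) ℤ.- t ℤ.* (s ℤ.* d ℤ.* (1ℤ ℤ.+ d))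
        ℤ.- s ℤ.* t ℤ.* ((1ℤ ℤ.+ d) ℤ.* (1ℤ ℤ.+ d)) ℤ.* (t ℤ.- 1ℤ)
      ≡ ℤ.- (s ℤ.* d ℤ.* ((1ℤ ℤ.+ d) ℤ.* (1ℤ ℤ.+ d))) ℤ.- t ℤ.* (s ℤ.* d ℤ.* (1ℤ ℤ.+ d)) ℤ.- s
          ℤ.* ((1ℤ ℤ.+ d) ℤ.* (1ℤ ℤ.+ d)) ℤ.* (t ℤ.* t ℤ.- t)
    lemma₂ = solve-∀
    lemma₃ : ∀ s t d → ℤ.- (s ℤ.* d ℤ.* ((1ℤ ℤ.+ d) ℤ.* (1ℤ ℤ.+ d))) ℤ.- t ℤ.* (s ℤ.* d ℤ.* (1ℤ ℤ.+ d))
        ℤ.- s ℤ.* ((1ℤ ℤ.+ d) ℤ.* (1ℤ ℤ.+ d)) ℤ.* (1ℤ ℤ.- t)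
      ≡ (ℤ.- s) ℤ.* ((1ℤ ℤ.+ d) ℤ.* (1ℤ ℤ.+ d) ℤ.* (1ℤ ℤ.+ d)) ℤ.+ (ℤ.- s) ℤ.* (ℤ.- t) ℤ.* (1ℤ ℤ.+ d)
    lemma₃ = solve-∀

  -- The term linear in D of `Θ` is exactly the negative of `signedSum`, so adding `signedSum`
  -- leaves the cubes alone.
  identity : signedSum N ℤ.+ + 4 ℤ.* (signedSum ⊗ signedSum) N ≡ cubeSum N
  identity = begin
    signedSum N ℤ.+ + 4 ℤ.* (signedSum ⊗ signedSum) N
      ≡⟨ cong (λ z → signedSum N ℤ.+ + 4 ℤ.* z) (divisorSum-⊗ β β N) ⟩
    signedSum N ℤ.+ + 4 ℤ.* ∑₄ ⟨ (λ a b x y → β a x ℤ.* β b y) ⟩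
      ≡⟨ cong (λ z → signedSum N ℤ.+ z) (∑₄-*ˡ (+ 4) _) ⟩
    signedSum N ℤ.+ T
      ≡⟨ cancel Differences T _ _ _
           (trans (∑₄-+ _ _)
               (trans (∑₄-cong λ a b x y → lemma (δ (suc a ℕ.* suc x ℕ.+ suc b ℕ.* suc y) N) (σ (suc a))
               (σ (suc b)) (σ (suc x)) (σ (suc y)) (+ suc a) (+ suc b)) Sums-Differences-divisors))
           (trans (sym (∑₂-+ N _ _))
               (∑₂-cong N λ d e → trans
               (cong (λ z → δ (suc d ℕ.* suc e) N ℤ.* z ℤ.+ δ (suc d ℕ.* suc e) N ℤ.* β (suc d) (suc e))
               (Θ d e))
             (lemma′ (δ (suc d ℕ.* suc e) N) (σ (suc d)) (σ (suc e)) (+ suc d)))) ⟩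
    cubeSum N ∎
    where
    open ≡-Reasoning
    β : ℕ → ℕ → ℤ
    β d e = ℤ.- (σ d ℤ.* σ e ℤ.* + d)
    T : ℤ
    T = ∑₄ (λ a b x y → + 4 ℤ.* (δ (a ℕ.* x ℕ.+ b ℕ.* y) N ℤ.* (β a x ℤ.* β b y)))
    cancel : ∀ d t θ s c → d ℤ.+ t ≡ d ℤ.+ θ → θ ℤ.+ s ≡ c → s ℤ.+ t ≡ c
    cancel d t θ s c p q rewrite +-cancelˡ d t θ p = trans (ℤ.+-comm s θ) q
    lemma : ∀ δ a b x y A B → δ ℤ.* (a ℤ.* x ℤ.* (b ℤ.* y) ℤ.* ((A ℤ.- B) ℤ.* (A ℤ.- B))) ℤ.+ + 4
        ℤ.* (δ ℤ.* ((ℤ.- (a ℤ.* x ℤ.* A)) ℤ.* (ℤ.- (b ℤ.* y ℤ.* B)))) ≡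
      δ ℤ.* (a ℤ.* x ℤ.* (b ℤ.* y) ℤ.* ((A ℤ.+ B) ℤ.* (A ℤ.+ B)))
    lemma = solve-∀
    lemma′ : ∀ δ s t D → δ ℤ.* (s ℤ.* (D ℤ.* D ℤ.* D) ℤ.+ s ℤ.* t ℤ.* D) ℤ.+ δ ℤ.* (ℤ.- (s ℤ.* t ℤ.* D))
        ≡ δ ℤ.* (s ℤ.* (D ℤ.* D ℤ.* D))
    lemma′ = solve-∀

signedSum-square : signedSum ⊕ const (+ 4) ⊗ (signedSum ⊗ signedSum) ≐ cubeSum
signedSum-square n = trans (cong (λ z → signedSum n ℤ.+ z) (const-⊗ (+ 4) (signedSum ⊗ signedSum) n))
    (SquareIdentity.identity n)

-- The derivation q d/dq

δ-transport : ∀ i n → δ i n ℤ.* + n ≡ δ i n ℤ.* + i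
δ-transport i n with i ℕ.≟ n
... | yes refl = refl
... | no i≢n rewrite δ-≢ i≢n = refl

D : Series → Series
D f n = + n ℤ.* f n

D-divisorSum : ∀ β → D (divisorSum β) ≐ divisorSum (λ d e → + d ℤ.* + e ℤ.* β d e)
D-divisorSum β n = trans (sym (∑₂-*ˡ n (+ n) (λ d e → δ (d ℕ.* e) n ℤ.* β d e)))
  (∑₂-cong n λ d e → begin
    + n ℤ.* (δ (suc d ℕ.* suc e) n ℤ.* β (suc d) (suc e))
        ≡⟨ lemma (+ n) (δ (suc d ℕ.* suc e) n) (β (suc d) (suc e)) ⟩
    δ (suc d ℕ.* suc e) n ℤ.* + n ℤ.* β (suc d) (suc e)
        ≡⟨ cong (ℤ._* β (suc d) (suc e)) (δ-transport (suc d ℕ.* suc e) n) ⟩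
    δ (suc d ℕ.* suc e) n ℤ.* (+ suc d ℤ.* + suc e) ℤ.* β (suc d) (suc e)
        ≡⟨ ℤ.*-assoc (δ (suc d ℕ.* suc e) n) _ _ ⟩
    _ ∎)
  where
  open ≡-Reasoning
  lemma : ∀ n d b → n ℤ.* (d ℤ.* b) ≡ d ℤ.* n ℤ.* b
  lemma = solve-∀

-- The aim is the differential equation of 1 + 8 `signedSum`, whose logarithmic derivative has to be
-- -4 `oddSum`. The weight `w` carries the signs of the product of `signedSum` and `oddSum`.
module DerivativeIdentity (N : ℕ) where

  w W : ℕ → ℕ → ℕ → ℕ → ℤ
  w a b x y = σ a ℤ.* σ x ℤ.* (1ℤ ℤ.- σ y)
  -- `W-sum` dictates this expression: replace a by a - b on its right side, and use that the sign
  -- of a sum or a difference is the product of the signs.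
  W a b x y = σ a ℤ.* σ b ℤ.* (σ x ℤ.- σ y) ℤ.+ σ b ℤ.* (σ x ℤ.* σ y ℤ.- σ y)

  W-sum : ∀ a b x z → W (a ℕ.+ b) b x z ≡ w a b x (x ℕ.+ z) ℤ.+ w b a (x ℕ.+ z) x
  W-sum a b x z rewrite σ-+ a b | σ-+ x z = trans
    (σ-cancel b (λ q → σ a ℤ.* q ℤ.* (σ x ℤ.- σ z) ℤ.+ σ b ℤ.* (σ x ℤ.* σ z ℤ.- σ z))
        (lemma (σ a) (σ b) (σ x) (σ z)) refl)
    (sym (σ-cancel x (λ q → σ a ℤ.* (σ x ℤ.- q ℤ.* σ z) ℤ.+ σ b ℤ.* (σ x ℤ.* σ z ℤ.- q ℤ.* σ z))
        (lemma′ (σ a) (σ b) (σ x) (σ z)) (lemma″ (σ a) (σ b) (σ x) (σ z))))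
    where
    lemma : ∀ a b x z → a ℤ.* b ℤ.* b ℤ.* (x ℤ.- z) ℤ.+ b ℤ.* (x ℤ.* z ℤ.- z)
        ≡ a ℤ.* (b ℤ.* b) ℤ.* (x ℤ.- z) ℤ.+ b ℤ.* (x ℤ.* z ℤ.- z)
    lemma = solve-∀
    lemma′ : ∀ a b x z → a ℤ.* x ℤ.* (1ℤ ℤ.- x ℤ.* z) ℤ.+ b ℤ.* (x ℤ.* z) ℤ.* (1ℤ ℤ.- x)
        ≡ a ℤ.* (x ℤ.- x ℤ.* x ℤ.* z) ℤ.+ b ℤ.* (x ℤ.* z ℤ.- x ℤ.* x ℤ.* z)
    lemma′ = solve-∀
    lemma″ : ∀ a b x z → a ℤ.* (x ℤ.- 1ℤ ℤ.* z) ℤ.+ b ℤ.* (x ℤ.* z ℤ.- 1ℤ ℤ.* z)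
        ≡ a ℤ.* 1ℤ ℤ.* (x ℤ.- z) ℤ.+ b ℤ.* (x ℤ.* z ℤ.- z)
    lemma″ = solve-∀

  W-difference : ∀ b c x y → W c b x (x ℕ.+ y) ≡ w (b ℕ.+ c) b x y ℤ.+ w b (b ℕ.+ c) y x
  W-difference b c x y rewrite σ-+ b c | σ-+ x y =
    σ-cancel x (λ q → σ c ℤ.* σ b ℤ.* (σ x ℤ.- σ x ℤ.* σ y) ℤ.+ σ b ℤ.* (q ℤ.* σ y ℤ.- σ x ℤ.* σ y))
      (lemma (σ b) (σ c) (σ x) (σ y)) (lemma′ (σ b) (σ c) (σ x) (σ y))
    where
    lemma : ∀ b c x y → c ℤ.* b ℤ.* (x ℤ.- x ℤ.* y) ℤ.+ b ℤ.* (x ℤ.* (x ℤ.* y) ℤ.- x ℤ.* y)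
        ≡ c ℤ.* b ℤ.* (x ℤ.- x ℤ.* y) ℤ.+ b ℤ.* (x ℤ.* x ℤ.* y ℤ.- x ℤ.* y)
    lemma = solve-∀
    lemma′ : ∀ b c x y → c ℤ.* b ℤ.* (x ℤ.- x ℤ.* y) ℤ.+ b ℤ.* (1ℤ ℤ.* y ℤ.- x ℤ.* y)
        ≡ b ℤ.* c ℤ.* x ℤ.* (1ℤ ℤ.- y) ℤ.+ b ℤ.* y ℤ.* (1ℤ ℤ.- x)
    lemma′ = solve-∀

  W-shear : ∀ a c x y → W a (a ℕ.+ c) x y ≡ W a c (x ℕ.+ y) y
  W-shear a c x y rewrite σ-+ a c | σ-+ x y = trans
    (σ-cancel a (λ q → q ℤ.* σ c ℤ.* (σ x ℤ.- σ y) ℤ.+ σ a ℤ.* σ c ℤ.* (σ x ℤ.* σ y ℤ.- σ y))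
        (lemma (σ a) (σ c) (σ x) (σ y)) refl)
    (sym (σ-cancel y (λ q → σ a ℤ.* σ c ℤ.* (σ x ℤ.* σ y ℤ.- σ y) ℤ.+ σ c ℤ.* (σ x ℤ.* q ℤ.- σ y))
        (lemma′ (σ a) (σ c) (σ x) (σ y)) (lemma″ (σ a) (σ c) (σ x) (σ y))))
    where
    lemma : ∀ a c x y → a ℤ.* (a ℤ.* c) ℤ.* (x ℤ.- y) ℤ.+ a ℤ.* c ℤ.* (x ℤ.* y ℤ.- y)
        ≡ a ℤ.* a ℤ.* c ℤ.* (x ℤ.- y) ℤ.+ a ℤ.* c ℤ.* (x ℤ.* y ℤ.- y)
    lemma = solve-∀
    lemma′ : ∀ a c x y → a ℤ.* c ℤ.* (x ℤ.* y ℤ.- y) ℤ.+ c ℤ.* (x ℤ.* y ℤ.* y ℤ.- y)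
        ≡ a ℤ.* c ℤ.* (x ℤ.* y ℤ.- y) ℤ.+ c ℤ.* (x ℤ.* (y ℤ.* y) ℤ.- y)
    lemma′ = solve-∀
    lemma″ : ∀ a c x y → a ℤ.* c ℤ.* (x ℤ.* y ℤ.- y) ℤ.+ c ℤ.* (x ℤ.* 1ℤ ℤ.- y)
        ≡ 1ℤ ℤ.* c ℤ.* (x ℤ.- y) ℤ.+ a ℤ.* c ℤ.* (x ℤ.* y ℤ.- y)
    lemma″ = solve-∀

  open Liouville N w W square squared-difference
    squared-difference-diagonal squared-difference-above squared-difference-below
    W-sum W-difference W-shear

  u v t : ℕ → ℕ → ℕ → ℤ
  u d a e = (σ e ℤ.- 1ℤ) ℤ.* σ a
  v d a e = σ d ℤ.* (1ℤ ℤ.- σ e) ℤ.* σ a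
  t d x e = (1ℤ ℤ.- σ e ℤ.- σ d ℤ.* σ e) ℤ.* σ x ℤ.+ σ d ℤ.* σ e

  w-diagonal-xy : ∀ a b x → w a b x x ≡ u (a ℕ.+ b) a x
  w-diagonal-xy a b x = σ-cancel x (λ q → σ a ℤ.* (σ x ℤ.- q)) (lemma (σ a) (σ x)) (lemma′ (σ a) (σ x))
    where
    lemma : ∀ a x → a ℤ.* x ℤ.* (1ℤ ℤ.- x) ≡ a ℤ.* (x ℤ.- x ℤ.* x)
    lemma = solve-∀
    lemma′ : ∀ a x → a ℤ.* (x ℤ.- 1ℤ) ≡ (x ℤ.- 1ℤ) ℤ.* a
    lemma′ = solve-∀

  W-diagonal-xy : ∀ a b x → W a b x x ≡ v (a ℕ.+ b) a x
  W-diagonal-xy a b x rewrite σ-+ a b = trans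
    (σ-cancel x (λ q → σ b ℤ.* (q ℤ.- σ x)) (lemma (σ a) (σ b) (σ x)) refl)
    (sym (σ-cancel a (λ q → q ℤ.* (σ b ℤ.* (1ℤ ℤ.- σ x))) (lemma′ (σ a) (σ b) (σ x)) (ℤ.*-identityˡ _)))
    where
    lemma : ∀ a b x → a ℤ.* b ℤ.* (x ℤ.- x) ℤ.+ b ℤ.* (x ℤ.* x ℤ.- x) ≡ b ℤ.* (x ℤ.* x ℤ.- x)
    lemma = solve-∀
    lemma′ : ∀ a b x → a ℤ.* b ℤ.* (1ℤ ℤ.- x) ℤ.* a ≡ a ℤ.* a ℤ.* (b ℤ.* (1ℤ ℤ.- x))
    lemma′ = solve-∀

  W-diagonal-ab : ∀ a x y → W a a x y ≡ t a x (x ℕ.+ y)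
  W-diagonal-ab a x y rewrite σ-+ x y = trans
    (σ-cancel a (λ q → q ℤ.* (σ x ℤ.- σ y) ℤ.+ σ a ℤ.* (σ x ℤ.* σ y ℤ.- σ y)) refl refl)
    (sym (σ-cancel x (λ q → σ x ℤ.- q ℤ.* σ y ℤ.+ σ a ℤ.* (σ x ℤ.* σ y ℤ.- q ℤ.* σ y))
        (lemma (σ a) (σ x) (σ y)) (lemma′ (σ a) (σ x) (σ y))))
    where
    lemma : ∀ a x y → (1ℤ ℤ.- x ℤ.* y ℤ.- a ℤ.* (x ℤ.* y)) ℤ.* x ℤ.+ a ℤ.* (x ℤ.* y)
        ≡ x ℤ.- x ℤ.* x ℤ.* y ℤ.+ a ℤ.* (x ℤ.* y ℤ.- x ℤ.* x ℤ.* y)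
    lemma = solve-∀
    lemma′ : ∀ a x y → x ℤ.- 1ℤ ℤ.* y ℤ.+ a ℤ.* (x ℤ.* y ℤ.- 1ℤ ℤ.* y)
        ≡ 1ℤ ℤ.* (x ℤ.- y) ℤ.+ a ℤ.* (x ℤ.* y ℤ.- y)
    lemma′ = solve-∀

  open DivisorForm u v t w-diagonal-xy W-diagonal-xy W-diagonal-ab

  -- Let D, E be the two arguments. The summand of `t` that is free of x is added E - 1 times;
  -- together with one further D² from the alternating sums it yields the factor E that q d/dq puts
  -- in front of `signedSum`. The terms left over are (1 - σ E)(D² - (D - 1)D), the weight of
  -- `oddSum`.
  Θ : ∀ d e → + 2 ℤ.* (Θ⁺ (suc d) (suc e) ℤ.- Θ⁻ (suc d) (suc e)) ≡
    (1ℤ ℤ.- σ (suc e)) ℤ.* + suc d ℤ.- + 2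
        ℤ.* (+ suc d ℤ.* + suc e ℤ.* (σ (suc d) ℤ.* σ (suc e) ℤ.* + suc d))
  Θ d e = begin
    + 2 ℤ.* (Θ⁺ (suc d) (suc e) ℤ.- Θ⁻ (suc d) (suc e))
      ≡⟨ cong₂ (λ p q → + 2 ℤ.* (p ℤ.- q)) plus minus ⟩
    + 2 ℤ.* (((ℤ.- τ ℤ.- 1ℤ) ℤ.* square (suc d) ℤ.* Y ℤ.+ (ℤ.- s) ℤ.* (1ℤ ℤ.- (ℤ.- τ)) ℤ.* A)
      ℤ.- ((1ℤ ℤ.- (ℤ.- τ) ℤ.- ℤ.- s ℤ.* ℤ.- τ) ℤ.* square (suc d) ℤ.* X ℤ.+ + e
          ℤ.* (ℤ.- s ℤ.* ℤ.- τ ℤ.* square (suc d))))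
      ≡⟨ lemma₁ s τ (+ d) (+ e) Y A X ⟩
    combination s τ (+ d) (+ e) (+ 2 ℤ.* Y) (+ 2 ℤ.* A) (+ 2 ℤ.* X)
      ≡⟨ cong (λ y → combination s τ (+ d) (+ e) y (+ 2 ℤ.* A) (+ 2 ℤ.* X)) (∑-σ d) ⟩
    combination s τ (+ d) (+ e) (s ℤ.- 1ℤ) (+ 2 ℤ.* A) (+ 2 ℤ.* X)
      ≡⟨ cong₂ (combination s τ (+ d) (+ e) (s ℤ.- 1ℤ)) (∑-σ-square d) (∑-σ e) ⟩
    combination s τ (+ d) (+ e) (s ℤ.- 1ℤ) (s ℤ.* + d ℤ.* + suc d) (τ ℤ.- 1ℤ)
      ≡⟨ lemma₂ s τ (+ d) (+ e) ⟩
    simplified s τ (+ d) (+ e) (s ℤ.* s) (τ ℤ.* τ)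
      ≡⟨ cong₂ (simplified s τ (+ d) (+ e)) (σ-square d) (σ-square e) ⟩
    simplified s τ (+ d) (+ e) 1ℤ 1ℤ
      ≡⟨ lemma₃ s τ (+ d) (+ e) ⟩
    _ ∎
    where
    open ≡-Reasoning
    s τ A X Y : ℤ
    s = σ d
    τ = σ e
    A = ∑ d (λ a → σ a ℤ.* square a)
    X = ∑ e σ
    Y = ∑ d σ
    plus : Θ⁺ (suc d) (suc e)
        ≡ (ℤ.- τ ℤ.- 1ℤ) ℤ.* square (suc d) ℤ.* Y ℤ.+ (ℤ.- s) ℤ.* (1ℤ ℤ.- (ℤ.- τ)) ℤ.* A
    plus = trans
        (∑-cong d λ a → lemma (ℤ.- τ ℤ.- 1ℤ) (σ (suc a)) (square (suc d)) ((ℤ.- s) ℤ.* (1ℤ ℤ.- (ℤ.- τ)))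
        (square (suc a)))
      (∑-linear d ((ℤ.- τ ℤ.- 1ℤ) ℤ.* square (suc d)) σ ((ℤ.- s) ℤ.* (1ℤ ℤ.- (ℤ.- τ)))
          (λ a → σ a ℤ.* square a))
      where
      lemma : ∀ p a q r x → p ℤ.* a ℤ.* q ℤ.+ r ℤ.* a ℤ.* x ≡ p ℤ.* q ℤ.* a ℤ.+ r ℤ.* (a ℤ.* x)
      lemma = solve-∀
    minus : Θ⁻ (suc d) (suc e)
        ≡ (1ℤ ℤ.- (ℤ.- τ) ℤ.- ℤ.- s ℤ.* ℤ.- τ) ℤ.* square (suc d) ℤ.* X ℤ.+ + e
        ℤ.* (ℤ.- s ℤ.* ℤ.- τ ℤ.* square (suc d))
    minus = trans
        (∑-cong e λ x → lemma (1ℤ ℤ.- (ℤ.- τ) ℤ.- ℤ.- s ℤ.* ℤ.- τ) (σ (suc x)) (ℤ.- s ℤ.* ℤ.- τ)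
        (square (suc d)))
      (trans (∑-linear e ((1ℤ ℤ.- (ℤ.- τ) ℤ.- ℤ.- s ℤ.* ℤ.- τ) ℤ.* square (suc d)) σ
          (ℤ.- s ℤ.* ℤ.- τ ℤ.* square (suc d)) (λ _ → 1ℤ))
        (cong (λ z → (1ℤ ℤ.- (ℤ.- τ) ℤ.- ℤ.- s ℤ.* ℤ.- τ) ℤ.* square (suc d) ℤ.* X ℤ.+ z)
          (trans (cong (λ z → ℤ.- s ℤ.* ℤ.- τ ℤ.* square (suc d) ℤ.* z) (∑-const e 1ℤ))
              (lemma′ (ℤ.- s ℤ.* ℤ.- τ ℤ.* square (suc d)) (+ e)))))
      where
      lemma : ∀ p x r q → (p ℤ.* x ℤ.+ r) ℤ.* q ≡ p ℤ.* q ℤ.* x ℤ.+ r ℤ.* q ℤ.* 1ℤ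
      lemma = solve-∀
      lemma′ : ∀ p e → p ℤ.* (e ℤ.* 1ℤ) ≡ e ℤ.* p
      lemma′ = solve-∀
    combination : ℤ → ℤ → ℤ → ℤ → ℤ → ℤ → ℤ → ℤ
    combination s t d e y a x = (ℤ.- t ℤ.- 1ℤ) ℤ.* ((1ℤ ℤ.+ d) ℤ.* (1ℤ ℤ.+ d)) ℤ.* y ℤ.- s
        ℤ.* (1ℤ ℤ.+ t) ℤ.* a
      ℤ.- ((1ℤ ℤ.+ t ℤ.- s ℤ.* t) ℤ.* ((1ℤ ℤ.+ d) ℤ.* (1ℤ ℤ.+ d)) ℤ.* x ℤ.+ + 2 ℤ.* e
          ℤ.* (s ℤ.* t ℤ.* ((1ℤ ℤ.+ d) ℤ.* (1ℤ ℤ.+ d))))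
    simplified : ℤ → ℤ → ℤ → ℤ → ℤ → ℤ → ℤ
    simplified s t d e p q = (ℤ.- t ℤ.- 1ℤ) ℤ.* ((1ℤ ℤ.+ d) ℤ.* (1ℤ ℤ.+ d)) ℤ.* (s ℤ.- 1ℤ)
        ℤ.- (1ℤ ℤ.+ t) ℤ.* p ℤ.* d ℤ.* (1ℤ ℤ.+ d)
      ℤ.- (q ℤ.- 1ℤ ℤ.- s ℤ.* q ℤ.+ s ℤ.* t) ℤ.* ((1ℤ ℤ.+ d) ℤ.* (1ℤ ℤ.+ d)) ℤ.- + 2 ℤ.* e
          ℤ.* (s ℤ.* t ℤ.* ((1ℤ ℤ.+ d) ℤ.* (1ℤ ℤ.+ d)))
    lemma₁ : ∀ s t d e Y A X → + 2
        ℤ.* (((ℤ.- t ℤ.- 1ℤ) ℤ.* ((1ℤ ℤ.+ d) ℤ.* (1ℤ ℤ.+ d)) ℤ.* Y ℤ.+ (ℤ.- s) ℤ.* (1ℤ ℤ.- (ℤ.- t))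
        ℤ.* A)
      ℤ.- ((1ℤ ℤ.- (ℤ.- t) ℤ.- ℤ.- s ℤ.* ℤ.- t) ℤ.* ((1ℤ ℤ.+ d) ℤ.* (1ℤ ℤ.+ d)) ℤ.* X ℤ.+ e
          ℤ.* (ℤ.- s ℤ.* ℤ.- t ℤ.* ((1ℤ ℤ.+ d) ℤ.* (1ℤ ℤ.+ d)))))
      ≡ (ℤ.- t ℤ.- 1ℤ) ℤ.* ((1ℤ ℤ.+ d) ℤ.* (1ℤ ℤ.+ d)) ℤ.* (+ 2 ℤ.* Y) ℤ.- s ℤ.* (1ℤ ℤ.+ t)
          ℤ.* (+ 2 ℤ.* A)
      ℤ.- ((1ℤ ℤ.+ t ℤ.- s ℤ.* t) ℤ.* ((1ℤ ℤ.+ d) ℤ.* (1ℤ ℤ.+ d)) ℤ.* (+ 2 ℤ.* X) ℤ.+ + 2 ℤ.* e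
          ℤ.* (s ℤ.* t ℤ.* ((1ℤ ℤ.+ d) ℤ.* (1ℤ ℤ.+ d))))
    lemma₁ = solve-∀
    lemma₂ : ∀ s t d e → (ℤ.- t ℤ.- 1ℤ) ℤ.* ((1ℤ ℤ.+ d) ℤ.* (1ℤ ℤ.+ d)) ℤ.* (s ℤ.- 1ℤ) ℤ.- s
        ℤ.* (1ℤ ℤ.+ t) ℤ.* (s ℤ.* d ℤ.* (1ℤ ℤ.+ d))
      ℤ.- ((1ℤ ℤ.+ t ℤ.- s ℤ.* t) ℤ.* ((1ℤ ℤ.+ d) ℤ.* (1ℤ ℤ.+ d)) ℤ.* (t ℤ.- 1ℤ) ℤ.+ + 2 ℤ.* e
          ℤ.* (s ℤ.* t ℤ.* ((1ℤ ℤ.+ d) ℤ.* (1ℤ ℤ.+ d))))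
      ≡ (ℤ.- t ℤ.- 1ℤ) ℤ.* ((1ℤ ℤ.+ d) ℤ.* (1ℤ ℤ.+ d)) ℤ.* (s ℤ.- 1ℤ) ℤ.- (1ℤ ℤ.+ t) ℤ.* (s ℤ.* s) ℤ.* d
          ℤ.* (1ℤ ℤ.+ d)
      ℤ.- (t ℤ.* t ℤ.- 1ℤ ℤ.- s ℤ.* (t ℤ.* t) ℤ.+ s ℤ.* t) ℤ.* ((1ℤ ℤ.+ d) ℤ.* (1ℤ ℤ.+ d)) ℤ.- + 2 ℤ.* e
          ℤ.* (s ℤ.* t ℤ.* ((1ℤ ℤ.+ d) ℤ.* (1ℤ ℤ.+ d)))
    lemma₂ = solve-∀
    lemma₃ : ∀ s t d e → (ℤ.- t ℤ.- 1ℤ) ℤ.* ((1ℤ ℤ.+ d) ℤ.* (1ℤ ℤ.+ d)) ℤ.* (s ℤ.- 1ℤ) ℤ.- (1ℤ ℤ.+ t)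
        ℤ.* 1ℤ ℤ.* d ℤ.* (1ℤ ℤ.+ d)
      ℤ.- (1ℤ ℤ.- 1ℤ ℤ.- s ℤ.* 1ℤ ℤ.+ s ℤ.* t) ℤ.* ((1ℤ ℤ.+ d) ℤ.* (1ℤ ℤ.+ d)) ℤ.- + 2 ℤ.* e
          ℤ.* (s ℤ.* t ℤ.* ((1ℤ ℤ.+ d) ℤ.* (1ℤ ℤ.+ d)))
      ≡ (1ℤ ℤ.- (ℤ.- t)) ℤ.* (1ℤ ℤ.+ d) ℤ.- + 2
          ℤ.* ((1ℤ ℤ.+ d) ℤ.* (1ℤ ℤ.+ e) ℤ.* ((ℤ.- s) ℤ.* (ℤ.- t) ℤ.* (1ℤ ℤ.+ d)))
    lemma₃ = solve-∀

  identity : + 2 ℤ.* D signedSum N ℤ.+ oddSum N ℤ.+ + 8 ℤ.* (signedSum ⊗ oddSum) N ≡ 0ℤ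
  identity = begin
    + 2 ℤ.* D signedSum N ℤ.+ oddSum N ℤ.+ + 8 ℤ.* (signedSum ⊗ oddSum) N
      ≡⟨ cong₂ (λ p q → p ℤ.+ oddSum N ℤ.+ q)
          (trans (cong (λ z → + 2 ℤ.* z) (D-divisorSum β N)) (sym (∑₂-*ˡ N (+ 2) _)))
           (trans (cong (λ z → + 8 ℤ.* z) (divisorSum-⊗ β γ N))
               (trans (double T₀) (cong (λ z → + 2 ℤ.* z) (∑₄-*ˡ (+ 4) _)))) ⟩
    S′ ℤ.+ oddSum N ℤ.+ + 2 ℤ.* T
      ≡⟨ cong (λ z → z ℤ.+ + 2 ℤ.* T)
          (trans (sym (∑₂-+ N _ _))
          (trans (∑₂-cong N {h = λ d e → δ (d ℕ.* e) N ℤ.* (+ 2 ℤ.* (Θ⁺ d e ℤ.- Θ⁻ d e))} λ d e →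
           trans (lemma′ (δ (suc d ℕ.* suc e) N) (σ (suc d)) (σ (suc e)) (+ suc d) (+ suc e))
               (cong (λ z → δ (suc d ℕ.* suc e) N ℤ.* z) (sym (Θ d e))))
           (trans (∑₂-cong N λ d e → lemma‴ (δ (suc d ℕ.* suc e) N)
               (Θ⁺ (suc d) (suc e) ℤ.- Θ⁻ (suc d) (suc e)))
             (∑₂-*ˡ N (+ 2) (λ d e → δ (d ℕ.* e) N ℤ.* (Θ⁺ d e ℤ.- Θ⁻ d e)))))) ⟩
    + 2 ℤ.* T′ ℤ.+ + 2 ℤ.* T
      ≡⟨ cancel Sums Differences T T′ Sums-Differences-divisors
           (trans (∑₄-+ _ _)
               (∑₄-cong λ a b x y → lemma (δ (suc a ℕ.* suc x ℕ.+ suc b ℕ.* suc y) N) (σ (suc a))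
               (σ (suc x)) (σ (suc y)) (+ suc a) (+ suc b))) ⟩
    0ℤ ∎
    where
    open ≡-Reasoning
    β γ : ℕ → ℕ → ℤ
    β d e = ℤ.- (σ d ℤ.* σ e ℤ.* + d)
    γ d e = (1ℤ ℤ.- σ e) ℤ.* + d
    T T₀ T′ S′ : ℤ
    T₀ = ∑₄ ⟨ (λ a b x y → β a x ℤ.* γ b y) ⟩
    T = ∑₄ (λ a b x y → + 4 ℤ.* (δ (a ℕ.* x ℕ.+ b ℕ.* y) N ℤ.* (β a x ℤ.* γ b y)))
    T′ = ∑₂ N (λ d e → δ (d ℕ.* e) N ℤ.* (Θ⁺ d e ℤ.- Θ⁻ d e))
    S′ = ∑₂ N (λ d e → + 2 ℤ.* (δ (d ℕ.* e) N ℤ.* (+ d ℤ.* + e ℤ.* β d e)))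
    double : ∀ t → + 8 ℤ.* t ≡ + 2 ℤ.* (+ 4 ℤ.* t)
    double = solve-∀
    cancel : ∀ s d t θ → s ≡ d ℤ.+ θ → s ℤ.+ t ≡ d → + 2 ℤ.* θ ℤ.+ + 2 ℤ.* t ≡ 0ℤ
    cancel s d t θ refl q = begin
      + 2 ℤ.* θ ℤ.+ + 2 ℤ.* t          ≡⟨ lemma₁ d t θ ⟩
      + 2 ℤ.* (d ℤ.+ θ ℤ.+ t ℤ.- d)    ≡⟨ cong (λ z → + 2 ℤ.* (z ℤ.- d)) q ⟩
      + 2 ℤ.* (d ℤ.- d)                ≡⟨ lemma₂ d ⟩
      0ℤ ∎
      where
      lemma₁ : ∀ d t θ → + 2 ℤ.* θ ℤ.+ + 2 ℤ.* t ≡ + 2 ℤ.* (d ℤ.+ θ ℤ.+ t ℤ.- d)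
      lemma₁ = solve-∀
      lemma₂ : ∀ d → + 2 ℤ.* (d ℤ.- d) ≡ 0ℤ
      lemma₂ = solve-∀
    lemma : ∀ δ a x y A B → δ ℤ.* (a ℤ.* x ℤ.* (1ℤ ℤ.- y) ℤ.* ((A ℤ.+ B) ℤ.* (A ℤ.+ B)))
      ℤ.+ + 4 ℤ.* (δ ℤ.* (ℤ.- (a ℤ.* x ℤ.* A) ℤ.* ((1ℤ ℤ.- y) ℤ.* B))) ≡
      δ ℤ.* (a ℤ.* x ℤ.* (1ℤ ℤ.- y) ℤ.* ((A ℤ.- B) ℤ.* (A ℤ.- B)))
    lemma = solve-∀
    lemma′ : ∀ δ s t d e → + 2 ℤ.* (δ ℤ.* (d ℤ.* e ℤ.* (ℤ.- (s ℤ.* t ℤ.* d)))) ℤ.+ δ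
        ℤ.* ((1ℤ ℤ.- t) ℤ.* d) ≡
      δ ℤ.* ((1ℤ ℤ.- t) ℤ.* d ℤ.- + 2 ℤ.* (d ℤ.* e ℤ.* (s ℤ.* t ℤ.* d)))
    lemma′ = solve-∀
    lemma‴ : ∀ δ θ → δ ℤ.* (+ 2 ℤ.* θ) ≡ + 2 ℤ.* (δ ℤ.* θ)
    lemma‴ = solve-∀

-- Overpartitions as infinite products

δ-⊗-< : ∀ {j n} f → n ℕ.< j → (δ j ⊗ f) n ≡ 0ℤ
δ-⊗-< {suc j} {zero}  f _       = refl
δ-⊗-< {suc j} {suc n} f (s≤s p) = trans (ℤ.+-identityˡ _) (δ-⊗-< f p)

δ-⊗-zero : ∀ f → δ 0 ⊗ f ≐ f
δ-⊗-zero f zero    = ℤ.*-identityˡ (f 0)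
δ-⊗-zero f (suc n) = trans (cong₂ ℤ._+_ (ℤ.*-identityˡ (f (suc n))) (zero-⊗ f n λ _ → refl))
    (ℤ.+-identityʳ _)

δ-⊗-suc : ∀ j f n → (δ (suc j) ⊗ f) (suc n) ≡ (δ j ⊗ f) n
δ-⊗-suc j f n = ℤ.+-identityˡ _

δ-⊗-+ : ∀ j f n → (δ j ⊗ f) (j ℕ.+ n) ≡ f n
δ-⊗-+ zero    f n = δ-⊗-zero f n
δ-⊗-+ (suc j) f n = trans (δ-⊗-suc j f (j ℕ.+ n)) (δ-⊗-+ j f n)

δ-⊗-+-+ : ∀ j i f n → (δ (j ℕ.+ i) ⊗ f) (j ℕ.+ n) ≡ (δ i ⊗ f) n
δ-⊗-+-+ zero    i f n = refl
δ-⊗-+-+ (suc j) i f n = trans (δ-⊗-suc (j ℕ.+ i) f (j ℕ.+ n)) (δ-⊗-+-+ j i f n)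

below-or-beyond : ∀ j n → n ℕ.< j ⊎ ∃ λ i → n ≡ j ℕ.+ i
below-or-beyond j n with n ℕ.<? j
... | yes n<j = inj₁ n<j
... | no  n≮j = inj₂ (n ℕ.∸ j , sym (ℕ.m+[n∸m]≡n (ℕ.≮⇒≥ n≮j)))

-- The equation determines each coefficient from one that lies k + 1 places earlier, hence has only
-- one solution. This is cancellation of 1 - q^(k+1).
δ-unique : ∀ k c {f g} → f ≐ c ⊕ δ (suc k) ⊗ f → g ≐ c ⊕ δ (suc k) ⊗ g → f ≐ g
δ-unique k c {f} {g} p q = <-rec (λ n → f n ≡ g n) step
  where
  step : ∀ n → (∀ {i} → i ℕ.< n → f i ≡ g i) → f n ≡ g n
  step n rec with below-or-beyond (suc k) n
  ... | inj₁ n<j = trans (p n)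
      (trans (cong (λ z → c n ℤ.+ z) (trans (δ-⊗-< f n<j) (sym (δ-⊗-< g n<j)))) (sym (q n)))
  ... | inj₂ (i , refl) = trans (p (suc k ℕ.+ i)) (trans (cong (λ z → c (suc k ℕ.+ i) ℤ.+ z)
    (trans (δ-⊗-+ (suc k) f i) (trans (rec (s≤s (ℕ.m≤n+m i k))) (sym (δ-⊗-+ (suc k) g i)))))
        (sym (q (suc k ℕ.+ i))))

-- The substitution of q⁵ for q

dilate : Series → Series
dilate f 0 = f 0
dilate f 1 = 0ℤ
dilate f 2 = 0ℤ
dilate f 3 = 0ℤ
dilate f 4 = 0ℤ
dilate f (suc (suc (suc (suc (suc n))))) = dilate (tail f) n

dilate-cong-upto : ∀ n {f g} → (∀ i → i ℕ.≤ n → f i ≡ g i) → dilate f n ≡ dilate g n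
dilate-cong-upto 0 p = p 0 z≤n
dilate-cong-upto 1 p = refl
dilate-cong-upto 2 p = refl
dilate-cong-upto 3 p = refl
dilate-cong-upto 4 p = refl
dilate-cong-upto (suc (suc (suc (suc (suc n))))) p =
  dilate-cong-upto n λ i i≤n → p (suc i) (s≤s (ℕ.≤-trans i≤n (ℕ.m≤n+m n 4)))

dilate-cong : ∀ {f g} → f ≐ g → dilate f ≐ dilate g
dilate-cong p n = dilate-cong-upto n λ i _ → p i

dilate-zero : dilate (λ _ → 0ℤ) ≐ λ _ → 0ℤ
dilate-zero 0 = refl
dilate-zero 1 = refl
dilate-zero 2 = refl
dilate-zero 3 = refl
dilate-zero 4 = refl
dilate-zero (suc (suc (suc (suc (suc n))))) = dilate-zero n

dilate-one : dilate (const 1ℤ) ≐ const 1ℤ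
dilate-one 0 = refl
dilate-one 1 = refl
dilate-one 2 = refl
dilate-one 3 = refl
dilate-one 4 = refl
dilate-one (suc (suc (suc (suc (suc n))))) = dilate-zero n

dilate-⊕ : ∀ f g → dilate (f ⊕ g) ≐ dilate f ⊕ dilate g
dilate-⊕ f g 0 = refl
dilate-⊕ f g 1 = refl
dilate-⊕ f g 2 = refl
dilate-⊕ f g 3 = refl
dilate-⊕ f g 4 = refl
dilate-⊕ f g (suc (suc (suc (suc (suc n))))) = dilate-⊕ (tail f) (tail g) n

dilate-δ : ∀ j f → dilate (δ j ⊗ f) ≐ δ (j ℕ.* 5) ⊗ dilate f
dilate-δ zero    f n = trans (dilate-cong (δ-⊗-zero f) n) (sym (δ-⊗-zero (dilate f) n))
dilate-δ (suc j) f 0 = refl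
dilate-δ (suc j) f 1 = refl
dilate-δ (suc j) f 2 = refl
dilate-δ (suc j) f 3 = refl
dilate-δ (suc j) f 4 = refl
dilate-δ (suc j) f (suc (suc (suc (suc (suc n))))) = begin
  dilate (tail (δ (suc j) ⊗ f)) n              ≡⟨ dilate-cong (δ-⊗-suc j f) n ⟩
  dilate (δ j ⊗ f) n                           ≡⟨ dilate-δ j f n ⟩
  (δ (j ℕ.* 5) ⊗ dilate f) n                   ≡⟨ δ-⊗-+-+ 5 (j ℕ.* 5) (dilate f) n ⟨
  (δ (5 ℕ.+ j ℕ.* 5) ⊗ dilate f) (5 ℕ.+ n)     ∎
  where open ≡-Reasoning

-- The coefficients of the product over j ≤ k with ℓ ∤ j of (1 + q^j) / (1 − q^j).
finiteProduct : ℕ → ℕ → Series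
finiteProduct ℓ k n = + length (overparts ℓ k n)

-- The function local to the definition of `overparts` is recovered as a witness, so that the number
-- of overpartitions with a given multiplicity of the part k + 1 can be discussed.
choices : ∀ ℓ k n → ¬ ℓ ∣ suc k → ∃ λ f → overparts ℓ (suc k) n ≡ concatMap f (upTo (suc n))
choices ℓ k n ℓ∤ with ℓ ∣? suc k
... | yes ℓ∣ = contradiction ℓ∣ ℓ∤
... | no  _  = _ , refl

choose : ∀ ℓ k n → ¬ ℓ ∣ suc k → ℕ → List (List Part)
choose ℓ k n ℓ∤ = proj₁ (choices ℓ k n ℓ∤)

length-choose-zero : ∀ ℓ k n ℓ∤ → length (choose ℓ k n ℓ∤ 0) ≡ length (overparts ℓ k n)
length-choose-zero ℓ k n ℓ∤ with ℓ ∣? suc k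
... | yes ℓ∣ = contradiction ℓ∣ ℓ∤
... | no  _  = trans (cong length (List.++-identityʳ (List.map ([] ++_) (overparts ℓ k n))))
    (List.length-map _ (overparts ℓ k n))

-- The 2 counts the choice whether the first copy of the part is overlined; with no copies there is
-- no such choice, so multiplicity zero is counted separately.
length-choose-suc : ∀ ℓ k n ℓ∤ m → + length (choose ℓ k n ℓ∤ (suc m))
    ≡ + 2 ℤ.* (δ (suc m ℕ.* suc k) ⊗ finiteProduct ℓ k) n
length-choose-suc ℓ k n ℓ∤ m with ℓ ∣? suc k
... | yes ℓ∣ = contradiction ℓ∣ ℓ∤
... | no  _ with suc m ℕ.* suc k ℕ.≤? n
... | no ≰n = sym (trans (cong (λ z → + 2 ℤ.* z) (δ-⊗-< (finiteProduct ℓ k) (ℕ.≰⇒> ≰n))) refl)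
... | yes ≤n = begin
  + length (List.map _ O ++ (List.map _ O ++ []))
    ≡⟨ cong +_ (trans (List.length-++ (List.map _ O)) (cong₂ ℕ._+_ (List.length-map _ O)
         (trans (List.length-++ (List.map _ O)) (cong (ℕ._+ 0) (List.length-map _ O))))) ⟩
  + (2 ℕ.* length O)
    ≡⟨ ℤ.pos-* 2 (length O) ⟩
  + 2 ℤ.* finiteProduct ℓ k (n ℕ.∸ suc m ℕ.* suc k)
    ≡⟨ cong (λ z → + 2 ℤ.* z)
        (trans (sym (δ-⊗-+ (suc m ℕ.* suc k) (finiteProduct ℓ k) (n ℕ.∸ suc m ℕ.* suc k)))
        (cong (δ (suc m ℕ.* suc k) ⊗ finiteProduct ℓ k) (ℕ.m+[n∸m]≡n ≤n))) ⟩
  _ ∎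
  where
  open ≡-Reasoning
  O : List (List Part)
  O = overparts ℓ k (n ℕ.∸ suc m ℕ.* suc k)

length-concatMap-applyUpTo : ∀ {A B : Set} (f : A → List B) (g : ℕ → A) N h → (∀ i → + length (f (g i))
    ≡ h (suc i)) →
  + length (concatMap f (applyUpTo g N)) ≡ ∑ N h
length-concatMap-applyUpTo f g zero    h p = refl
length-concatMap-applyUpTo f g (suc N) h p = trans (cong +_ (List.length-++ (f (g 0))))
  (cong₂ ℤ._+_ (p 0) (length-concatMap-applyUpTo f (g ∘ suc) N (h ∘ suc) (p ∘ suc)))

module _ (ℓ k : ℕ) (ℓ∤ : ¬ ℓ ∣ suc k) where

  private
    G G′ : Series
    G  = finiteProduct ℓ k
    G′ = finiteProduct ℓ (suc k)

    term : ℕ → ℕ → ℤ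
    term m n = + 2 ℤ.* (δ (m ℕ.* suc k) ⊗ G) n

    expansion : ∀ n {N} → n ℕ.≤ N → G′ n ≡ G n ℤ.+ ∑ N (λ m → term m n)
    expansion n n≤N = begin
      G′ n
        ≡⟨ cong (+_ ∘ length) (proj₂ (choices ℓ k n ℓ∤)) ⟩
      + length (choose ℓ k n ℓ∤ 0 ++ concatMap (choose ℓ k n ℓ∤) (applyUpTo suc n))
        ≡⟨ cong +_ (List.length-++ (choose ℓ k n ℓ∤ 0)) ⟩
      + length (choose ℓ k n ℓ∤ 0) ℤ.+ + length (concatMap (choose ℓ k n ℓ∤) (applyUpTo suc n))
        ≡⟨ cong₂ ℤ._+_ (cong +_ (length-choose-zero ℓ k n ℓ∤))
             (length-concatMap-applyUpTo _ suc n (λ m → term m n) (length-choose-suc ℓ k n ℓ∤)) ⟩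
      G n ℤ.+ ∑ n (λ m → term m n)
        ≡⟨ cong (λ z → G n ℤ.+ z) (∑-extend (λ m → term m n) n≤N λ m n≤m →
             cong (λ z → + 2 ℤ.* z) (δ-⊗-< G (ℕ.<-≤-trans (s≤s n≤m) (ℕ.m≤m*n (suc m) (suc k))))) ⟨
      _ ∎
      where open ≡-Reasoning

  -- Division-free form of G′ = G (1 + t)/(1 - t) with t = q^(k+1). Shifting G′ = G + 2tG + 2t²G +
  -- ... by one copy of the part turns its tail into t(2G + 2tG + ...), and one of the two leading G
  -- completes G′ while the other stays.
  finiteProduct-suc : G′ ≐ G ⊕ δ (suc k) ⊗ (G ⊕ G′)
  finiteProduct-suc n with below-or-beyond (suc k) n
  ... | inj₁ n<j = trans (expansion n ℕ.≤-refl) (cong (λ z → G n ℤ.+ z) (trans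
    (∑-zero n λ m → cong (λ z → + 2 ℤ.* z) (δ-⊗-< G (ℕ.<-≤-trans n<j (ℕ.m≤m+n (suc k) _))))
    (sym (δ-⊗-< (G ⊕ G′) n<j))))
  ... | inj₂ (i , refl) = begin
    G′ (suc k ℕ.+ i)
      ≡⟨ expansion (suc k ℕ.+ i) ℕ.≤-refl ⟩
    G (suc k ℕ.+ i) ℤ.+ (term 1 (suc k ℕ.+ i) ℤ.+ ∑ (k ℕ.+ i) (λ m → term (suc m) (suc k ℕ.+ i)))
      ≡⟨ cong₂ (λ x y → G (suc k ℕ.+ i) ℤ.+ (+ 2 ℤ.* x ℤ.+ y))
           (trans (δ-⊗-+-+ (suc k) 0 G i) (δ-⊗-zero G i))
           (∑-cong (k ℕ.+ i) λ m → cong (λ z → + 2 ℤ.* z) (δ-⊗-+-+ (suc k) (suc m ℕ.* suc k) G i)) ⟩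
    G (suc k ℕ.+ i) ℤ.+ (+ 2 ℤ.* G i ℤ.+ S)
      ≡⟨ cong (λ z → G (suc k ℕ.+ i) ℤ.+ z)
          (trans (lemma (G i) S) (cong (λ z → G i ℤ.+ z) (sym (expansion i (ℕ.m≤n+m i k))))) ⟩
    G (suc k ℕ.+ i) ℤ.+ (G i ℤ.+ G′ i)
      ≡⟨ cong (λ z → G (suc k ℕ.+ i) ℤ.+ z) (δ-⊗-+ (suc k) (G ⊕ G′) i) ⟨
    _ ∎
    where
    open ≡-Reasoning
    S : ℤ
    S = ∑ (k ℕ.+ i) (λ m → term m i)
    lemma : ∀ g s → + 2 ℤ.* g ℤ.+ s ≡ g ℤ.+ (g ℤ.+ s)
    lemma = solve-∀

finiteProduct-skip : ∀ ℓ k → ℓ ∣ suc k → finiteProduct ℓ (suc k) ≐ finiteProduct ℓ k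
finiteProduct-skip ℓ k ℓ∣ n with ℓ ∣? suc k
... | yes _  = refl
... | no ℓ∤  = contradiction ℓ∣ ℓ∤

finiteProduct-zero : ∀ ℓ → finiteProduct ℓ 0 ≐ const 1ℤ
finiteProduct-zero ℓ zero    = refl
finiteProduct-zero ℓ (suc n) = refl

finiteProduct-stable : ∀ ℓ n m → finiteProduct ℓ (m ℕ.+ n) n ≡ finiteProduct ℓ n n
finiteProduct-stable ℓ n zero    = refl
finiteProduct-stable ℓ n (suc m) = trans (step (ℓ ∣? suc (m ℕ.+ n))) (finiteProduct-stable ℓ n m)
  where
  step : Dec (ℓ ∣ suc (m ℕ.+ n)) → finiteProduct ℓ (suc m ℕ.+ n) n ≡ finiteProduct ℓ (m ℕ.+ n) n
  step (yes ℓ∣) = finiteProduct-skip ℓ (m ℕ.+ n) ℓ∣ n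
  step (no ℓ∤)  = trans (finiteProduct-suc ℓ (m ℕ.+ n) ℓ∤ n)
    (trans (cong (λ z → finiteProduct ℓ (m ℕ.+ n) n ℤ.+ z) (δ-⊗-< _ (s≤s (ℕ.m≤n+m n m))))
        (ℤ.+-identityʳ _))

overpartitions : ℕ → Series
overpartitions ℓ n = + Abar ℓ n

finiteProduct≡overpartitions : ∀ ℓ {n k} → n ℕ.≤ k → finiteProduct ℓ k n ≡ overpartitions ℓ n
finiteProduct≡overpartitions ℓ {n} {k} n≤k =
  subst (λ k → finiteProduct ℓ k n
      ≡ overpartitions ℓ n) (ℕ.m∸n+n≡m n≤k) (finiteProduct-stable ℓ n (k ℕ.∸ n))

-- The quotient of two overpartition generating functions

⊗-congˡ : ∀ f {g h} → g ≐ h → f ⊗ g ≐ f ⊗ h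
⊗-congˡ f = ⊗-cong {f = f} (λ _ → refl)

⊗-congʳ : ∀ h {f g} → f ≐ g → f ⊗ h ≐ g ⊗ h
⊗-congʳ h f≐g = ⊗-cong {g = h} f≐g (λ _ → refl)

⊕-cong : ∀ {f f′ g g′} → f ≐ f′ → g ≐ g′ → f ⊕ g ≐ f′ ⊕ g′
⊕-cong p q n = cong₂ ℤ._+_ (p n) (q n)

-- X and Y acquire the same factor (1 + q^(k+1))/(1 - q^(k+1)), so the relation XZ = Y persists:
-- `X′ ⊗ Z` and `Y′` solve the same fixed-point equation.
product-step : ∀ k {X X′ Y Y′ Z} → X ⊗ Z ≐ Y → X′ ≐ X ⊕ δ (suc k) ⊗ (X ⊕ X′) →
  Y′ ≐ Y ⊕ δ (suc k) ⊗ (Y ⊕ Y′) → X′ ⊗ Z ≐ Y′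
product-step k {X} {X′} {Y} {Y′} {Z} XZ≐Y x y = δ-unique k (Y ⊕ δ (suc k) ⊗ Y)
  (begin
    X′ ⊗ Z                                                ≈⟨ ⊗-congʳ Z x ⟩
    (X ⊕ δ (suc k) ⊗ (X ⊕ X′)) ⊗ Z
        ≈⟨ solve 4 (λ X X′ Z t → (X :+ t :* (X :+ X′)) :* Z := X :* Z :+ t :* (X :* Z) :+ t
        :* (X′ :* Z)) (λ _ → refl) X X′ Z (δ (suc k)) ⟩
    X ⊗ Z ⊕ δ (suc k) ⊗ (X ⊗ Z) ⊕ δ (suc k) ⊗ (X′ ⊗ Z)
        ≈⟨ ⊕-cong (⊕-cong XZ≐Y (⊗-congˡ (δ (suc k)) XZ≐Y)) (λ _ → refl) ⟩
    Y ⊕ δ (suc k) ⊗ Y ⊕ δ (suc k) ⊗ (X′ ⊗ Z)              ∎)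
  (begin
    Y′                                                    ≈⟨ y ⟩
    Y ⊕ δ (suc k) ⊗ (Y ⊕ Y′)
        ≈⟨ solve 3 (λ Y Y′ t → Y :+ t :* (Y :+ Y′) := Y :+ t :* Y :+ t :* Y′) (λ _ → refl) Y Y′
        (δ (suc k)) ⟩
    Y ⊕ δ (suc k) ⊗ Y ⊕ δ (suc k) ⊗ Y′                    ∎)
  where
  open Exact
  open SetoidReasoning Exact.setoid

dilate-finiteProduct-suc : ∀ k → dilate (dilate (finiteProduct 0 (suc k))) ≐
  dilate (dilate (finiteProduct 0 k)) ⊕ δ (suc k ℕ.* 5 ℕ.* 5)
      ⊗ (dilate (dilate (finiteProduct 0 k)) ⊕ dilate (dilate (finiteProduct 0 (suc k))))
dilate-finiteProduct-suc k = begin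
  dilate (dilate G′)
    ≈⟨ dilate-cong (dilate-cong (finiteProduct-suc 0 k (λ 0∣ → ℕ.1+n≢0 (0∣⇒≡0 0∣)))) ⟩
  dilate (dilate (G ⊕ δ (suc k) ⊗ (G ⊕ G′)))
    ≈⟨ dilate-cong (λ n → trans (dilate-⊕ G (δ (suc k) ⊗ (G ⊕ G′)) n)
         (cong (λ z → dilate G n ℤ.+ z)
             (trans (dilate-δ (suc k) (G ⊕ G′) n) (⊗-congˡ (δ (suc k ℕ.* 5)) (dilate-⊕ G G′) n)))) ⟩
  dilate (dilate G ⊕ δ (suc k ℕ.* 5) ⊗ (dilate G ⊕ dilate G′))
    ≈⟨ (λ n → trans (dilate-⊕ (dilate G) (δ (suc k ℕ.* 5) ⊗ (dilate G ⊕ dilate G′)) n)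
         (cong (λ z → dilate (dilate G) n ℤ.+ z)
             (trans (dilate-δ (suc k ℕ.* 5) (dilate G ⊕ dilate G′) n)
           (⊗-congˡ (δ (suc k ℕ.* 5 ℕ.* 5)) (dilate-⊕ (dilate G) (dilate G′)) n)))) ⟩
  dilate (dilate G) ⊕ δ (suc k ℕ.* 5 ℕ.* 5) ⊗ (dilate (dilate G) ⊕ dilate (dilate G′)) ∎
  where
  open SetoidReasoning Exact.setoid
  G G′ : Series
  G  = finiteProduct 0 k
  G′ = finiteProduct 0 (suc k)

finiteProduct-ratio : ∀ m r → r ℕ.≤ 24 →
  finiteProduct 25 (r ℕ.+ m ℕ.* 5 ℕ.* 5) ⊗ dilate (dilate (finiteProduct 0 m)) ≐ finiteProduct 0
      (r ℕ.+ m ℕ.* 5 ℕ.* 5)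
finiteProduct-ratio zero zero _ n = trans (⊗-cong (finiteProduct-zero 25) dilated n)
    (trans (const-⊗-const 1ℤ 1ℤ n) (sym (finiteProduct-zero 0 n)))
  where
  dilated : dilate (dilate (finiteProduct 0 0)) ≐ const 1ℤ
  dilated n = trans (dilate-cong (dilate-cong (finiteProduct-zero 0)) n)
      (trans (dilate-cong dilate-one n) (dilate-one n))
-- At the next multiple of 25 the product for 25 is unchanged, and the twice dilated product gains
-- the factor instead. Hence the two factors on the left are commuted before `product-step` is
-- applied.
finiteProduct-ratio (suc m) zero _ = λ n → trans
    (⊗-congʳ _ (finiteProduct-skip 25 (24 ℕ.+ m ℕ.* 5 ℕ.* 5) 25∣) n)
  (trans (⊗-comm (finiteProduct 25 (24 ℕ.+ m ℕ.* 5 ℕ.* 5)) _ n)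
    (product-step (24 ℕ.+ m ℕ.* 5 ℕ.* 5)
      (λ n → trans (⊗-comm (dilate (dilate (finiteProduct 0 m))) _ n)
          (finiteProduct-ratio m 24 ℕ.≤-refl n))
      (dilate-finiteProduct-suc m)
      (finiteProduct-suc 0 (24 ℕ.+ m ℕ.* 5 ℕ.* 5) (λ 0∣ → ℕ.1+n≢0 (0∣⇒≡0 0∣))) n))
  where
  25∣ : 25 ∣ suc m ℕ.* 5 ℕ.* 5
  25∣ = divides (suc m) (ℕ.*-assoc (suc m) 5 5)
finiteProduct-ratio m (suc r) r<24 = product-step (r ℕ.+ m ℕ.* 5 ℕ.* 5)
    (finiteProduct-ratio m r (ℕ.<⇒≤ r<24))
  (finiteProduct-suc 25 (r ℕ.+ m ℕ.* 5 ℕ.* 5) 25∤)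
  (finiteProduct-suc 0 (r ℕ.+ m ℕ.* 5 ℕ.* 5) (λ 0∣ → ℕ.1+n≢0 (0∣⇒≡0 0∣)))
  where
  25∤ : ¬ 25 ∣ suc (r ℕ.+ m ℕ.* 5 ℕ.* 5)
  25∤ 25∣ = ℕ.<⇒≱ (s≤s r<24)
      (∣⇒≤ (∣m+n∣m⇒∣n (subst (25 ∣_) (ℕ.+-comm (suc r) (m ℕ.* 5 ℕ.* 5)) 25∣)
      (divides m (ℕ.*-assoc m 5 5))))

overpartitions-ratio : overpartitions 25 ⊗ dilate (dilate (overpartitions 0)) ≐ overpartitions 0
overpartitions-ratio n = begin
  (overpartitions 25 ⊗ dilate (dilate (overpartitions 0))) n
    ≡⟨ ⊗-cong-upto n (λ i i≤n → sym (finiteProduct≡overpartitions 25 (ℕ.≤-trans i≤n n≤)))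
         (λ i i≤n → dilate-cong-upto i λ j j≤i → dilate-cong-upto j λ l l≤j →
           sym (finiteProduct≡overpartitions 0 (ℕ.≤-trans l≤j (ℕ.≤-trans j≤i i≤n)))) ⟩
  (finiteProduct 25 (n ℕ.* 5 ℕ.* 5) ⊗ dilate (dilate (finiteProduct 0 n))) n
    ≡⟨ finiteProduct-ratio n 0 z≤n n ⟩
  finiteProduct 0 (n ℕ.* 5 ℕ.* 5) n
    ≡⟨ finiteProduct≡overpartitions 0 n≤ ⟩
  overpartitions 0 n ∎
  where
  open ≡-Reasoning
  n≤ : n ℕ.≤ n ℕ.* 5 ℕ.* 5
  n≤ = ℕ.≤-trans (ℕ.m≤m*n n 5) (ℕ.m≤m*n (n ℕ.* 5) 5)

-- Logarithmic derivatives and the fourth power of φ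

D-⊗ : ∀ f g → D (f ⊗ g) ≐ D f ⊗ g ⊕ f ⊗ D g
D-⊗ f g zero    = lemma (f 0) (g 0)
  where
  lemma : ∀ a b → 0ℤ ≡ 0ℤ ℤ.* b ℤ.+ a ℤ.* 0ℤ
  lemma = solve-∀
D-⊗ f g (suc n) = begin
  + suc n ℤ.* (f 0 ℤ.* g (suc n) ℤ.+ (tail f ⊗ g) n)
    ≡⟨ lemma₁ (+ n) (f 0) (g (suc n)) ((tail f ⊗ g) n) ⟩
  f 0 ℤ.* D g (suc n) ℤ.+ ((tail f ⊗ g) n ℤ.+ D (tail f ⊗ g) n)
    ≡⟨ cong (λ z → f 0 ℤ.* D g (suc n) ℤ.+ ((tail f ⊗ g) n ℤ.+ z)) (D-⊗ (tail f) g n) ⟩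
  f 0 ℤ.* D g (suc n) ℤ.+ ((tail f ⊗ g) n ℤ.+ ((D (tail f) ⊗ g) n ℤ.+ (tail f ⊗ D g) n))
    ≡⟨ lemma₂ (f 0 ℤ.* D g (suc n)) ((tail f ⊗ g) n) ((D (tail f) ⊗ g) n) ((tail f ⊗ D g) n) ⟩
  ((tail f ⊗ g) n ℤ.+ (D (tail f) ⊗ g) n) ℤ.+ (f ⊗ D g) (suc n)
    ≡⟨ cong (λ z → z ℤ.+ (f ⊗ D g) (suc n))
        (trans (sym (⊗-distribʳ g (tail f) (D (tail f)) n))
        (⊗-congʳ g (λ k → lemma₃ (+ k) (f (suc k))) n)) ⟩
  (tail (D f) ⊗ g) n ℤ.+ (f ⊗ D g) (suc n)
    ≡⟨ cong (λ z → z ℤ.+ (f ⊗ D g) (suc n)) (ℤ.+-identityˡ ((tail (D f) ⊗ g) n)) ⟨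
  _ ∎
  where
  open ≡-Reasoning
  lemma₁ : ∀ n a b u → (1ℤ ℤ.+ n) ℤ.* (a ℤ.* b ℤ.+ u) ≡ a ℤ.* ((1ℤ ℤ.+ n) ℤ.* b) ℤ.+ (u ℤ.+ n ℤ.* u)
  lemma₁ = solve-∀
  lemma₂ : ∀ a u v w → a ℤ.+ (u ℤ.+ (v ℤ.+ w)) ≡ (u ℤ.+ v) ℤ.+ (a ℤ.+ w)
  lemma₂ = solve-∀
  lemma₃ : ∀ k a → a ℤ.+ k ℤ.* a ≡ (1ℤ ℤ.+ k) ℤ.* a
  lemma₃ = solve-∀

D-cong : ∀ {f g} → f ≐ g → D f ≐ D g
D-cong p n = cong (λ z → + n ℤ.* z) (p n)

D-⊕ : ∀ f g → D (f ⊕ g) ≐ D f ⊕ D g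
D-⊕ f g n = ℤ.*-distribˡ-+ (+ n) (f n) (g n)

D-const : ∀ c n → D (const c) n ≡ 0ℤ
D-const c zero    = refl
D-const c (suc n) = ℤ.*-zeroʳ (+ suc n)

D-δ : ∀ j → D (δ j) ≐ const (+ j) ⊗ δ j
D-δ j n = trans (ℤ.*-comm (+ n) (δ j n))
    (trans (δ-transport j n) (trans (ℤ.*-comm (δ j n) (+ j)) (sym (const-⊗ (+ j) (δ j) n))))

-- The series 2j q^j/(1 - q^(2j)), which is q times the logarithmic derivative of (1 + q^j)/(1 -
-- q^j).
logFactor : ℕ → Series
logFactor j n = ∑ n λ e → δ (j ℕ.* e) n ℤ.* ((1ℤ ℤ.- σ e) ℤ.* + j)

module _ (k : ℕ) where
  private
    j = suc k
    term : ℕ → ℕ → ℤ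
    term n e = δ (j ℕ.* e) n ℤ.* ((1ℤ ℤ.- σ e) ℤ.* + j)

    extended : ∀ {n N} → n ℕ.≤ N → logFactor j n ≡ ∑ N (term n)
    extended {n} n≤N = sym (∑-extend (term n) n≤N λ e n≤e →
      0*-when _ (δ-> (ℕ.≤-trans (s≤s n≤e) (ℕ.m≤n*m (suc e) j))))

  -- The term e = 1 is split off, the term e = 2 vanishes, and raising e by 2 keeps the sign while
  -- multiplying by q^(2j).
  logFactor-fixpoint : logFactor j ≐ const (+ 2) ⊗ (const (+ j) ⊗ δ j) ⊕ δ j ⊗ δ j ⊗ logFactor j
  logFactor-fixpoint n = begin
    logFactor j n
      ≡⟨ extended (ℕ.m≤n+m n 2) ⟩
    term n 1 ℤ.+ (term n 2 ℤ.+ ∑ n (λ e → term n (2 ℕ.+ e)))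
      ≡⟨ cong₂ ℤ._+_ first
          (trans (cong (λ z → z ℤ.+ ∑ n (λ e → term n (2 ℕ.+ e))) (ℤ.*-zeroʳ (δ (j ℕ.* 2) n)))
          (ℤ.+-identityˡ _)) ⟩
    (const (+ 2) ⊗ (const (+ j) ⊗ δ j)) n ℤ.+ ∑ n (λ e → term n (2 ℕ.+ e))
      ≡⟨ cong (λ z → (const (+ 2) ⊗ (const (+ j) ⊗ δ j)) n ℤ.+ z)
          (trans (rest n) (sym (⊗-congʳ (logFactor j) (δ-⊗-δ j j) n))) ⟩
    _ ∎
    where
    open ≡-Reasoning
    first : term n 1 ≡ (const (+ 2) ⊗ (const (+ j) ⊗ δ j)) n
    first rewrite ℕ.*-identityʳ k = trans (ℤ.*-comm (δ j n) _) (trans (ℤ.*-assoc (+ 2) (+ j) (δ j n))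
      (sym (trans (const-⊗ (+ 2) (const (+ j) ⊗ δ j) n)
          (cong (λ z → + 2 ℤ.* z) (const-⊗ (+ j) (δ j) n)))))
    distr : ∀ e → j ℕ.* (2 ℕ.+ e) ≡ j ℕ.+ j ℕ.+ j ℕ.* e
    distr e = lemma j e
      where
      lemma : ∀ j e → j ℕ.* (2 ℕ.+ e) ≡ j ℕ.+ j ℕ.+ j ℕ.* e
      lemma = ℕ-Solver.solve-∀
    δ-+ : ∀ j i n → δ (j ℕ.+ i) (j ℕ.+ n) ≡ δ i n
    δ-+ zero i n = refl
    δ-+ (suc j) i n = δ-+ j i n
    rest : ∀ n → ∑ n (λ e → term n (2 ℕ.+ e)) ≡ (δ (j ℕ.+ j) ⊗ logFactor j) n
    rest n with below-or-beyond (j ℕ.+ j) n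
    ... | inj₁ n<2j = trans
        (∑-zero n λ e → 0*-when _
        (δ-> (subst (n ℕ.<_) (sym (distr (suc e))) (ℕ.<-≤-trans n<2j (ℕ.m≤m+n (j ℕ.+ j) _)))))
      (sym (δ-⊗-< (logFactor j) n<2j))
    ... | inj₂ (i , refl) = trans
        (∑-cong (j ℕ.+ j ℕ.+ i) {term (j ℕ.+ j ℕ.+ i) ∘ (2 ℕ.+_)} {term i} λ e →
        cong₂ (λ x y → x ℤ.* ((1ℤ ℤ.- y) ℤ.* + j))
            (trans (cong (λ z → δ z (j ℕ.+ j ℕ.+ i)) (distr (suc e))) (δ-+ (j ℕ.+ j) (j ℕ.* suc e) i))
            (ℤ.neg-involutive (σ (suc e))))
      (trans (sym (extended (ℕ.m≤n+m i (j ℕ.+ j)))) (sym (δ-⊗-+ (j ℕ.+ j) (logFactor j) i)))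

⊗-zero : ∀ f {g} n → (∀ i → g i ≡ 0ℤ) → (f ⊗ g) n ≡ 0ℤ
⊗-zero f {g} n p = trans (⊗-comm f g n) (zero-⊗ f n p)

difference-zero : ∀ {f g} → f ≐ g → ∀ n → (f ⊕ ⊖ g) n ≡ 0ℤ
difference-zero {f} {g} p n = ℤ.i≡j⇒i-j≡0 (p n)

-- Multiplying the claimed equation by 1 − t² makes it a combination of the given ones.
logDerivative-step : ∀ k {X X′ L} → X′ ≐ X ⊕ δ (suc k) ⊗ (X ⊕ X′) → D X ≐ X ⊗ L →
  D X′ ≐ X′ ⊗ (L ⊕ logFactor (suc k))
logDerivative-step k {X} {X′} {L} x dX n = ℤ.i-j≡0⇒i≡j _ _ (δ-unique (k ℕ.+ suc k) (λ _ → 0ℤ)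
  (λ n → trans (combination n) (cong₂ ℤ._+_ (combination-zero n) (⊗-congʳ Δ (δ-⊗-δ (suc k) (suc k)) n)))
  (λ n → sym (trans (ℤ.+-identityˡ _) (⊗-zero (δ (suc k ℕ.+ suc k)) n λ _ → refl))) n)
  where
  t κ Λ Δ h₁ h₂ h₃ h₄ : Series
  t  = δ (suc k)
  κ  = const (+ suc k)
  Λ  = logFactor (suc k)
  Δ  = D X′ ⊕ ⊖ (X′ ⊗ (L ⊕ Λ))
  h₁ = X′ ⊕ ⊖ (X ⊕ t ⊗ (X ⊕ X′))
  h₂ = D X′ ⊕ ⊖ (D X ⊕ (κ ⊗ t ⊗ (X ⊕ X′) ⊕ t ⊗ (D X ⊕ D X′)))
  h₃ = D X ⊕ ⊖ (X ⊗ L)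
  h₄ = Λ ⊕ ⊖ (const (+ 2) ⊗ (κ ⊗ t) ⊕ t ⊗ t ⊗ Λ)
  dX′ : D X′ ≐ D X ⊕ (κ ⊗ t ⊗ (X ⊕ X′) ⊕ t ⊗ (D X ⊕ D X′))
  dX′ n = begin
    D X′ n                                      ≡⟨ D-cong x n ⟩
    D (X ⊕ t ⊗ (X ⊕ X′)) n                      ≡⟨ D-⊕ X (t ⊗ (X ⊕ X′)) n ⟩
    D X n ℤ.+ D (t ⊗ (X ⊕ X′)) n                ≡⟨ cong (λ z → D X n ℤ.+ z) (D-⊗ t (X ⊕ X′) n) ⟩
    D X n ℤ.+ ((D t ⊗ (X ⊕ X′)) n ℤ.+ (t ⊗ D (X ⊕ X′)) n)
      ≡⟨ cong₂ (λ y z → D X n ℤ.+ (y ℤ.+ z)) (⊗-congʳ (X ⊕ X′) (D-δ (suc k)) n)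
          (⊗-congˡ t (D-⊕ X X′) n) ⟩
    _ ∎
    where open ≡-Reasoning
  -- The coefficients record the hand computation. Take 1 + t times the derivative of (1 - t)X′ = (1
  -- + t)X. Replace D X by XL, then use (1 + t)X = (1 - t)X′ again, which also gives (1 + t)(X + X′)
  -- = 2X′. Last, recognise 2κt as (1 - t²)Λ.
  combination : Δ ≐ ((⊖ ((const 1ℤ ⊕ t) ⊗ L ⊕ κ ⊗ t)) ⊗ h₁ ⊕ (const 1ℤ ⊕ t) ⊗ h₂
    ⊕ (const 1ℤ ⊕ t) ⊗ (const 1ℤ ⊕ t) ⊗ h₃ ⊕ (⊖ X′) ⊗ h₄) ⊕ t ⊗ t ⊗ Δ
  combination = solve 8 (λ X X′ dX dX′ L Λ t κ →
    let Δ  = dX′ :+ :- (X′ :* (L :+ Λ))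
        h₁ = X′ :+ :- (X :+ t :* (X :+ X′))
        h₂ = dX′ :+ :- (dX :+ (κ :* t :* (X :+ X′) :+ t :* (dX :+ dX′)))
        h₃ = dX :+ :- (X :* L)
        h₄ = Λ :+ :- (con (+ 2) :* (κ :* t) :+ t :* t :* Λ)
    in Δ := ((:- ((con 1ℤ :+ t) :* L :+ κ :* t)) :* h₁ :+ (con 1ℤ :+ t) :* h₂
         :+ (con 1ℤ :+ t) :* (con 1ℤ :+ t) :* h₃ :+ (:- X′) :* h₄) :+ t :* t :* Δ) (λ _ → refl)
    X X′ (D X) (D X′) L Λ t κ
    where open Exact
  combination-zero : ∀ n → ((⊖ ((const 1ℤ ⊕ t) ⊗ L ⊕ κ ⊗ t)) ⊗ h₁ ⊕ (const 1ℤ ⊕ t) ⊗ h₂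
    ⊕ (const 1ℤ ⊕ t) ⊗ (const 1ℤ ⊕ t) ⊗ h₃ ⊕ (⊖ X′) ⊗ h₄) n ≡ 0ℤ
  combination-zero n = cong₂ ℤ._+_ (cong₂ ℤ._+_ (cong₂ ℤ._+_
    (⊗-zero (⊖ ((const 1ℤ ⊕ t) ⊗ L ⊕ κ ⊗ t)) n (difference-zero x))
    (⊗-zero (const 1ℤ ⊕ t) n (difference-zero dX′)))
    (⊗-zero ((const 1ℤ ⊕ t) ⊗ (const 1ℤ ⊕ t)) n (difference-zero dX)))
    (⊗-zero (⊖ X′) n (difference-zero (logFactor-fixpoint k)))

logDerivative : ℕ → Series
logDerivative k n = ∑ k λ j → logFactor j n

D-finiteProduct : ∀ k → D (finiteProduct 0 k) ≐ finiteProduct 0 k ⊗ logDerivative k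
D-finiteProduct zero n = trans (D-cong (finiteProduct-zero 0) n)
    (trans (D-const 1ℤ n) (sym (⊗-zero (finiteProduct 0 0) n λ _ → refl)))
D-finiteProduct (suc k) n =
  trans (logDerivative-step k (finiteProduct-suc 0 k (λ 0∣ → ℕ.1+n≢0 (0∣⇒≡0 0∣))) (D-finiteProduct k) n)
    (⊗-congˡ (finiteProduct 0 (suc k)) (λ i → sym (∑-last k λ j → logFactor j i)) n)

D-overpartitions : D (overpartitions 0) ≐ overpartitions 0 ⊗ oddSum
D-overpartitions n = begin
  + n ℤ.* overpartitions 0 n                    ≡⟨⟩
  D (finiteProduct 0 n) n                       ≡⟨ D-finiteProduct n n ⟩
  (finiteProduct 0 n ⊗ logDerivative n) n
      ≡⟨ ⊗-cong-upto n (λ i → finiteProduct≡overpartitions 0) (λ i i≤n → restrict i≤n) ⟩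
  (overpartitions 0 ⊗ oddSum) n                 ∎
  where
  open ≡-Reasoning
  restrict : ∀ {i n} → i ℕ.≤ n → logDerivative n i ≡ oddSum i
  restrict {i} i≤n = ∑-extend (λ j → logFactor j i) i≤n λ j i≤j → ∑-zero i λ e →
    0*-when _ (δ-> (ℕ.<-≤-trans (s≤s i≤j) (ℕ.m≤m*n (suc j) (suc e))))

-- φ⁴ for φ = (q;q)²/(q²;q²).
F : Series
F = const 1ℤ ⊕ const (+ 8) ⊗ signedSum

D-F : D F ≐ const (ℤ.- + 4) ⊗ (oddSum ⊗ F)
D-F n = begin
  D F n
    ≡⟨ D-⊕ (const 1ℤ) (const (+ 8) ⊗ signedSum) n ⟩
  D (const 1ℤ) n ℤ.+ D (const (+ 8) ⊗ signedSum) n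
    ≡⟨ cong₂ ℤ._+_ (D-const 1ℤ n) (cong (λ z → + n ℤ.* z) (const-⊗ (+ 8) signedSum n)) ⟩
  0ℤ ℤ.+ + n ℤ.* (+ 8 ℤ.* signedSum n)
    ≡⟨ lemma (+ n) (signedSum n) (oddSum n) ((signedSum ⊗ oddSum) n) ⟩
  + 4 ℤ.* (+ 2 ℤ.* (+ n ℤ.* signedSum n) ℤ.+ oddSum n ℤ.+ + 8 ℤ.* (signedSum ⊗ oddSum) n)
    ℤ.+ (ℤ.- + 4) ℤ.* (oddSum n ℤ.+ + 8 ℤ.* (signedSum ⊗ oddSum) n)
    ≡⟨ cong (λ z → + 4 ℤ.* z ℤ.+ (ℤ.- + 4) ℤ.* (oddSum n ℤ.+ + 8 ℤ.* (signedSum ⊗ oddSum) n))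
        (DerivativeIdentity.identity n) ⟩
  0ℤ ℤ.+ (ℤ.- + 4) ℤ.* (oddSum n ℤ.+ + 8 ℤ.* (signedSum ⊗ oddSum) n)
    ≡⟨ ℤ.+-identityˡ _ ⟩
  (ℤ.- + 4) ℤ.* (oddSum n ℤ.+ + 8 ℤ.* (signedSum ⊗ oddSum) n)
    ≡⟨ cong (λ z → (ℤ.- + 4) ℤ.* (oddSum n ℤ.+ z)) (const-⊗ (+ 8) (signedSum ⊗ oddSum) n) ⟨
  (ℤ.- + 4) ℤ.* (oddSum ⊕ const (+ 8) ⊗ (signedSum ⊗ oddSum)) n
    ≡⟨ const-⊗ (ℤ.- + 4) _ n ⟨
  (const (ℤ.- + 4) ⊗ (oddSum ⊕ const (+ 8) ⊗ (signedSum ⊗ oddSum))) n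
    ≡⟨ solve 2 (λ B S → con (ℤ.- + 4) :* (S :+ con (+ 8) :* (B :* S)) := con (ℤ.- + 4)
        :* (S :* (con 1ℤ :+ con (+ 8) :* B))) (λ _ → refl) signedSum oddSum n ⟩
  _ ∎
  where
  open ≡-Reasoning
  open Exact using (solve; con; _:*_; _:+_; _:=_)
  lemma : ∀ n b s c → 0ℤ ℤ.+ n ℤ.* (+ 8 ℤ.* b)
      ≡ + 4 ℤ.* (+ 2 ℤ.* (n ℤ.* b) ℤ.+ s ℤ.+ + 8 ℤ.* c) ℤ.+ (ℤ.- + 4) ℤ.* (s ℤ.+ + 8 ℤ.* c)
  lemma = solve-∀

fourth : Series → Series
fourth f = f ⊗ f ⊗ (f ⊗ f)

-- The logarithmic derivatives of the two factors are -4 `oddSum` and 4 `oddSum`, so the product has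
-- derivative zero. A coefficient at a positive index n is then annihilated by n, hence zero over
-- the integers, and the constant term is 1 by computation.
F-inverse : F ⊗ fourth (overpartitions 0) ≐ const 1ℤ
F-inverse zero    = refl
F-inverse (suc n) = ℤ.*-cancelˡ-≡ (+ suc n) _ _ (trans derivative-zero (sym (ℤ.*-zeroʳ (+ suc n))))
  where
  open SetoidReasoning Exact.setoid
  open Exact using (solve; con; _:*_; _:+_; _:=_)
  P : Series
  P = overpartitions 0
  derivative : D (F ⊗ (P ⊗ P ⊗ (P ⊗ P))) ≐ const 0ℤ
  derivative = begin
    D (F ⊗ (P ⊗ P ⊗ (P ⊗ P)))
      ≈⟨ D-⊗ F (P ⊗ P ⊗ (P ⊗ P)) ⟩
    D F ⊗ (P ⊗ P ⊗ (P ⊗ P)) ⊕ F ⊗ D (P ⊗ P ⊗ (P ⊗ P))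
      ≈⟨ ⊕-cong (⊗-congʳ (P ⊗ P ⊗ (P ⊗ P)) D-F) (⊗-congˡ F λ n → trans (D-⊗ (P ⊗ P) (P ⊗ P) n)
           (⊕-cong (⊗-congʳ (P ⊗ P) square-rule) (⊗-congˡ (P ⊗ P) square-rule) n)) ⟩
    const (ℤ.- + 4) ⊗ (oddSum ⊗ F) ⊗ (P ⊗ P ⊗ (P ⊗ P)) ⊕ F
        ⊗ ((P ⊗ oddSum ⊗ P ⊕ P ⊗ (P ⊗ oddSum)) ⊗ (P ⊗ P) ⊕ P ⊗ P ⊗ (P ⊗ oddSum ⊗ P ⊕ P ⊗ (P ⊗ oddSum)))
      ≈⟨ solve 3 (λ F P S → con (ℤ.- + 4) :* (S :* F) :* (P :* P :* (P :* P)) :+ F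
          :* ((P :* S :* P :+ P :* (P :* S)) :* (P :* P) :+ P :* P :* (P :* S :* P :+ P :* (P :* S)))
          := con 0ℤ)
           (λ _ → refl) F P oddSum ⟩
    const 0ℤ ∎
    where
    square-rule : D (P ⊗ P) ≐ P ⊗ oddSum ⊗ P ⊕ P ⊗ (P ⊗ oddSum)
    square-rule n = trans (D-⊗ P P n)
        (⊕-cong (⊗-congʳ P D-overpartitions) (⊗-congˡ P D-overpartitions) n)
  derivative-zero : + suc n ℤ.* (F ⊗ fourth P) (suc n) ≡ 0ℤ
  derivative-zero = derivative (suc n)

F-square : F ⊗ F ≐ const 1ℤ ⊕ const (+ 16) ⊗ cubeSum
F-square = begin
  F ⊗ F
    ≈⟨ solve 1 (λ B → (con 1ℤ :+ con (+ 8) :* B) :* (con 1ℤ :+ con (+ 8) :* B) := con 1ℤ :+ con (+ 16)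
        :* (B :+ con (+ 4) :* (B :* B))) (λ _ → refl) signedSum ⟩
  const 1ℤ ⊕ const (+ 16) ⊗ (signedSum ⊕ const (+ 4) ⊗ (signedSum ⊗ signedSum))
    ≈⟨ ⊕-cong {f = const 1ℤ} (λ _ → refl) (⊗-congˡ (const (+ 16)) signedSum-square) ⟩
  const 1ℤ ⊕ const (+ 16) ⊗ cubeSum ∎
  where
  open SetoidReasoning Exact.setoid
  open Exact using (solve; con; _:*_; _:+_; _:=_)

-- Reduction modulo 5

≡⇒≡₅ : ∀ {a b} → a ≡ b → a ≡₅ b
≡⇒≡₅ refl = ≡₅-refl

infix 4 _≐₅_
_≐₅_ : Series → Series → Set
f ≐₅ g = ∀ n → f n ≡₅ g n

open ⊗-Congruence _≡₅_ +-cong₅ *-cong₅ public using () renaming (⊗-cong to ⊗-cong₅)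

fifth : Series → Series
fifth f = f ⊗ f ⊗ f ⊗ f ⊗ f

fifth-cong : ∀ {f g} → f ≐₅ g → fifth f ≐₅ fifth g
fifth-cong p = ⊗-cong₅ (⊗-cong₅ (⊗-cong₅ (⊗-cong₅ p p) p) p) p

fermat : ∀ a → a ℤ.* a ℤ.* a ℤ.* a ℤ.* a ≡₅ a
fermat (+ n) = natural n
  where
  natural : ∀ n → + n ℤ.* + n ℤ.* + n ℤ.* + n ℤ.* + n ≡₅ + n
  natural zero    = ≡₅-refl
  natural (suc n) with natural n
  ... | mod₅ k eq = mod₅
      (k ℤ.+ x ℤ.* x ℤ.* x ℤ.* x ℤ.+ + 2 ℤ.* (x ℤ.* x ℤ.* x) ℤ.+ + 2 ℤ.* (x ℤ.* x) ℤ.+ x) (begin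
      (1ℤ ℤ.+ x) ℤ.* (1ℤ ℤ.+ x) ℤ.* (1ℤ ℤ.+ x) ℤ.* (1ℤ ℤ.+ x) ℤ.* (1ℤ ℤ.+ x)
        ≡⟨ expand x ⟩
      1ℤ ℤ.+ x ℤ.* x ℤ.* x ℤ.* x ℤ.* x ℤ.+ + 5
          ℤ.* (x ℤ.* x ℤ.* x ℤ.* x ℤ.+ + 2 ℤ.* (x ℤ.* x ℤ.* x) ℤ.+ + 2 ℤ.* (x ℤ.* x) ℤ.+ x)
        ≡⟨ cong (λ z → 1ℤ ℤ.+ z ℤ.+ + 5
            ℤ.* (x ℤ.* x ℤ.* x ℤ.* x ℤ.+ + 2 ℤ.* (x ℤ.* x ℤ.* x) ℤ.+ + 2 ℤ.* (x ℤ.* x) ℤ.+ x)) eq ⟩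
      1ℤ ℤ.+ (x ℤ.+ + 5 ℤ.* k) ℤ.+ + 5
          ℤ.* (x ℤ.* x ℤ.* x ℤ.* x ℤ.+ + 2 ℤ.* (x ℤ.* x ℤ.* x) ℤ.+ + 2 ℤ.* (x ℤ.* x) ℤ.+ x)
        ≡⟨ collect x k ⟩
      _ ∎)
    where
    open ≡-Reasoning
    x = + n
    expand : ∀ x → (1ℤ ℤ.+ x) ℤ.* (1ℤ ℤ.+ x) ℤ.* (1ℤ ℤ.+ x) ℤ.* (1ℤ ℤ.+ x) ℤ.* (1ℤ ℤ.+ x)
      ≡ 1ℤ ℤ.+ x ℤ.* x ℤ.* x ℤ.* x ℤ.* x ℤ.+ + 5
          ℤ.* (x ℤ.* x ℤ.* x ℤ.* x ℤ.+ + 2 ℤ.* (x ℤ.* x ℤ.* x) ℤ.+ + 2 ℤ.* (x ℤ.* x) ℤ.+ x)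
    expand = solve-∀
    collect : ∀ x k → 1ℤ ℤ.+ (x ℤ.+ + 5 ℤ.* k) ℤ.+ + 5
        ℤ.* (x ℤ.* x ℤ.* x ℤ.* x ℤ.+ + 2 ℤ.* (x ℤ.* x ℤ.* x) ℤ.+ + 2 ℤ.* (x ℤ.* x) ℤ.+ x)
      ≡ 1ℤ ℤ.+ x ℤ.+ + 5
          ℤ.* (k ℤ.+ x ℤ.* x ℤ.* x ℤ.* x ℤ.+ + 2 ℤ.* (x ℤ.* x ℤ.* x) ℤ.+ + 2 ℤ.* (x ℤ.* x) ℤ.+ x)
    collect = solve-∀
fermat (ℤ.-[1+ n ]) = ≡₅-trans (≡⇒≡₅ (odd (+ suc n))) (-‿cong₅ (fermat (+ suc n)))
  where
  odd : ∀ x → (ℤ.- x) ℤ.* (ℤ.- x) ℤ.* (ℤ.- x) ℤ.* (ℤ.- x) ℤ.* (ℤ.- x) ≡ ℤ.- (x ℤ.* x ℤ.* x ℤ.* x ℤ.* x)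
  odd = solve-∀

head+tail : ∀ f → f ≐ const (f 0) ⊕ δ 1 ⊗ tail f
head+tail f zero    = sym (ℤ.+-identityʳ (f 0))
head+tail f (suc n) = sym (trans (ℤ.+-identityˡ _) (δ-⊗-+ 1 (tail f) n))

fifth-const : ∀ c → fifth (const c) ≐ const (c ℤ.* c ℤ.* c ℤ.* c ℤ.* c)
fifth-const c = begin
  const c ⊗ const c ⊗ const c ⊗ const c ⊗ const c
    ≈⟨ ⊗-congʳ (const c) (⊗-congʳ (const c) (⊗-congʳ (const c) (const-⊗-const c c))) ⟩
  const (c ℤ.* c) ⊗ const c ⊗ const c ⊗ const c
    ≈⟨ ⊗-congʳ (const c) (⊗-congʳ (const c) (const-⊗-const (c ℤ.* c) c)) ⟩
  const (c ℤ.* c ℤ.* c) ⊗ const c ⊗ const c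
    ≈⟨ ⊗-congʳ (const c) (const-⊗-const (c ℤ.* c ℤ.* c) c) ⟩
  const (c ℤ.* c ℤ.* c ℤ.* c) ⊗ const c
    ≈⟨ const-⊗-const (c ℤ.* c ℤ.* c ℤ.* c) c ⟩
  const (c ℤ.* c ℤ.* c ℤ.* c ℤ.* c) ∎
  where open SetoidReasoning Exact.setoid

fifth-δ : fifth (δ 1) ≐ δ 5
fifth-δ = begin
  δ 1 ⊗ δ 1 ⊗ δ 1 ⊗ δ 1 ⊗ δ 1 ≈⟨ ⊗-congʳ (δ 1) (⊗-congʳ (δ 1) (⊗-congʳ (δ 1) (δ-⊗-δ 1 1))) ⟩
  δ 2 ⊗ δ 1 ⊗ δ 1 ⊗ δ 1       ≈⟨ ⊗-congʳ (δ 1) (⊗-congʳ (δ 1) (δ-⊗-δ 2 1)) ⟩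
  δ 3 ⊗ δ 1 ⊗ δ 1             ≈⟨ ⊗-congʳ (δ 1) (δ-⊗-δ 3 1) ⟩
  δ 4 ⊗ δ 1                   ≈⟨ δ-⊗-δ 4 1 ⟩
  δ 5                         ∎
  where open SetoidReasoning Exact.setoid

fifth-⊗ : ∀ f g → fifth (f ⊗ g) ≐ fifth f ⊗ fifth g
fifth-⊗ = solve 2 (λ f g → (f :* g) :* (f :* g) :* (f :* g) :* (f :* g) :* (f :* g) :=
  f :* f :* f :* f :* f :* (g :* g :* g :* g :* g)) (λ _ → refl)
  where open Exact using (solve; _:*_; _:=_)

fifth-⊕ : ∀ f g → fifth (f ⊕ g) ≐₅ fifth f ⊕ fifth g
fifth-⊕ = solve 2 (λ f g → (f :+ g) :* (f :+ g) :* (f :+ g) :* (f :+ g) :* (f :+ g) :=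
  f :* f :* f :* f :* f :+ g :* g :* g :* g :* g) (λ _ → ≡₅-refl)
  where open Mod₅ using (solve; _:*_; _:+_; _:=_)

-- Write f = c + q g with g = `tail f`. Modulo 5 the fifth power is additive and c⁵ is c, so f⁵ is c
-- + q⁵ g⁵, the recursion that defines `dilate`.
fifth-recursion : ∀ f → fifth f ≐₅ const (f 0) ⊕ δ 5 ⊗ fifth (tail f)
fifth-recursion f n = ≡₅-trans (fifth-cong (≡⇒≡₅ ∘ head+tail f) n)
    (≡₅-trans (fifth-⊕ (const (f 0)) (δ 1 ⊗ tail f) n)
  (+-cong₅ (≡₅-trans (≡⇒≡₅ (fifth-const (f 0) n)) (const-cong (fermat (f 0)) n))
    (≡⇒≡₅ (trans (fifth-⊗ (δ 1) (tail f) n) (⊗-congʳ (fifth (tail f)) fifth-δ n)))))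
  where
  const-cong : ∀ {a b} → a ≡₅ b → const a ≐₅ const b
  const-cong p zero    = p
  const-cong p (suc n) = ≡₅-refl

frobenius : ∀ f → fifth f ≐₅ dilate f
frobenius f n = ≡₅-trans (fifth-recursion f n) (cases n)
  where
  below : ∀ {n} → n ℕ.< 5 → const (f 0) n ℤ.+ (δ 5 ⊗ fifth (tail f)) n ≡ const (f 0) n
  below {n} n<5 = trans (cong (λ z → const (f 0) n ℤ.+ z) (δ-⊗-< (fifth (tail f)) n<5))
      (ℤ.+-identityʳ _)
  cases : ∀ n → const (f 0) n ℤ.+ (δ 5 ⊗ fifth (tail f)) n ≡₅ dilate f n
  cases 0 = ≡⇒≡₅ (below (s≤s z≤n))
  cases 1 = ≡₅-refl
  cases 2 = ≡₅-refl
  cases 3 = ≡₅-refl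
  cases 4 = ≡₅-refl
  cases (suc (suc (suc (suc (suc n))))) = ≡₅-trans
      (≡⇒≡₅ (trans (ℤ.+-identityˡ _) (δ-⊗-+ 5 (fifth (tail f)) n))) (frobenius (tail f) n)

-- Since E = F P⁴ is 1, its seventh power may be inserted; 7 is the least exponent providing 25
-- factors P. These become P(q²⁵) modulo 5, and A P(q²⁵) is P. With the remaining P³ this P forms
-- one more P⁴, which consumes one F and leaves F⁶ = F⁵ F.
overpartitions₂₅ : overpartitions 25 ≐₅ dilate F ⊗ F
overpartitions₂₅ = begin
  A
    ≈⟨ ≡⇒≡₅ ∘ solve 1
        (λ A → A := A :* (con 1ℤ :* con 1ℤ :* con 1ℤ :* con 1ℤ :* con 1ℤ :* con 1ℤ :* con 1ℤ))
        (λ _ → refl) A ⟩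
  A ⊗ (const 1ℤ ⊗ const 1ℤ ⊗ const 1ℤ ⊗ const 1ℤ ⊗ const 1ℤ ⊗ const 1ℤ ⊗ const 1ℤ)
    ≈⟨ ≡⇒≡₅ ∘ ⊗-congˡ A (⊗-cong (⊗-cong (⊗-cong (⊗-cong (⊗-cong (⊗-cong e e) e) e) e) e) e) ⟩
  A ⊗ (E ⊗ E ⊗ E ⊗ E ⊗ E ⊗ E ⊗ E)
    ≈⟨ ≡⇒≡₅ ∘ solve 3
        (λ A P F → let E = F :* (P :* P :* (P :* P)) in A :* (E :* E :* E :* E :* E :* E :* E) :=
         A :* (let Q = P :* P :* P :* P :* P in Q :* Q :* Q :* Q :* Q)
             :* (P :* P :* P :* (F :* (F :* (F :* F :* F :* F :* F))))) (λ _ → refl) A P F ⟩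
  A ⊗ fifth (fifth P) ⊗ R
    ≈⟨ ⊗-cong₅ (⊗-cong₅ {f = A} (λ _ → ≡₅-refl) λ n → ≡₅-trans (fifth-cong (frobenius P) n)
        (frobenius (dilate P) n)) (λ _ → ≡₅-refl) ⟩
  A ⊗ dilate (dilate P) ⊗ R
    ≈⟨ ≡⇒≡₅ ∘ ⊗-congʳ R overpartitions-ratio ⟩
  P ⊗ R
    ≈⟨ ≡⇒≡₅ ∘ solve 2
        (λ P F → P :* (P :* P :* P :* (F :* (F :* (F :* F :* F :* F :* F)))) := F
        :* (P :* P :* (P :* P)) :* (F :* F :* F :* F :* F :* F)) (λ _ → refl) P F ⟩
  E ⊗ (fifth F ⊗ F)
    ≈⟨ ≡⇒≡₅ ∘ ⊗-congʳ (fifth F ⊗ F) F-inverse ⟩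
  const 1ℤ ⊗ (fifth F ⊗ F)
    ≈⟨ ≡⇒≡₅ ∘ solve 1 (λ F → con 1ℤ :* (F :* F :* F :* F :* F :* F) := F :* F :* F :* F :* F :* F)
        (λ _ → refl) F ⟩
  fifth F ⊗ F
    ≈⟨ ⊗-cong₅ (frobenius F) (λ _ → ≡₅-refl) ⟩
  dilate F ⊗ F ∎
  where
  open SetoidReasoning Mod₅.setoid
  open Exact using (solve; con; _:*_; _:=_)
  A P E R : Series
  A = overpartitions 25
  P = overpartitions 0
  E = F ⊗ fourth P
  R = P ⊗ P ⊗ P ⊗ (F ⊗ (F ⊗ fifth F))
  e : const 1ℤ ≐ E
  e n = sym (F-inverse n)

-- Coefficients at multiples of a prime

dilate-⊗-multiple : ∀ f g n → (dilate f ⊗ g) (n ℕ.* 5) ≡ (f ⊗ λ k → g (k ℕ.* 5)) n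
dilate-⊗-multiple f g zero    = refl
dilate-⊗-multiple f g (suc n)
  -- Four zero coefficients of `dilate f` lie between consecutive multiples of 5.
  rewrite ℤ.+-identityˡ (0ℤ ℤ.+ (0ℤ ℤ.+ (0ℤ ℤ.+ (dilate (tail f) ⊗ g) (n ℕ.* 5))))
        | ℤ.+-identityˡ (0ℤ ℤ.+ (0ℤ ℤ.+ (dilate (tail f) ⊗ g) (n ℕ.* 5)))
        | ℤ.+-identityˡ (0ℤ ℤ.+ (dilate (tail f) ⊗ g) (n ℕ.* 5))
        | ℤ.+-identityˡ ((dilate (tail f) ⊗ g) (n ℕ.* 5))
        | dilate-⊗-multiple (tail f) g n = refl

∑-split : ∀ M N f → ∑ (M ℕ.+ N) f ≡ ∑ M f ℤ.+ ∑ N (λ i → f (M ℕ.+ i))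
∑-split zero    N f = sym (ℤ.+-identityˡ _)
∑-split (suc M) N f = trans (cong (λ z → f 1 ℤ.+ z) (∑-split M N (f ∘ suc)))
    (trans (sym (ℤ.+-assoc (f 1) _ _))
  (cong (λ z → f 1 ℤ.+ ∑ M (f ∘ suc) ℤ.+ z) refl))

∑-zero-upto : ∀ N {f} → (∀ i → i ℕ.< N → f (suc i) ≡ 0ℤ) → ∑ N f ≡ 0ℤ
∑-zero-upto zero    p = refl
∑-zero-upto (suc N) p = cong₂ ℤ._+_ (p 0 (s≤s z≤n)) (∑-zero-upto N λ i i<N → p (suc i) (s≤s i<N))

∑-multiples : ∀ p .{{_ : ℕ.NonZero p}} m f → (∀ i → ¬ p ∣ suc i → f (suc i) ≡ 0ℤ) →
  ∑ (m ℕ.* p) f ≡ ∑ m (λ d → f (d ℕ.* p))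
∑-multiples p          zero    f vanish = refl
∑-multiples p@(suc p′) (suc m) f vanish = begin
  ∑ (p ℕ.+ m ℕ.* p) f
    ≡⟨ ∑-split p (m ℕ.* p) f ⟩
  ∑ p f ℤ.+ ∑ (m ℕ.* p) (λ i → f (p ℕ.+ i))
    ≡⟨ cong₂ ℤ._+_ block (∑-multiples p m (λ i → f (p ℕ.+ i)) shifted) ⟩
  f (1 ℕ.* p) ℤ.+ ∑ m (λ d → f (suc d ℕ.* p)) ∎
  where
  open ≡-Reasoning
  shifted : ∀ i → ¬ p ∣ suc i → f (p ℕ.+ suc i) ≡ 0ℤ
  shifted i p∤ = vanish (p′ ℕ.+ suc i) λ p∣ → p∤ (∣m+n∣m⇒∣n p∣ ∣-refl)
  block : ∑ p f ≡ f (1 ℕ.* p)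
  block = begin
    ∑ p f                  ≡⟨ ∑-last p′ f ⟩
    ∑ p′ f ℤ.+ f p
        ≡⟨ cong (ℤ._+ f p) (∑-zero-upto p′ λ i i<p′ → vanish i λ p∣ → ℕ.<⇒≱ (s≤s i<p′) (∣⇒≤ p∣)) ⟩
    0ℤ ℤ.+ f p             ≡⟨ ℤ.+-identityˡ (f p) ⟩
    f p                    ≡⟨ cong f (ℕ.*-identityˡ p) ⟨
    f (1 ℕ.* p) ∎

whenDivides unlessDivides : ℕ → ℕ → ℤ → ℤ
whenDivides p d z with p ∣? d
... | yes _ = z
... | no  _ = 0ℤ
unlessDivides p d z with p ∣? d
... | yes _ = 0ℤ
... | no  _ = z

when+unless : ∀ p d z → z ≡ whenDivides p d z ℤ.+ unlessDivides p d z
when+unless p d z with p ∣? d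
... | yes _ = sym (ℤ.+-identityʳ z)
... | no  _ = sym (ℤ.+-identityˡ z)

when-∣ : ∀ {p d} z → p ∣ d → whenDivides p d z ≡ z
when-∣ {p} {d} z p∣d with p ∣? d
... | yes _  = refl
... | no p∤d = contradiction p∣d p∤d

when-∤ : ∀ {p d} z → ¬ p ∣ d → whenDivides p d z ≡ 0ℤ
when-∤ {p} {d} z p∤d with p ∣? d
... | yes p∣d = contradiction p∣d p∤d
... | no _    = refl

unless-∣ : ∀ {p d} z → p ∣ d → unlessDivides p d z ≡ 0ℤ
unless-∣ {p} {d} z p∣d with p ∣? d
... | yes _  = refl
... | no p∤d = contradiction p∣d p∤d

unless-∤ : ∀ {p d} z → ¬ p ∣ d → unlessDivides p d z ≡ z
unless-∤ {p} {d} z p∤d with p ∣? d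
... | yes p∣d = contradiction p∣d p∤d
... | no _    = refl

δ-scale : ∀ p .{{_ : ℕ.NonZero p}} i n → δ (i ℕ.* p) (n ℕ.* p) ≡ δ i n
δ-scale p i n with i ℕ.≟ n
... | yes refl = trans (δ-refl (i ℕ.* p)) (sym (δ-refl i))
... | no i≢n   = trans (δ-≢ (i≢n ∘ ℕ.*-cancelʳ-≡ i n p)) (sym (δ-≢ i≢n))

-- The factorisations de = mp are split by whether p divides d. If it does, p is cancelled from d;
-- if not, Euclid's lemma puts p into e, where it is cancelled. Either way a factorisation of m
-- remains.
divisorSum-*-prime : ∀ {p} → Prime p → ∀ m β → divisorSum β (m ℕ.* p) ≡
  divisorSum (λ d e → β (d ℕ.* p) e) m ℤ.+ divisorSum (λ d e → unlessDivides p d (β d (e ℕ.* p))) m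
divisorSum-*-prime {p} p-prime m β = begin
  ∑₂ n (λ d e → δ (d ℕ.* e) n ℤ.* β d e)
    ≡⟨ ∑₂-cong n
        (λ d e → trans
        (cong (λ z → δ (suc d ℕ.* suc e) n ℤ.* z) (when+unless p (suc d) (β (suc d) (suc e))))
         (ℤ.*-distribˡ-+ (δ (suc d ℕ.* suc e) n) _ _)) ⟩
  ∑₂ n (λ d e → δ (d ℕ.* e) n ℤ.* whenDivides p d (β d e) ℤ.+ δ (d ℕ.* e) n ℤ.* unlessDivides p d
      (β d e))
    ≡⟨ ∑₂-+ n _ _ ⟩
  ∑₂ n (λ d e → δ (d ℕ.* e) n ℤ.* whenDivides p d (β d e)) ℤ.+ ∑₂
      n (λ d e → δ (d ℕ.* e) n ℤ.* unlessDivides p d (β d e))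
    ≡⟨ cong₂ ℤ._+_ divisible coprime ⟩
  _ ∎
  where
  open ≡-Reasoning
  instance
    _ = prime⇒nonZero p-prime
  n : ℕ
  n = m ℕ.* p
  m≤n : m ℕ.≤ n
  m≤n = ℕ.m≤m*n m p
  large : ∀ {i} → m ℕ.< i → δ (i ℕ.* p) n ≡ 0ℤ
  large {i} m<i = trans (δ-scale p i m) (δ-> m<i)
  divisible : ∑₂ n (λ d e → δ (d ℕ.* e) n ℤ.* whenDivides p d (β d e))
      ≡ divisorSum (λ d e → β (d ℕ.* p) e) m
  divisible = begin
    ∑₂ n (λ d e → δ (d ℕ.* e) n ℤ.* whenDivides p d (β d e))
      ≡⟨ ∑-multiples p m (λ d → ∑ n λ e → δ (d ℕ.* e) n ℤ.* whenDivides p d (β d e))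
           (λ d p∤ → ∑-zero n λ e → trans
               (cong (λ z → δ (suc d ℕ.* suc e) n ℤ.* z) (when-∤ (β (suc d) (suc e)) p∤))
               (ℤ.*-zeroʳ (δ (suc d ℕ.* suc e) n))) ⟩
    (∑ m λ d → ∑ n λ e → δ (d ℕ.* p ℕ.* e) n ℤ.* whenDivides p (d ℕ.* p) (β (d ℕ.* p) e))
      ≡⟨ ∑-cong m (λ d → trans (∑-cong n λ e → cong₂ ℤ._*_
             (trans (cong (λ z → δ z n) (swap (suc d) p (suc e))) (δ-scale p (suc d ℕ.* suc e) m))
             (when-∣ (β (suc d ℕ.* p) (suc e)) (n∣m*n (suc d))))
           (∑-extend (λ e → δ (suc d ℕ.* e) m ℤ.* β (suc d ℕ.* p) e) m≤n
             λ e m≤e → 0*-when (β (suc d ℕ.* p) (suc e))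
                 (δ-> (ℕ.≤-trans (s≤s m≤e) (ℕ.m≤n*m (suc e) (suc d)))))) ⟩
    divisorSum (λ d e → β (d ℕ.* p) e) m ∎
    where
    swap : ∀ d p e → d ℕ.* p ℕ.* e ≡ d ℕ.* e ℕ.* p
    swap = ℕ-Solver.solve-∀
  coprime : ∑₂ n (λ d e → δ (d ℕ.* e) n ℤ.* unlessDivides p d (β d e))
      ≡ divisorSum (λ d e → unlessDivides p d (β d (e ℕ.* p))) m
  coprime = begin
    ∑₂ n (λ d e → δ (d ℕ.* e) n ℤ.* unlessDivides p d (β d e))
      ≡⟨ ∑-cong n (λ d → ∑-multiples p m
          (λ e → δ (suc d ℕ.* e) n ℤ.* unlessDivides p (suc d) (β (suc d) e)) (vanish d)) ⟩
    (∑ n λ d → ∑ m λ e → δ (d ℕ.* (e ℕ.* p)) n ℤ.* unlessDivides p d (β d (e ℕ.* p)))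
      ≡⟨ ∑-cong n (λ d → ∑-cong m λ e → cong
          (λ z → z ℤ.* unlessDivides p (suc d) (β (suc d) (suc e ℕ.* p)))
           (trans (cong (λ z → δ z n) (sym (ℕ.*-assoc (suc d) (suc e) p)))
               (δ-scale p (suc d ℕ.* suc e) m))) ⟩
    (∑ n λ d → ∑ m λ e → δ (d ℕ.* e) m ℤ.* unlessDivides p d (β d (e ℕ.* p)))
      ≡⟨ ∑-extend (λ d → ∑ m λ e → δ (d ℕ.* e) m ℤ.* unlessDivides p d (β d (e ℕ.* p))) m≤n
           (λ d m≤d → ∑-zero m λ e → 0*-when _
               (δ-> (ℕ.<-≤-trans (s≤s m≤d) (ℕ.m≤m*n (suc d) (suc e))))) ⟩
    divisorSum (λ d e → unlessDivides p d (β d (e ℕ.* p))) m ∎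
    where
    vanish : ∀ d e → ¬ p ∣ suc e → δ (suc d ℕ.* suc e) n ℤ.* unlessDivides p (suc d) (β (suc d) (suc e))
        ≡ 0ℤ
    vanish d e p∤e with suc d ℕ.* suc e ℕ.≟ n
    ... | no de≢n = 0*-when _ (δ-≢ de≢n)
    ... | yes de≡n with euclidsLemma (suc d) (suc e) p-prime (divides m de≡n)
    ... | inj₁ p∣d = trans (cong (λ z → δ (suc d ℕ.* suc e) n ℤ.* z) (unless-∣ (β (suc d) (suc e)) p∣d))
        (ℤ.*-zeroʳ (δ (suc d ℕ.* suc e) n))
    ... | inj₂ p∣e = contradiction p∣e p∤e

∑-cong₅ : ∀ N {f g} → (∀ i → f (suc i) ≡₅ g (suc i)) → ∑ N f ≡₅ ∑ N g
∑-cong₅ zero    p = ≡₅-refl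
∑-cong₅ (suc N) p = +-cong₅ (p 0) (∑-cong₅ N (p ∘ suc))

divisorSum-cong₅ : ∀ n {β γ} → (∀ d e → β (suc d) (suc e) ≡₅ γ (suc d) (suc e)) → divisorSum β n ≡₅
    divisorSum γ n
divisorSum-cong₅ n p = ∑-cong₅ n λ d → ∑-cong₅ n λ e → *-cong₅ (≡₅-refl {δ (suc d ℕ.* suc e) n}) (p d e)

σ-*-odd : ∀ {p} → σ p ≡ ℤ.- 1ℤ → ∀ n → σ (n ℕ.* p) ≡ σ n
σ-*-odd {p} odd zero    = refl
σ-*-odd {p} odd (suc n) = begin
  σ (p ℕ.+ n ℕ.* p)         ≡⟨ σ-+ p (n ℕ.* p) ⟩
  σ p ℤ.* σ (n ℕ.* p)       ≡⟨ cong₂ ℤ._*_ odd (σ-*-odd odd n) ⟩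
  ℤ.- 1ℤ ℤ.* σ n            ≡⟨ ℤ.-1*i≡-i (σ n) ⟩
  ℤ.- σ n                   ∎
  where open ≡-Reasoning

-- The weight contains the factor d, so factorisations with 5 dividing d count for nothing modulo 5
-- and may be dropped or restored. For the others e is multiplied by 5, which is odd and preserves
-- the sign.
signedSum-5 : ∀ n → signedSum (n ℕ.* 5) ≡₅ signedSum n
signedSum-5 n = ≡₅-trans (≡⇒≡₅ (divisorSum-*-prime (toWitness {a? = prime? 5} _) n β))
  (≡₅-trans (+-cong₅
      (≡₅-trans (divisorSum-cong₅ n {γ = λ _ _ → 0ℤ} multiple)
      (≡⇒≡₅ (∑-zero n λ d → ∑-zero n λ e → ℤ.*-zeroʳ (δ (suc d ℕ.* suc e) n))))
    (divisorSum-cong₅ n {γ = β} rest)) (≡⇒≡₅ (ℤ.+-identityˡ _)))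
  where
  β : ℕ → ℕ → ℤ
  β d e = ℤ.- (σ d ℤ.* σ e ℤ.* + d)
  five : ∀ d s → ℤ.- (s ℤ.* + (d ℕ.* 5)) ≡₅ 0ℤ
  five d s = mod₅ (ℤ.- (s ℤ.* + d)) (trans (cong (λ z → ℤ.- (s ℤ.* z)) (ℤ.pos-* d 5)) (lemma s (+ d)))
    where
    lemma : ∀ s d → ℤ.- (s ℤ.* (d ℤ.* + 5)) ≡ 0ℤ ℤ.+ + 5 ℤ.* (ℤ.- (s ℤ.* d))
    lemma = solve-∀
  multiple : ∀ d e → β (suc d ℕ.* 5) (suc e) ≡₅ 0ℤ
  multiple d e = five (suc d) (σ (suc d ℕ.* 5) ℤ.* σ (suc e))
  rest : ∀ d e → unlessDivides 5 (suc d) (β (suc d) (suc e ℕ.* 5)) ≡₅ β (suc d) (suc e)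
  rest d e with 5 ∣? suc d
  ... | yes (divides k eq) = ≡₅-sym
      (≡₅-trans (≡⇒≡₅ (cong (λ z → ℤ.- (σ (suc d) ℤ.* σ (suc e) ℤ.* + z)) eq))
      (five k (σ (suc d) ℤ.* σ (suc e))))
  ... | no _ = ≡⇒≡₅ (cong (λ z → ℤ.- (σ (suc d) ℤ.* z ℤ.* + suc d)) (σ-*-odd {5} refl (suc e)))

-- As p does not divide m, neither does it divide any divisor d of m. So each d gives two divisors
-- of mp, d and dp, with equal signs because p is odd, and with cubes d³ and p³d³.
cubeSum-*-prime : ∀ {p} → Prime p → σ p ≡ ℤ.- 1ℤ → ∀ {m} → ¬ p ∣ m →
  cubeSum (m ℕ.* p) ≡ (+ p ℤ.* + p ℤ.* + p ℤ.+ 1ℤ) ℤ.* cubeSum m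
cubeSum-*-prime {p} p-prime odd {m} p∤m = begin
  cubeSum (m ℕ.* p)
    ≡⟨ divisorSum-*-prime p-prime m β ⟩
  divisorSum (λ d e → β (d ℕ.* p) e) m ℤ.+ divisorSum (λ d e → unlessDivides p d (β d (e ℕ.* p))) m
    ≡⟨ cong₂ ℤ._+_
        (trans (∑₂-cong m λ d e → trans
        (cong₂ (λ s x → δ (suc d ℕ.* suc e) m ℤ.* (s ℤ.* (x ℤ.* x ℤ.* x))) (σ-*-odd {p} odd (suc d))
        (ℤ.pos-* (suc d) p))
           (lemma (δ (suc d ℕ.* suc e) m) (σ (suc d)) (+ suc d) (+ p)))
               (∑₂-*ˡ m (+ p ℤ.* + p ℤ.* + p) (λ d e → δ (d ℕ.* e) m ℤ.* β d e)))
         (∑₂-cong m coprime) ⟩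
  + p ℤ.* + p ℤ.* + p ℤ.* cubeSum m ℤ.+ cubeSum m
    ≡⟨ collect (+ p) (cubeSum m) ⟩
  _ ∎
  where
  open ≡-Reasoning
  β : ℕ → ℕ → ℤ
  β d e = σ d ℤ.* (+ d ℤ.* + d ℤ.* + d)
  lemma : ∀ δ s d p → δ ℤ.* (s ℤ.* (d ℤ.* p ℤ.* (d ℤ.* p) ℤ.* (d ℤ.* p)))
      ≡ p ℤ.* p ℤ.* p ℤ.* (δ ℤ.* (s ℤ.* (d ℤ.* d ℤ.* d)))
  lemma = solve-∀
  collect : ∀ p c → p ℤ.* p ℤ.* p ℤ.* c ℤ.+ c ≡ (p ℤ.* p ℤ.* p ℤ.+ 1ℤ) ℤ.* c
  collect = solve-∀
  coprime : ∀ d e → δ (suc d ℕ.* suc e) m ℤ.* unlessDivides p (suc d) (β (suc d) (suc e ℕ.* p))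
      ≡ δ (suc d ℕ.* suc e) m ℤ.* β (suc d) (suc e)
  coprime d e with suc d ℕ.* suc e ℕ.≟ m
  ... | yes refl = cong (λ z → δ (suc d ℕ.* suc e) m ℤ.* z)
      (unless-∤ _ λ p∣d → p∤m (∣-trans p∣d (m∣m*n (suc e))))
  ... | no de≢m  = trans (0*-when _ (δ-≢ de≢m)) (sym (0*-when _ (δ-≢ de≢m)))

-- The generating function at multiples of 5

F-5 : ∀ n → F (n ℕ.* 5) ≡₅ F n
F-5 zero    = ≡₅-refl
F-5 (suc n) = +-cong₅ (≡₅-refl {0ℤ}) (≡₅-trans (≡⇒≡₅ (const-⊗ (+ 8) signedSum (suc n ℕ.* 5)))
  (≡₅-trans (*-cong₅ (≡₅-refl {+ 8}) (signedSum-5 (suc n)))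
      (≡⇒≡₅ (sym (const-⊗ (+ 8) signedSum (suc n))))))

overpartitions₂₅-5 : ∀ n → overpartitions 25 (n ℕ.* 5) ≡₅ const 1ℤ n ℤ.+ + 16 ℤ.* cubeSum n
overpartitions₂₅-5 n = ≡₅-trans (overpartitions₂₅ (n ℕ.* 5)) (≡₅-trans (≡⇒≡₅ (dilate-⊗-multiple F F n))
  (≡₅-trans (⊗-cong₅ {f = F} (λ _ → ≡₅-refl) F-5 n)
    (≡⇒≡₅ (trans (F-square n) (cong (λ z → const 1ℤ n ℤ.+ z) (const-⊗ (+ 16) cubeSum n))))))

≡₅0⇒5∣ : ∀ {n} → + n ≡₅ 0ℤ → 5 ∣ n
≡₅0⇒5∣ {n} (mod₅ k eq) = divides ℤ.∣ k ∣ (begin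
  n                          ≡⟨ cong ℤ.∣_∣ eq ⟩
  ℤ.∣ 0ℤ ℤ.+ + 5 ℤ.* k ∣     ≡⟨ cong ℤ.∣_∣ (ℤ.+-identityˡ (+ 5 ℤ.* k)) ⟩
  ℤ.∣ + 5 ℤ.* k ∣            ≡⟨ ℤ.abs-* (+ 5) k ⟩
  5 ℕ.* ℤ.∣ k ∣              ≡⟨ ℕ.*-comm 5 ℤ.∣ k ∣ ⟩
  ℤ.∣ k ∣ ℕ.* 5              ∎)
  where open ≡-Reasoning

theorem7 : (p : ℕ) → Prime p → p % 10 ≡ 9 → (n i : ℕ) → 1 ≤ i → i < p →
    5 ∣ Abar 25 (5 * p * (p * n + i))
theorem7 p p-prime p%10≡9 n i 1≤i i<p = subst (λ k → 5 ∣ Abar 25 k) (index p m)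
  (≡₅0⇒5∣ (≡₅-trans (overpartitions₂₅-5 (m * p))
    (+-cong₅ (≡⇒≡₅ (constant (m * p)))
      (*-cong₅ (≡₅-refl {+ 16}) (≡₅-trans (≡⇒≡₅ (cubeSum-*-prime p-prime odd p∤m))
        (*-cong₅ (cube+1 (+ q) p≡′) (≡₅-refl {cubeSum m})))))))
  where
  m q : ℕ
  m = p * n + i
  q = p ℕ./ 10
  instance
    _ = prime⇒nonZero p-prime
    _ = ℕ.>-nonZero (ℕ.≤-trans 1≤i (ℕ.m≤n+m i (p * n)))
    _ = ℕ.m*n≢0 m p
  index : ∀ p m → m * p * 5 ≡ 5 * p * m
  index = ℕ-Solver.solve-∀
  p≡ : p ≡ 9 + q * 10
  p≡ = trans (ℕ.m≡m%n+[m/n]*n p 10) (cong (_+ q * 10) p%10≡9)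
  p≡′ : + p ≡ + 9 ℤ.+ + q ℤ.* + 10
  p≡′ = trans (cong +_ p≡) (cong (λ z → + 9 ℤ.+ z) (ℤ.pos-* q 10))
  odd : σ p ≡ ℤ.- 1ℤ
  odd = trans (cong σ p≡) (trans (σ-+ 9 (q * 10)) (cong (λ z → ℤ.- 1ℤ ℤ.* z) (even q)))
    where
    even : ∀ q → σ (q * 10) ≡ 1ℤ
    even zero    = refl
    even (suc q) = trans (σ-+ 10 (q * 10)) (trans (ℤ.*-identityˡ _) (even q))
  cube+1 : ∀ {x} q → x ≡ + 9 ℤ.+ q ℤ.* + 10 → x ℤ.* x ℤ.* x ℤ.+ 1ℤ ≡₅ 0ℤ
  -- The witness is a fifth of the factorisation x³ + 1 = (x + 1)(x(x - 1) + 1), where x + 1 = 10(q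
  -- + 1).
  cube+1 q refl = mod₅ (+ 2 ℤ.* (q ℤ.+ 1ℤ) ℤ.* ((+ 9 ℤ.+ q ℤ.* + 10) ℤ.* (+ 8 ℤ.+ q ℤ.* + 10) ℤ.+ 1ℤ))
      (lemma q)
    where
    lemma : ∀ q → (+ 9 ℤ.+ q ℤ.* + 10) ℤ.* (+ 9 ℤ.+ q ℤ.* + 10) ℤ.* (+ 9 ℤ.+ q ℤ.* + 10) ℤ.+ 1ℤ ≡
      0ℤ ℤ.+ + 5 ℤ.* (+ 2 ℤ.* (q ℤ.+ 1ℤ) ℤ.* ((+ 9 ℤ.+ q ℤ.* + 10) ℤ.* (+ 8 ℤ.+ q ℤ.* + 10) ℤ.+ 1ℤ))
    lemma = solve-∀
  p∤m : ¬ p ∣ m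
  p∤m p∣m = ℕ.<⇒≱ i<p (∣⇒≤ {{ℕ.>-nonZero 1≤i}} (∣m+n∣m⇒∣n p∣m (m∣m*n n)))
  constant : ∀ k .{{_ : ℕ.NonZero k}} → const 1ℤ k ≡ 0ℤ
  constant (suc k) = refl
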